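{- Let $k\ge2$ and let $\mathcal{G}$ and $\mathcal{F}$ be $k$-uniform hypergraphs. Then for any positive integer $s$, $ex_{\mathcal{F}}(n,\mathcal{G}(s))=ex_{\mathcal{F}}(n,\mathcal{G})+o(n^k)$.
   Context: For $k$-uniform hypergraphs $\mathcal{F}$ and $\mathcal{G}$, consider $n$-vertex $k$-uniform hypergraphs $\mathcal{R}$ whose edge set is the union of pairwise edge-disjoint subhypergraphs each isomorphic to $\mathcal{F}$ (called $\mathcal{F}$-copies; each is thought of as a single colour). A subhypergraph of $\mathcal{R}$ is rainbow if its edges come from pairwise distinct $\mathcal{F}$-copies. $ex_{\mathcal{F}}(n,\mathcal{G})$ is the maximum number of $\mathcal{F}$-copies in such an $n$-vertex $\mathcal{R}$ with no rainbow copy of $\mathcal{G}$. The $s$-blowup $\mathcal{G}(s)$ is obtained by replacing each vertex $x$ of $\mathcal{G}$ by $s$ copies $x^1,\dots,x^s$ and each edge $\{x_1,\dots,x_k\}$ by the $s^k$ edges $\{x_1^{a_1},\dots,x_k^{a_k}\}$, $a_i\in[s]$. -}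

module Defs where

open import Data.Nat using (ℕ; _*_)
open import Data.Fin using (Fin; combine) renaming (_≟_ to _≟ᶠ_)
open import Data.Fin.Properties using (any?)
open import Data.Fin.Subset using (Subset; _∈_; ∣_∣)
open import Data.Fin.Subset.Properties using (_∈?_)
open import Data.Vec using (tabulate)
open import Data.Product using (Σ; _×_; _,_)
open import Relation.Nullary using (¬_)
open import Relation.Nullary.Decidable using (⌊_⌋; _×-dec_)
open import Relation.Binary.PropositionalEquality using (_≡_; _≢_)
open import Function.Definitions using (Injective)

record Hypergraph : Set₁ where
  field
    V : ℕ
    E : Subset V → Set
open Hypergraph public

Uniform : ℕ → Hypergraph → Set
Uniform k H = ∀ e → E H e → ∣ e ∣ ≡ k

image : ∀ {m n} → (Fin m → Fin n) → Subset m → Subset n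
image {m} {n} φ S = tabulate λ y → ⌊ any? (λ x → (x ∈? S) ×-dec (φ x ≟ᶠ y)) ⌋

-- The s-blowup G(s): vertex (x , a) with x ∈ V(G), a ∈ [s] is encoded as
-- combine x a : Fin (V * s).  Edges: {x₁^{a₁},…,x_k^{a_k}} for an edge
-- {x₁,…,x_k} of G and arbitrary choices a_i (given by a function c).
blowup : Hypergraph → ℕ → Hypergraph
blowup G s = record
  { V = V G * s
  ; E = λ T → Σ (Subset (V G)) λ e → E G e ×
               Σ (Fin (V G) → Fin s) λ c → T ≡ image (λ x → combine x (c x)) e
  }

-- An n-vertex hypergraph R given as the union of c pairwise edge-disjoint
-- F-copies (the colours are the indices Fin c).  Copy i is the image of F
-- under the injective vertex map emb i.
record Packing (F : Hypergraph) (n c : ℕ) : Set₁ where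
  field
    emb  : Fin c → Fin (V F) → Fin n
    inj  : ∀ i → Injective _≡_ _≡_ (emb i)
    disj : ∀ i j → i ≢ j → ∀ f f' → E F f → E F f' →
           image (emb i) f ≢ image (emb j) f'
open Packing public

record Rainbow (G : Hypergraph) {F : Hypergraph} {n c : ℕ}
               (P : Packing F n c) : Set where
  field
    ψ      : Fin (V G) → Fin n
    ψ-inj  : Injective _≡_ _≡_ ψ
    col    : ∀ e → E G e → Fin c
    fedge  : ∀ e → E G e → Subset (V F)
    fedgeE : ∀ e p → E F (fedge e p)
    match  : ∀ e p → image ψ e ≡ image (emb P (col e p)) (fedge e p)
    col-inj : ∀ e p e' p' → col e p ≡ col e' p' → e ≡ e'

IsEx : Hypergraph → Hypergraph → ℕ → ℕ → Set₁
IsEx F G n x =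
  (Σ (Packing F n x) λ P → ¬ Rainbow G P) ×
  (∀ c → (P : Packing F n c) → ¬ Rainbow G P → Data.Nat._≤_ c x)

{-# OPTIONS --safe #-}
module Submission where

-- A rainbow copy of G(s) contains one of G, so only the upper bound on ex(n, G(s)) needs an
-- argument.  It is the hypergraph removal lemma for H = G(s).  If a packing is rainbow-H-free,
-- then all but O(1/n) of the homomorphisms from H would be rainbow, so homomorphisms have small
-- density and can be destroyed by deleting few edges, hence few copies of F.  A surviving rainbow
-- copy of G would give, by composition with the projection of H onto G, a homomorphism from H.
--
-- The removal lemma is proved by induction on the level j, the size of the vertex sets J on which
-- the sets of the system depend, for homomorphisms regarded as points of the product space Ω.
-- The statement Cleaning j carries sets Bad I of higher level to be avoided.  In the inductive
-- step a coarse and a fine partition of level j - 1 are chosen, such that densities hardly change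
-- in between, and such that the sets are pseudorandom with respect to the fine partition with an
-- error tiny compared to the complexity of the coarse one.  The places where the densities jump
-- become the bad sets of the previous level.  This avoids any counting lemma for lower levels.
-- Constants are explicit, while the sets that exist once n is given are found up to double
-- negation, which suffices as the conclusion is decidable.

open import Defs

-- The obstacle is the order of the constants: an error can be small only against quantities fixed
-- before it, while the mass of a cell shrinks as its partition grows. Hence every mass is bounded
-- through the coarse partition. By induction a surviving point shares its coarse cell with many
-- points free of jumps, and their measure depends on the coarse complexity only. On this set the
-- fine densities equal the coarse ones up to a jump, so they are bounded below; and since the set
-- is a union of fine cells, its indicator is an admissible test function, relative to which the
-- cells of the next level are counted. The length of the fine partition never enters that estimate.
--
-- That almost all homomorphisms are rainbow uses that `F` is fixed: two edges of one colour force a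
-- vertex outside one of them into the `V F` vertices of the copy which that edge determines.
-- Deleting an edge costs a single copy of `F`, because copies are edge-disjoint.

module Removal where

  open import Data.Bool as Bool using (Bool; true; false; _∧_; _∨_; not)
  open import Data.Empty using (⊥-elim)
  open import Data.Fin using (Fin; zero; suc; combine; remQuot; _≟_)
  open import Data.Fin.Properties using (any?; suc-injective; 0≢1+n; remQuot-combine; combine-injectiveˡ)
  open import Data.Fin.Subset using (Subset; _⊆_; ∣_∣; _∩_; ⊤) renaming (_∈_ to _∈ₛ_; _∉_ to _∉ₛ_)
  open import Data.Fin.Subset.Properties using (_⊆?_; _∈?_; p∩q⊆p; p∩q⊆q; x∈p∩q⁺; ⊆⊤; ⊆-antisym; ⊆-trans; p⊂q⇒∣p∣<∣q∣; ∣p∣≤∣x∷p∣; ∣p∩q∣≤∣p∣; x∈p∧x≢y⇒x∈p-y; x∈p⇒∣p-x∣<∣p∣; anySubset?; drop-∷-⊆; s⊆s)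
  import Data.Integer as ℤ
  import Data.Integer.Properties as ℤₚ
  open import Data.List as List using (List; []; _∷_; _++_; length; map; filter; cartesianProduct; allFin)
  open import Data.List.Membership.Propositional using (_∈_)
  open import Data.List.Membership.Propositional.Properties using (∈-map⁺; ∈-map⁻; ∈-++⁺ˡ; ∈-++⁺ʳ; ∈-++⁻; ∈-filter⁺; ∈-filter⁻; ∈-cartesianProduct⁺; ∈-cartesianProduct⁻; ∈-allFin; ∈-lookup)
  open import Data.List.Properties using (length-map; length-++; length-filter; length-tabulate; ∷-injective) renaming (≡-dec to List-≡-dec)
  import Data.List.Relation.Unary.All as All
  open import Data.List.Relation.Unary.AllPairs using ([]; _∷_)
  open import Data.List.Relation.Unary.Any using (here; there)
  open import Data.List.Relation.Unary.Unique.Propositional using (Unique)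
  import Data.List.Relation.Unary.Unique.Propositional.Properties as Uniqueₚ
  open import Data.Nat as ℕ using (ℕ; zero; suc)
  import Data.Nat.Properties as ℕₚ
  open import Data.Product using (Σ; _×_; _,_; proj₁; proj₂; ∃)
  open import Data.Rational using (ℚ; mkℚ; 0ℚ; 1ℚ; ½; _+_; _*_; _-_; -_; _≤_; _<_; _≤?_; _<?_; 1/_; toℚᵘ; *≤*; *<*; nonNegative; positive)
  open import Data.Rational.Properties hiding (_≟_)
  open import Data.Rational.Solver using (module +-*-Solver)
  import Data.Rational.Unnormalised as ℚᵘ
  import Data.Rational.Unnormalised.Properties as ℚᵘₚ
  open import Data.Sum using (_⊎_; inj₁; inj₂; [_,_]′)
  open import Data.Vec using (Vec; []; _∷_; lookup; here; there; tabulate)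
  open import Data.Vec.Properties using ([]=⇒lookup; lookup⇒[]=; lookup∘tabulate) renaming (≡-dec to Vec-≡-dec)
  open import Function using (_∘_)
  open import Function.Definitions using (Injective)
  open import Relation.Binary.PropositionalEquality using (_≡_; _≢_; refl; sym; trans; cong; cong₂; subst; module ≡-Reasoning)
  open import Relation.Nullary using (¬_; Dec; yes; no; contradiction; ¬?)
  open import Relation.Nullary.Decidable using (⌊_⌋; _×-dec_)
  open +-*-Solver using (solve; _:=_; _:+_; _:*_; _:-_; :-_; con)

  -- Arithmetic of rationals

  -- Once the slack `c` is named, an inequality becomes a ring identity, which the solver decides;
  -- most estimates below are proved in this way.
  ≤-by : ∀ {a b} c → 0ℚ ≤ c → b ≡ a + c → a ≤ b
  ≤-by {a} c h refl = subst (_≤ a + c) (+-identityʳ a) (+-monoʳ-≤ a h)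

  0≤1 : 0ℚ ≤ 1ℚ
  0≤1 = *≤* (ℤ.+≤+ ℕ.z≤n)

  0<1 : 0ℚ < 1ℚ
  0<1 = *<* (ℤ.+<+ (ℕ.s≤s ℕ.z≤n))

  0≤+ : ∀ {a b} → 0ℚ ≤ a → 0ℚ ≤ b → 0ℚ ≤ a + b
  0≤+ = +-mono-≤

  0<+ : ∀ {a b} → 0ℚ < a → 0ℚ ≤ b → 0ℚ < a + b
  0<+ = +-mono-<-≤

  *-monoˡ : ∀ {a b c} → 0ℚ ≤ c → a ≤ b → c * a ≤ c * b
  *-monoˡ {c = c} h = *-monoˡ-≤-nonNeg c {{nonNegative h}}

  *-monoʳ : ∀ {a b c} → 0ℚ ≤ c → a ≤ b → a * c ≤ b * c
  *-monoʳ {c = c} h = *-monoʳ-≤-nonNeg c {{nonNegative h}}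

  0≤* : ∀ {a b} → 0ℚ ≤ a → 0ℚ ≤ b → 0ℚ ≤ a * b
  0≤* {a} {b} ha hb = subst (_≤ a * b) (*-zeroʳ a) (*-monoˡ ha hb)

  *-mono : ∀ {a b c d} → 0ℚ ≤ c → 0ℚ ≤ b → a ≤ b → c ≤ d → a * c ≤ b * d
  *-mono hc hb ab cd = ≤-trans (*-monoʳ hc ab) (*-monoˡ hb cd)

  0<* : ∀ {a b} → 0ℚ < a → 0ℚ < b → 0ℚ < a * b
  0<* {a} {b} ha hb = subst (_< a * b) (*-zeroʳ a) (*-monoʳ-<-pos a {{positive ha}} hb)

  0≤-diff : ∀ {a b} → a ≤ b → 0ℚ ≤ b - a
  0≤-diff {a} {b} h = subst (_≤ b - a) (+-inverseʳ a) (+-monoˡ-≤ (- a) h)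

  diff-≤ : ∀ {a b} → 0ℚ ≤ b - a → a ≤ b
  diff-≤ {a} {b} h = ≤-by (b - a) h (solve 2 (λ a b → b := a :+ (b :- a)) refl a b)

  0≤sq : ∀ a → 0ℚ ≤ a * a
  0≤sq a with ≤-total 0ℚ a
  ... | inj₁ h = 0≤* h h
  ... | inj₂ h = subst (0ℚ ≤_) (solve 1 (λ a → (:- a) :* (:- a) := a :* a) refl a) (0≤* h' h')
    where
    h' : 0ℚ ≤ - a
    h' = neg-antimono-≤ h

  inv : ∀ {q} → 0ℚ < q → Σ ℚ λ r → (0ℚ < r) × (r * q ≡ 1ℚ)
  inv {q} h = r , positive⁻¹ r {{1/pos⇒pos q {{p}}}} , *-inverseˡ q {{nz}}
    where
    p = positive h
    nz = pos⇒nonZero q {{p}}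
    r = (1/ q) {{nz}}

  nat : ℕ → ℚ
  nat zero = 0ℚ
  nat (suc k) = 1ℚ + nat k

  0≤nat : ∀ k → 0ℚ ≤ nat k
  0≤nat zero = ≤-refl
  0≤nat (suc k) = 0≤+ 0≤1 (0≤nat k)

  0<nat-suc : ∀ k → 0ℚ < nat (suc k)
  0<nat-suc k = 0<+ 0<1 (0≤nat k)

  nat-mono : ∀ {k l} → k ℕ.≤ l → nat k ≤ nat l
  nat-mono {l = l} ℕ.z≤n = 0≤nat l
  nat-mono (ℕ.s≤s h) = +-monoʳ-≤ 1ℚ (nat-mono h)

  nat-+ : ∀ k l → nat (k ℕ.+ l) ≡ nat k + nat l
  nat-+ zero l = sym (+-identityˡ (nat l))
  nat-+ (suc k) l = trans (cong (1ℚ +_) (nat-+ k l)) (sym (+-assoc 1ℚ (nat k) (nat l)))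

  nat-* : ∀ k l → nat (k ℕ.* l) ≡ nat k * nat l
  nat-* zero l = sym (*-zeroˡ (nat l))
  nat-* (suc k) l = begin
    nat (l ℕ.+ k ℕ.* l)       ≡⟨ nat-+ l (k ℕ.* l) ⟩
    nat l + nat (k ℕ.* l)     ≡⟨ cong (nat l +_) (nat-* k l) ⟩
    nat l + nat k * nat l     ≡⟨ solve 2 (λ k l → l :+ k :* l := (con 1ℚ :+ k) :* l) refl (nat k) (nat l) ⟩
    (1ℚ + nat k) * nat l      ∎
    where open ≡-Reasoning

  <-nat-cancel : ∀ {k l} → nat k < nat l → k ℕ.< l
  <-nat-cancel {k} {l} h with k ℕₚ.<? l
  ... | yes p = p
  ... | no p = contradiction (nat-mono (ℕₚ.≮⇒≥ p)) (<⇒≱ h)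
    where
    <⇒≱ : ∀ {a b} → a < b → ¬ (b ≤ a)
    <⇒≱ p q = <-irrefl refl (<-≤-trans p q)

  ≤-nat-cancel : ∀ {k l} → nat k ≤ nat l → k ℕ.≤ l
  ≤-nat-cancel {k} {l} h = ℕₚ.≤-pred (<-nat-cancel (≤-<-trans h l<))
    where
    l< : nat l < nat (suc l)
    l< = subst (_< nat (suc l)) (+-identityˡ (nat l)) (+-monoˡ-< (nat l) 0<1)

  toℚᵘ-nat : ∀ k → toℚᵘ (nat k) ℚᵘ.≃ ℚᵘ.mkℚᵘ (ℤ.+ k) 0
  toℚᵘ-nat zero = ℚᵘₚ.≃-refl
  toℚᵘ-nat (suc k) = ℚᵘₚ.≃-trans (toℚᵘ-homo-+ 1ℚ (nat k))
    (ℚᵘₚ.≃-trans (ℚᵘₚ.+-congʳ (toℚᵘ 1ℚ) (toℚᵘ-nat k))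
      (ℚᵘ.*≡* (cong (ℤ._* ℤ.+ 1) (cong (ℤ._+_ (ℤ.+ 1)) (ℤₚ.*-identityʳ (ℤ.+ k))))))

  ceil : ∀ b → Σ ℕ λ K → b < nat K
  ceil b@(mkℚ (ℤ.+ m) d _) = suc m , toℚᵘ-cancel-< (ℚᵘₚ.<-respʳ-≃ (ℚᵘₚ.≃-sym (toℚᵘ-nat (suc m)))
    (ℚᵘ.*<* (ℤₚ.<-≤-trans (ℤₚ.*-monoʳ-<-pos (ℤ.+ 1) (ℤ.+<+ (ℕₚ.n<1+n m)))
       (ℤₚ.*-monoˡ-≤-nonNeg (ℤ.+ suc m) (ℤ.+≤+ (ℕ.s≤s (ℕ.z≤n {d})))))))
  ceil b@(mkℚ ℤ.-[1+ m ] d _) = 0 , *<* (subst (ℤ._< ℤ.+ 0) (sym (ℤₚ.*-identityʳ ℤ.-[1+ m ])) ℤ.-<+)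

  archimedean : ∀ {q} → 0ℚ < q → ∀ b → Σ ℕ λ K → b < nat K * q
  archimedean {q} h b with inv h
  ... | r , r>0 , rq with ceil (b * r)
  ... | K , lt = K , subst (_< nat K * q) eq (*-monoˡ-<-pos q {{positive h}} lt)
    where
    eq : b * r * q ≡ b
    eq = trans (*-assoc b r q) (trans (cong (b *_) rq) (*-identityʳ b))

  min : ∀ {a b} → 0ℚ < a → 0ℚ < b → Σ ℚ λ c → (0ℚ < c) × (c ≤ a) × (c ≤ b)
  min {a} {b} ha hb with ≤-total a b
  ... | inj₁ h = a , ha , ≤-refl , h
  ... | inj₂ h = b , hb , h , ≤-refl

  minUpTo : (f : ℕ → ℚ) → (∀ i → 0ℚ < f i) → ∀ M → Σ ℚ λ c → (0ℚ < c) × (∀ i → i ℕ.≤ M → c ≤ f i)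
  minUpTo f pos zero = f 0 , pos 0 , λ { .zero ℕ.z≤n → ≤-refl }
  minUpTo f pos (suc M) with minUpTo f pos M
  ... | c , c>0 , le with min c>0 (pos (suc M))
  ... | d , d>0 , dc , df = d , d>0 , λ i i≤ → go i (ℕₚ.m≤n⇒m<n∨m≡n i≤)
    where
    go : ∀ i → (i ℕ.< suc M) ⊎ (i ≡ suc M) → d ≤ f i
    go i (inj₁ (ℕ.s≤s h)) = ≤-trans dc (le i h)
    go i (inj₂ refl) = df

  sq-cancel-< : ∀ {d s} → 0ℚ < s → d * d < s * s → d < s
  sq-cancel-< {d} {s} hs h with d <? s
  ... | yes p = p
  ... | no p = contradiction (≤-<-trans (*-mono (<⇒≤ hs) (≤-trans (<⇒≤ hs) sd) sd sd) h) (<-irrefl refl)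
    where
    sd : s ≤ d
    sd = ≮⇒≥ p


  -- Averages over finite product spaces

  sumF : ∀ {n} → (Fin n → ℚ) → ℚ
  sumF {zero} f = 0ℚ
  sumF {suc n} f = f zero + sumF (f ∘ suc)

  -- Exchange of summations is proved once for every functional with these laws, and then used for
  -- `avg`, `𝔼` and `sumL` alike.
  record Linear {A : Set} (Φ : (A → ℚ) → ℚ) : Set where
    field
      Φ-cong : ∀ {f g} → (∀ a → f a ≡ g a) → Φ f ≡ Φ g
      Φ-+ : ∀ f g → Φ (λ a → f a + g a) ≡ Φ f + Φ g
      Φ-* : ∀ c f → Φ (λ a → c * f a) ≡ c * Φ f

  sumF-cong : ∀ {n} {f g : Fin n → ℚ} → (∀ a → f a ≡ g a) → sumF f ≡ sumF g
  sumF-cong {zero} h = refl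
  sumF-cong {suc n} h = cong₂ _+_ (h zero) (sumF-cong (h ∘ suc))

  sumF-+ : ∀ {n} (f g : Fin n → ℚ) → sumF (λ a → f a + g a) ≡ sumF f + sumF g
  sumF-+ {zero} f g = refl
  sumF-+ {suc n} f g = trans (cong (f zero + g zero +_) (sumF-+ (f ∘ suc) (g ∘ suc)))
    (solve 4 (λ a b c d → a :+ b :+ (c :+ d) := a :+ c :+ (b :+ d)) refl (f zero) (g zero) (sumF (f ∘ suc)) (sumF (g ∘ suc)))

  sumF-* : ∀ {n} c (f : Fin n → ℚ) → sumF (λ a → c * f a) ≡ c * sumF f
  sumF-* {zero} c f = sym (*-zeroʳ c)
  sumF-* {suc n} c f = trans (cong (c * f zero +_) (sumF-* c (f ∘ suc))) (sym (*-distribˡ-+ c (f zero) (sumF (f ∘ suc))))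

  sumF-mono : ∀ {n} {f g : Fin n → ℚ} → (∀ a → f a ≤ g a) → sumF f ≤ sumF g
  sumF-mono {zero} h = ≤-refl
  sumF-mono {suc n} h = +-mono-≤ (h zero) (sumF-mono (h ∘ suc))

  sumF-const : ∀ {n} c → sumF {n} (λ _ → c) ≡ nat n * c
  sumF-const {zero} c = sym (*-zeroˡ c)
  sumF-const {suc n} c = trans (cong (c +_) (sumF-const {n} c)) (solve 2 (λ n c → c :+ n :* c := (con 1ℚ :+ n) :* c) refl (nat n) c)

  sumF-nonneg : ∀ {n} {f : Fin n → ℚ} → (∀ a → 0ℚ ≤ f a) → 0ℚ ≤ sumF f
  sumF-nonneg {zero} h = ≤-refl
  sumF-nonneg {suc n} h = 0≤+ (h zero) (sumF-nonneg (h ∘ suc))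

  term≤sumF : ∀ {n} {f : Fin n → ℚ} → (∀ a → 0ℚ ≤ f a) → ∀ a → f a ≤ sumF f
  term≤sumF {f = f} h zero = ≤-by _ (sumF-nonneg (h ∘ suc)) refl
  term≤sumF {f = f} h (suc a) = ≤-trans (term≤sumF (h ∘ suc) a) (≤-by (f zero) (h zero) (+-comm (f zero) _))

  opaque
    -- This is 1/(n+1). The shift makes it total, and it still serves to share a budget among `n`
    -- summands, as `nat n * recip n ≤ 1ℚ`.
    recip : ℕ → ℚ
    recip n = proj₁ (inv (0<nat-suc n))

    0<recip : ∀ n → 0ℚ < recip n
    0<recip n = proj₁ (proj₂ (inv (0<nat-suc n)))

    recip-inv : ∀ n → recip n * nat (suc n) ≡ 1ℚ
    recip-inv n = proj₂ (proj₂ (inv (0<nat-suc n)))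

  opaque
    avg : ∀ {n} → (Fin (suc n) → ℚ) → ℚ
    avg {n} f = recip n * sumF f

    avg-linear : ∀ {n} → Linear (avg {n})
    avg-linear {n} = record
      { Φ-cong = λ h → cong (recip n *_) (sumF-cong h)
      ; Φ-+ = λ f g → trans (cong (recip n *_) (sumF-+ f g)) (*-distribˡ-+ (recip n) _ _)
      ; Φ-* = λ c f → trans (cong (recip n *_) (sumF-* c f)) (solve 3 (λ r c s → r :* (c :* s) := c :* (r :* s)) refl (recip n) c (sumF f))
      }

    avg-mono : ∀ {n} {f g : Fin (suc n) → ℚ} → (∀ a → f a ≤ g a) → avg f ≤ avg g
    avg-mono {n} h = *-monoˡ (<⇒≤ (0<recip n)) (sumF-mono h)

    avg-const : ∀ {n} c → avg {n} (λ _ → c) ≡ c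
    avg-const {n} c = trans (cong (recip n *_) (sumF-const {suc n} c))
      (trans (sym (*-assoc (recip n) (nat (suc n)) c)) (trans (cong (_* c) (recip-inv n)) (*-identityˡ c)))

    avg-pos : ∀ {n} {f : Fin (suc n) → ℚ} → (∀ a → 0ℚ ≤ f a) → ∀ a → 0ℚ < f a → 0ℚ < avg f
    avg-pos {n} h a p = 0<* (0<recip n) (<-≤-trans p (term≤sumF h a))

  -- The points are the maps, injective or not, from `v` vertices to `suc n` vertices; the successor
  -- keeps the uniform measure defined.
  Ω : ℕ → ℕ → Set
  Ω n v = Vec (Fin (suc n)) v

  opaque
    𝔼 : ∀ {n v} → (Ω n v → ℚ) → ℚ
    𝔼 {v = zero} f = f []
    𝔼 {v = suc v} f = avg (λ a → 𝔼 (λ x → f (a ∷ x)))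

  open Linear

  opaque
    unfolding 𝔼

    𝔼-linear : ∀ {n v} → Linear (𝔼 {n} {v})
    𝔼-linear {v = zero} = record { Φ-cong = λ h → h [] ; Φ-+ = λ _ _ → refl ; Φ-* = λ _ _ → refl }
    𝔼-linear {n} {suc v} = record
      { Φ-cong = λ h → Φ-cong avg-linear (λ a → Φ-cong (𝔼-linear {n} {v}) (λ x → h (a ∷ x)))
      ; Φ-+ = λ f g → trans (Φ-cong avg-linear (λ a → Φ-+ (𝔼-linear {n} {v}) (λ x → f (a ∷ x)) (λ x → g (a ∷ x)))) (Φ-+ avg-linear _ _)
      ; Φ-* = λ c f → trans (Φ-cong avg-linear (λ a → Φ-* (𝔼-linear {n} {v}) c (λ x → f (a ∷ x)))) (Φ-* avg-linear c _)
      }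

  module _ {n v : ℕ} where
    open Linear (𝔼-linear {n} {v}) public renaming (Φ-cong to 𝔼-cong; Φ-+ to 𝔼-+; Φ-* to 𝔼-*)

  opaque
    unfolding 𝔼

    𝔼-mono : ∀ {n v} {f g : Ω n v → ℚ} → (∀ x → f x ≤ g x) → 𝔼 f ≤ 𝔼 g
    𝔼-mono {v = zero} h = h []
    𝔼-mono {v = suc v} h = avg-mono (λ a → 𝔼-mono (λ x → h (a ∷ x)))

    𝔼-const : ∀ {n v} c → 𝔼 {n} {v} (λ _ → c) ≡ c
    𝔼-const {v = zero} c = refl
    𝔼-const {n} {suc v} c = trans (Φ-cong avg-linear (λ _ → 𝔼-const {n} {v} c)) (avg-const c)

  𝔼-nonneg : ∀ {n v} {f : Ω n v → ℚ} → (∀ x → 0ℚ ≤ f x) → 0ℚ ≤ 𝔼 f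
  𝔼-nonneg {n} {v} {f} h = subst (_≤ 𝔼 f) (𝔼-const {n} {v} 0ℚ) (𝔼-mono h)

  𝔼-≤c : ∀ {n v} {f : Ω n v → ℚ} {c} → (∀ x → f x ≤ c) → 𝔼 f ≤ c
  𝔼-≤c {n} {v} {f} {c} h = subst (𝔼 f ≤_) (𝔼-const {n} {v} c) (𝔼-mono h)

  opaque
    unfolding 𝔼

    𝔼-pos : ∀ {n v} {f : Ω n v → ℚ} → (∀ x → 0ℚ ≤ f x) → ∀ x → 0ℚ < f x → 0ℚ < 𝔼 f
    𝔼-pos {v = zero} h [] p = p
    𝔼-pos {v = suc v} h (a ∷ x) p = avg-pos (λ b → 𝔼-nonneg (λ y → h (b ∷ y))) a (𝔼-pos (λ y → h (a ∷ y)) x p)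

  𝔼-*ʳ : ∀ {n v} (f : Ω n v → ℚ) c → 𝔼 (λ x → f x * c) ≡ 𝔼 f * c
  𝔼-*ʳ f c = trans (𝔼-cong (λ x → *-comm (f x) c)) (trans (𝔼-* c f) (*-comm c (𝔼 f)))

  𝔼-neg : ∀ {n v} (f : Ω n v → ℚ) → 𝔼 (λ x → - f x) ≡ - 𝔼 f
  𝔼-neg f = trans (𝔼-cong (λ x → neg-1 (f x))) (trans (𝔼-* (- 1ℚ) f) (sym (neg-1 (𝔼 f))))
    where
    neg-1 : ∀ a → - a ≡ (- 1ℚ) * a
    neg-1 = solve 1 (λ a → :- a := (:- con 1ℚ) :* a) refl

  𝔼-- : ∀ {n v} (f g : Ω n v → ℚ) → 𝔼 (λ x → f x - g x) ≡ 𝔼 f - 𝔼 g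
  𝔼-- f g = trans (𝔼-+ f (λ x → - g x)) (cong (_+_ (𝔼 f)) (𝔼-neg g))

  module _ {A : Set} {Φ : (A → ℚ) → ℚ} (L : Linear Φ) where

    Φ-zero : Φ (λ _ → 0ℚ) ≡ 0ℚ
    Φ-zero = trans (Φ-cong L (λ _ → sym (*-zeroˡ 0ℚ))) (trans (Φ-* L 0ℚ (λ _ → 0ℚ)) (*-zeroˡ (Φ (λ _ → 0ℚ))))

    sumF-swap : ∀ {n} (f : Fin n → A → ℚ) → Φ (λ x → sumF (λ a → f a x)) ≡ sumF (λ a → Φ (f a))
    sumF-swap {zero} f = Φ-zero
    sumF-swap {suc n} f = trans (Φ-+ L _ _) (cong (_+_ (Φ (f zero))) (sumF-swap (f ∘ suc)))

    opaque
      unfolding avg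

      avg-swap : ∀ {n} (f : Fin (suc n) → A → ℚ) → Φ (λ x → avg (λ a → f a x)) ≡ avg (λ a → Φ (f a))
      avg-swap {n} f = trans (Φ-* L (recip n) _) (cong (recip n *_) (sumF-swap f))

    opaque
      unfolding 𝔼

      𝔼-swap : ∀ {n v} (f : Ω n v → A → ℚ) → Φ (λ x → 𝔼 (λ y → f y x)) ≡ 𝔼 (λ y → Φ (f y))
      𝔼-swap {v = zero} f = refl
      𝔼-swap {v = suc v} f = trans (avg-swap (λ a x → 𝔼 (λ y → f (a ∷ y) x)))
        (Φ-cong avg-linear (λ a → 𝔼-swap (λ y → f (a ∷ y))))

  -- Conditional expectations on product spaces

  _≈[_]_ : ∀ {n v} → Ω n v → Subset v → Ω n v → Set
  x ≈[ I ] y = ∀ i → i ∈ₛ I → lookup x i ≡ lookup y i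

  mix : ∀ {n v} → Subset v → Ω n v → Ω n v → Ω n v
  mix [] [] [] = []
  mix (true ∷ I) (a ∷ y) (b ∷ z) = a ∷ mix I y z
  mix (false ∷ I) (a ∷ y) (b ∷ z) = b ∷ mix I y z

  mix-in : ∀ {n v} (I : Subset v) (y z : Ω n v) → mix I y z ≈[ I ] y
  mix-in (true ∷ I) (a ∷ y) (b ∷ z) zero here = refl
  mix-in (true ∷ I) (a ∷ y) (b ∷ z) (suc i) (there h) = mix-in I y z i h
  mix-in (false ∷ I) (a ∷ y) (b ∷ z) (suc i) (there h) = mix-in I y z i h

  mix-out : ∀ {n v} (I : Subset v) (y z : Ω n v) i → i ∉ₛ I → lookup (mix I y z) i ≡ lookup z i
  mix-out (true ∷ I) (a ∷ y) (b ∷ z) zero h = contradiction here h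
  mix-out (false ∷ I) (a ∷ y) (b ∷ z) zero h = refl
  mix-out (true ∷ I) (a ∷ y) (b ∷ z) (suc i) h = mix-out I y z i (h ∘ there)
  mix-out (false ∷ I) (a ∷ y) (b ∷ z) (suc i) h = mix-out I y z i (h ∘ there)

  opaque
    unfolding 𝔼

    -- The coordinates inside `I` come from `y` and the others from an independent `z`; in each
    -- coordinate the variable that is discarded averages out.
    𝔼-mix : ∀ {n v} (I : Subset v) (F : Ω n v → ℚ) → 𝔼 (λ y → 𝔼 (λ z → F (mix I y z))) ≡ 𝔼 F
    𝔼-mix [] F = refl
    𝔼-mix (true ∷ I) F = Φ-cong avg-linear λ a →
      trans (𝔼-cong (λ y → avg-const (𝔼 (λ z → F (a ∷ mix I y z))))) (𝔼-mix I (λ y → F (a ∷ y)))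
    𝔼-mix (false ∷ I) F = trans (avg-const _)
      (trans (avg-swap 𝔼-linear (λ b y → 𝔼 (λ z → F (b ∷ mix I y z))))
        (Φ-cong avg-linear (λ b → 𝔼-mix I (λ y → F (b ∷ y)))))

  -- Indicators, sums over lists and the union bound

  ind : Bool → ℚ
  ind true = 1ℚ
  ind false = 0ℚ

  0≤ind : ∀ b → 0ℚ ≤ ind b
  0≤ind true = 0≤1
  0≤ind false = ≤-refl

  ind≤1 : ∀ b → ind b ≤ 1ℚ
  ind≤1 true = ≤-refl
  ind≤1 false = 0≤1

  ind-∧ : ∀ a b → ind (a ∧ b) ≡ ind a * ind b
  ind-∧ true b = sym (*-identityˡ (ind b))
  ind-∧ false b = sym (*-zeroˡ (ind b))

  ind-yes : ∀ {P : Set} (d : Dec P) → P → ind ⌊ d ⌋ ≡ 1ℚ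
  ind-yes (yes _) p = refl
  ind-yes (no ¬p) p = contradiction p ¬p

  sumL : ∀ {A : Set} → List A → (A → ℚ) → ℚ
  sumL [] f = 0ℚ
  sumL (a ∷ as) f = f a + sumL as f

  sumL-≤ : ∀ {A : Set} (as : List A) {f g : A → ℚ} → (∀ a → a ∈ as → f a ≤ g a) → sumL as f ≤ sumL as g
  sumL-≤ [] h = ≤-refl
  sumL-≤ (a ∷ as) h = +-mono-≤ (h a (here refl)) (sumL-≤ as (λ b m → h b (there m)))

  sumL-const : ∀ {A : Set} (as : List A) c → sumL as (λ _ → c) ≡ nat (length as) * c
  sumL-const [] c = sym (*-zeroˡ c)
  sumL-const (a ∷ as) c = trans (cong (c +_) (sumL-const as c)) (solve 2 (λ n c → c :+ n :* c := (con 1ℚ :+ n) :* c) refl (nat (length as)) c)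

  sumL-nonneg : ∀ {A : Set} (as : List A) {f : A → ℚ} → (∀ a → 0ℚ ≤ f a) → 0ℚ ≤ sumL as f
  sumL-nonneg [] h = ≤-refl
  sumL-nonneg (a ∷ as) h = 0≤+ (h a) (sumL-nonneg as h)

  term≤sumL : ∀ {A : Set} {as : List A} {f : A → ℚ} → (∀ a → 0ℚ ≤ f a) → ∀ {a} → a ∈ as → f a ≤ sumL as f
  term≤sumL {as = a ∷ as} h (here refl) = ≤-by _ (sumL-nonneg as h) refl
  term≤sumL {as = b ∷ as} {f} h (there m) = ≤-trans (term≤sumL h m) (≤-by (f b) (h b) (+-comm (f b) _))

  sumL-swap : ∀ {A B : Set} {Φ : (B → ℚ) → ℚ} → Linear Φ → (as : List A) (f : A → B → ℚ) →
              Φ (λ x → sumL as (λ a → f a x)) ≡ sumL as (λ a → Φ (f a))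
  sumL-swap L [] f = Φ-zero L
  sumL-swap {Φ = Φ} L (a ∷ as) f = trans (Φ-+ L _ _) (cong (_+_ (Φ (f a))) (sumL-swap L as f))

  𝔼-union : ∀ {n v} {A : Set} (as : List A) {F : A → Ω n v → ℚ} {f : Ω n v → ℚ} c →
            (∀ x → f x ≤ sumL as (λ a → F a x)) → (∀ a → a ∈ as → 𝔼 (F a) ≤ c) → 𝔼 f ≤ nat (length as) * c
  𝔼-union as {F} {f} c h b = ≤-trans (𝔼-mono h) (≤-trans (≤-reflexive (sumL-swap 𝔼-linear as F))
    (≤-trans (sumL-≤ as b) (≤-reflexive (sumL-const as c))))

  -- Systems of cylinder sets and their partitions

  record Item (n v : ℕ) : Set where
    field
      set : Subset v
      fn : Ω n v → Bool
      meas : ∀ {x y} → x ≈[ set ] y → fn x ≡ fn y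
  open Item public

  System : ℕ → ℕ → Set
  System n v = List (Item n v)

  -- The name of the cell of `x` in the partition generated by the members of `P` that live inside
  -- `I`. The other members are masked by `false` instead of being dropped, so all keys have length
  -- `length P` and can be enumerated.
  key : ∀ {n v} → System n v → Subset v → Ω n v → List Bool
  key P I x = map (λ it → ⌊ set it ⊆? I ⌋ ∧ fn it x) P

  key-length : ∀ {n v} (P : System n v) I x → length (key P I x) ≡ length P
  key-length P I x = length-map _ P

  key-∈ : ∀ {n v} {P : System n v} {I x y} → key P I x ≡ key P I y → ∀ {it} → it ∈ P → set it ⊆ I → fn it x ≡ fn it y
  key-∈ {P = it ∷ P} {I} h (here refl) sub with set it ⊆? I
  ... | yes _ = proj₁ (∷-injective h)
  ... | no ns = contradiction (λ {i} → sub {i}) ns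
  key-∈ {P = it ∷ P} h (there m) sub = key-∈ {P = P} (proj₂ (∷-injective h)) m sub

  key-ext : ∀ {n v} (P : System n v) {I x y} → (∀ {it} → it ∈ P → set it ⊆ I → fn it x ≡ fn it y) → key P I x ≡ key P I y
  key-ext [] h = refl
  key-ext (it ∷ P) {I} {x} {y} h = cong₂ _∷_ hd (key-ext P (λ m → h (there m)))
    where
    hd : ⌊ set it ⊆? I ⌋ ∧ fn it x ≡ ⌊ set it ⊆? I ⌋ ∧ fn it y
    hd with set it ⊆? I
    ... | yes s = h (here refl) s
    ... | no _ = refl

  key-≈ : ∀ {n v} (P : System n v) {I x y} → x ≈[ I ] y → key P I x ≡ key P I y
  key-≈ P e = key-ext P (λ {it} _ s → meas it (λ i m → e i (s m)))

  key-⊆ : ∀ {n v} {P Q : System n v} {I x y} → (∀ {it} → it ∈ P → it ∈ Q) → key Q I x ≡ key Q I y → key P I x ≡ key P I y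
  key-⊆ {P = P} {Q} s h = key-ext P (λ m → key-∈ {P = Q} h (s m))

  key-mono : ∀ {n v} {P : System n v} {I J x y} → I ⊆ J → key P J x ≡ key P J y → key P I x ≡ key P I y
  key-mono {P = P} s h = key-ext P (λ m t → key-∈ {P = P} h m (λ k → s (t k)))

  _≟L_ : (a b : List Bool) → Dec (a ≡ b)
  _≟L_ = List-≡-dec Bool._≟_

  opaque
    -- Extended by 0 outside the positive rationals.
    inv₀ : ℚ → ℚ
    inv₀ q with 0ℚ <? q
    ... | yes h = proj₁ (inv h)
    ... | no _ = 0ℚ

    inv₀-* : ∀ {q} → 0ℚ < q → inv₀ q * q ≡ 1ℚ
    inv₀-* {q} h with 0ℚ <? q
    ... | yes h' = proj₂ (proj₂ (inv h'))
    ... | no nh = contradiction h nh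

  module _ {n v : ℕ} (κ : Ω n v → List Bool) where

    same : List Bool → Ω n v → ℚ
    same k y = ind ⌊ k ≟L κ y ⌋

    0≤same : ∀ k y → 0ℚ ≤ same k y
    0≤same k y = 0≤ind ⌊ k ≟L κ y ⌋

    cls : List Bool → ℚ
    cls k = 𝔼 (same k)

    opaque
      cond : (Ω n v → ℚ) → Ω n v → ℚ
      cond f x = 𝔼 (λ y → same (κ x) y * f y) * inv₀ (cls (κ x))

    0<cls : ∀ x → 0ℚ < cls (κ x)
    0<cls x = 𝔼-pos (0≤same (κ x)) x (subst (0ℚ <_) (sym (ind-yes (κ x ≟L κ x) refl)) 0<1)

    Measurable : (Ω n v → ℚ) → Set
    Measurable φ = ∀ {x y} → κ x ≡ κ y → φ x ≡ φ y

    opaque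
      unfolding cond

      cond-measurable : ∀ f → Measurable (cond f)
      cond-measurable f e = cong (λ k → 𝔼 (λ y → same k y * f y) * inv₀ (cls k)) e

      cond-cls : ∀ f x → cond f x * cls (κ x) ≡ 𝔼 (λ y → same (κ x) y * f y)
      cond-cls f x = trans (*-assoc (𝔼 (λ y → same (κ x) y * f y)) (inv₀ (cls (κ x))) (cls (κ x))) (trans (cong (𝔼 (λ y → same (κ x) y * f y) *_) (inv₀-* (0<cls x))) (*-identityʳ _))

    cond-≤ : ∀ {f c} x → 𝔼 (λ y → same (κ x) y * f y) ≤ c * cls (κ x) → cond f x ≤ c
    cond-≤ {f} {c} x h = *-cancelʳ-≤-pos (cls (κ x)) {{positive (0<cls x)}} (subst (_≤ c * cls (κ x)) (sym (cond-cls f x)) h)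

    cond-≥ : ∀ {f c} x → c * cls (κ x) ≤ 𝔼 (λ y → same (κ x) y * f y) → c ≤ cond f x
    cond-≥ {f} {c} x h = *-cancelʳ-≤-pos (cls (κ x)) {{positive (0<cls x)}} (subst (c * cls (κ x) ≤_) (sym (cond-cls f x)) h)

    cond-upper : ∀ {f c} → (∀ y → f y ≤ c) → ∀ x → cond f x ≤ c
    cond-upper {f} {c} h x = cond-≤ x (≤-trans (𝔼-mono (λ y → *-monoˡ (0≤same (κ x) y) (h y))) (≤-reflexive (trans (𝔼-*ʳ _ c) (*-comm _ c))))

    cond-lower : ∀ {f c} → (∀ y → c ≤ f y) → ∀ x → c ≤ cond f x
    cond-lower {f} {c} h x = cond-≥ x (≤-trans (≤-reflexive (trans (*-comm c _) (sym (𝔼-*ʳ _ c)))) (𝔼-mono (λ y → *-monoˡ (0≤same (κ x) y) (h y))))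

    same-sym : ∀ x y → same (κ x) y ≡ same (κ y) x
    same-sym x y with κ x ≟L κ y | κ y ≟L κ x
    ... | yes _ | yes _ = refl
    ... | no _ | no _ = refl
    ... | yes e | no ne = contradiction (sym e) ne
    ... | no ne | yes e = contradiction (sym e) ne

    same-subst : ∀ {φ} → Measurable φ → ∀ x y → same (κ x) y * φ x ≡ same (κ x) y * φ y
    same-subst {φ} h x y with κ x ≟L κ y
    ... | yes e = cong (1ℚ *_) (h e)
    ... | no _ = trans (*-zeroˡ (φ x)) (sym (*-zeroˡ (φ y)))

    opaque
      unfolding cond

      -- The left side is a double average over pairs in a common cell. Exchanging the two averages
      -- and moving `φ` from one point of the cell to the other, where it has the same value, leaves
      -- the mass of the cell, which cancels.
      cond-orth : ∀ f {φ} → Measurable φ → 𝔼 (λ x → cond f x * φ x) ≡ 𝔼 (λ x → f x * φ x)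
      cond-orth f {φ} h = begin
        𝔼 (λ x → cond f x * φ x)
          ≡⟨ 𝔼-cong (λ x → trans (*-assoc (𝔼 (λ y → same (κ x) y * f y)) (inv₀ (cls (κ x))) (φ x)) (sym (𝔼-*ʳ _ (ψ x)))) ⟩
        𝔼 (λ x → 𝔼 (λ y → same (κ x) y * f y * ψ x))
          ≡⟨ 𝔼-swap 𝔼-linear (λ y x → same (κ x) y * f y * ψ x) ⟩
        𝔼 (λ y → 𝔼 (λ x → same (κ x) y * f y * ψ x))
          ≡⟨ 𝔼-cong (λ y → trans (𝔼-cong (λ x → step x y)) (trans (𝔼-*ʳ _ (f y * ψ y)) (fin y))) ⟩
        𝔼 (λ x → f x * φ x) ∎
        where
        open ≡-Reasoning
        ψ : Ω n v → ℚ
        ψ x = inv₀ (cls (κ x)) * φ x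
        ψ-meas : Measurable ψ
        ψ-meas e = cong₂ _*_ (cong (inv₀ ∘ cls) e) (h e)
        step : ∀ x y → same (κ x) y * f y * ψ x ≡ same (κ y) x * (f y * ψ y)
        step x y = begin
          same (κ x) y * f y * ψ x ≡⟨ solve 3 (λ s f p → s :* f :* p := f :* (s :* p)) refl (same (κ x) y) (f y) (ψ x) ⟩
          f y * (same (κ x) y * ψ x) ≡⟨ cong (f y *_) (same-subst ψ-meas x y) ⟩
          f y * (same (κ x) y * ψ y) ≡⟨ solve 3 (λ s f p → f :* (s :* p) := s :* (f :* p)) refl (same (κ x) y) (f y) (ψ y) ⟩
          same (κ x) y * (f y * ψ y) ≡⟨ cong (_* (f y * ψ y)) (same-sym x y) ⟩
          same (κ y) x * (f y * ψ y) ∎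
        fin : ∀ y → cls (κ y) * (f y * ψ y) ≡ f y * φ y
        fin y = begin
          cls (κ y) * (f y * (inv₀ (cls (κ y)) * φ y))
            ≡⟨ solve 4 (λ c f i p → c :* (f :* (i :* p)) := (i :* c) :* (f :* p)) refl (cls (κ y)) (f y) (inv₀ (cls (κ y))) (φ y) ⟩
          (inv₀ (cls (κ y)) * cls (κ y)) * (f y * φ y) ≡⟨ cong (_* (f y * φ y)) (inv₀-* (0<cls y)) ⟩
          1ℚ * (f y * φ y) ≡⟨ *-identityˡ _ ⟩
          f y * φ y ∎

  -- Energy increment

  -- The range is [-1, 1] because the functions to be regularised include the signed `excess`
  -- besides indicators of cells.
  record Fun (n v : ℕ) : Set where
    field
      dom : Subset v
      val : Ω n v → ℚ
      val-meas : ∀ {x y} → x ≈[ dom ] y → val x ≡ val y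
      lower : ∀ x → - 1ℚ ≤ val x
      upper : ∀ x → val x ≤ 1ℚ
  open Fun public

  sq≤1 : ∀ {a} → - 1ℚ ≤ a → a ≤ 1ℚ → a * a ≤ 1ℚ
  sq≤1 {a} l u = ≤-by _ (0≤* (0≤-diff u) (0≤-diff l))
    (solve 1 (λ a → con 1ℚ := a :* a :+ (con 1ℚ :- a) :* (a :- (:- con 1ℚ))) refl a)

  module _ {n v : ℕ} where

    hat : System n v → Fun n v → Ω n v → ℚ
    hat P F = cond (key P (dom F)) (val F)

    sqnorm : (Ω n v → ℚ) → ℚ
    sqnorm f = 𝔼 (λ x → f x * f x)

    energy : System n v → List (Fun n v) → ℚ
    energy P fs = sumL fs (λ F → sqnorm (hat P F))

    _⊑_ : System n v → System n v → Set
    P ⊑ P' = ∀ {it} → it ∈ P → it ∈ P'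

    hat-meas : ∀ {P P'} → P ⊑ P' → ∀ F → Measurable (key P' (dom F)) (hat P F)
    hat-meas {P} {P'} s F e = cond-measurable (key P (dom F)) (val F) (key-⊆ {P = P} {Q = P'} s e)

    hat-≈ : ∀ P F {x y} → x ≈[ dom F ] y → hat P F x ≡ hat P F y
    hat-≈ P F e = cond-measurable (key P (dom F)) (val F) (key-≈ P e)

    hat²≤1 : ∀ P F x → hat P F x * hat P F x ≤ 1ℚ
    hat²≤1 P F x = sq≤1 (cond-lower (key P (dom F)) (lower F) x) (cond-upper (key P (dom F)) (upper F) x)

    sqnorm-nonneg : ∀ f → 0ℚ ≤ sqnorm f
    sqnorm-nonneg f = 𝔼-nonneg (λ x → 0≤sq (f x))

    0≤energy : ∀ P fs → 0ℚ ≤ energy P fs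
    0≤energy P fs = sumL-nonneg fs (λ F → sqnorm-nonneg (hat P F))

    energy-≤ : ∀ P fs → energy P fs ≤ nat (length fs)
    energy-≤ P fs = ≤-trans (sumL-≤ fs (λ F _ → 𝔼-≤c (hat²≤1 P F)))
      (≤-reflexive (trans (sumL-const fs 1ℚ) (*-identityʳ (nat (length fs)))))

    -- The coarse projection is measurable for both partitions, so pairing it with either projection
    -- gives the same as pairing it with `val F`. Hence the mixed term equals the coarse norm.
    pythagoras : ∀ {P P'} → P ⊑ P' → ∀ F →
      sqnorm (hat P F) + sqnorm (λ x → hat P' F x - hat P F x) ≡ sqnorm (hat P' F)
    pythagoras {P} {P'} s F = begin
      sqnorm p + sqnorm (λ x → q x - p x)
        ≡⟨ cong (sqnorm p +_) (𝔼-cong (λ x → solve 2 (λ p q → (q :- p) :* (q :- p) := (q :* q :+ p :* p) :- (q :* p :+ q :* p)) refl (p x) (q x))) ⟩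
      sqnorm p + 𝔼 (λ x → (q x * q x + p x * p x) - (q x * p x + q x * p x))
        ≡⟨ cong (sqnorm p +_) (trans (𝔼-- _ _) (cong₂ _-_ (𝔼-+ _ _) (𝔼-+ _ _))) ⟩
      sqnorm p + ((sqnorm q + sqnorm p) - (qp + qp))
        ≡⟨ cong (λ c → sqnorm p + ((sqnorm q + sqnorm p) - (c + c))) qp≡pp ⟩
      sqnorm p + ((sqnorm q + sqnorm p) - (sqnorm p + sqnorm p))
        ≡⟨ solve 2 (λ p q → p :+ ((q :+ p) :- (p :+ p)) := q) refl (sqnorm p) (sqnorm q) ⟩
      sqnorm q ∎
      where
      open ≡-Reasoning
      p q : Ω n v → ℚ
      p = hat P F
      q = hat P' F
      qp : ℚ
      qp = 𝔼 (λ x → q x * p x)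
      qp≡pp : qp ≡ sqnorm p
      qp≡pp = trans (cond-orth (key P' (dom F)) (val F) (hat-meas {P} {P'} s F))
        (sym (cond-orth (key P (dom F)) (val F) (cond-measurable (key P (dom F)) (val F))))

    sqnorm-mono : ∀ {P P'} → P ⊑ P' → ∀ F → sqnorm (hat P F) ≤ sqnorm (hat P' F)
    sqnorm-mono {P} {P'} s F = ≤-by _ (sqnorm-nonneg (λ x → hat P' F x - hat P F x)) (sym (pythagoras {P} {P'} s F))

  sumL-gain : ∀ {A : Set} {as : List A} {f g : A → ℚ} {a e} → (∀ b → f b ≤ g b) → a ∈ as → f a + e ≤ g a → sumL as f + e ≤ sumL as g
  sumL-gain {as = b ∷ as} {f} {g} {e = e} h (here refl) le = ≤-trans
    (≤-reflexive (solve 3 (λ a s e → a :+ s :+ e := (a :+ e) :+ s) refl (f b) (sumL as f) e)) (+-mono-≤ le (sumL-≤ as (λ c _ → h c)))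
  sumL-gain {as = b ∷ as} {f} {g} {e = e} h (there m) le = ≤-trans (≤-reflexive (+-assoc (f b) (sumL as f) e))
    (+-mono-≤ (h b) (sumL-gain h m le))

  record Test {n v : ℕ} (Q : System n v) (T : Ω n v → ℚ) : Set where
    field
      dep : ∀ x y → (∀ {it} → it ∈ Q → fn it x ≡ fn it y) → T x ≡ T y
      sq-bd : ∀ x → T x * T x ≤ 1ℚ
  open Test public

  module _ {n v : ℕ} where

    -- Sets in a test may be large; only their intersections with `dom F` must have at most `l`
    -- points, which admits cells over other sets of the same size as `dom F`. The allowance is
    -- relative to `length P`, so a test may contain all of `P`. An upper bound suffices since `T`
    -- may be replaced by its negative.
    Pseudorandom : ℕ → ℕ → System n v → Fun n v → ℚ → Set
    Pseudorandom l C P F η = ∀ Q → length Q ℕ.≤ length P ℕ.+ C → (∀ {it} → it ∈ Q → ∣ set it ∩ dom F ∣ ℕ.≤ l) →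
      ∀ T → Test Q T → 𝔼 (λ x → (val F x - hat P F x) * T x) ≤ η

    -- Fixing the coordinates outside I at z turns a set meeting I in few points into a subset of I.
    fibreItem : Subset v → Ω n v → Item n v → Item n v
    fibreItem I z it = record
      { set = set it ∩ I
      ; fn = λ y → fn it (mix I y z)
      ; meas = λ {x} {y} e → meas it (λ i m → agree x y e i m)
      }
      where
      agree : ∀ x y → x ≈[ set it ∩ I ] y → ∀ i → i ∈ₛ set it → lookup (mix I x z) i ≡ lookup (mix I y z) i
      agree x y e i m with i ∈? I
      ... | yes p = trans (mix-in I x z i p) (trans (e i (x∈p∩q⁺ (m , p))) (sym (mix-in I y z i p)))
      ... | no p = trans (mix-out I x z i p) (sym (mix-out I y z i p))

    refine : Subset v → Ω n v → System n v → System n v → System n v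
    refine I z Q P = map (fibreItem I z) Q ++ P

    fibre-meas : ∀ {Q T} → Test Q T → ∀ I z P → Measurable (key (refine I z Q P) I) (λ y → T (mix I y z))
    fibre-meas {Q} t I z P {x} {y} e = dep t _ _ λ {it} m →
      key-∈ {P = refine I z Q P} e (∈-++⁺ˡ (∈-map⁺ (fibreItem I z) m)) (p∩q⊆q (set it) I)

    -- The deviation of `F` from its projection depends on `dom F` only, so the correlation is the
    -- average over `z` of the correlations with the fibres of `T`. A large average excludes that
    -- all fibres are small.
    bad-fibre : ∀ {P F} {T : Ω n v → ℚ} {η} → η < 𝔼 (λ x → (val F x - hat P F x) * T x) →
      ¬ (∀ z → 𝔼 (λ y → (val F y - hat P F y) * T (mix (dom F) y z)) ≤ η)
    bad-fibre {P} {F} {T} {η} lt h = <-irrefl refl (<-≤-trans lt le)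
      where
      w : Ω n v → ℚ
      w x = val F x - hat P F x
      I = dom F
      w-mix : ∀ y z → w (mix I y z) ≡ w y
      w-mix y z = cong₂ _-_ (val-meas F (mix-in I y z)) (hat-≈ P F (mix-in I y z))
      le : 𝔼 (λ x → w x * T x) ≤ η
      le = begin
        𝔼 (λ x → w x * T x) ≡⟨ sym (𝔼-mix I (λ x → w x * T x)) ⟩
        𝔼 (λ y → 𝔼 (λ z → w (mix I y z) * T (mix I y z))) ≡⟨ 𝔼-cong (λ y → 𝔼-cong (λ z → cong (_* T (mix I y z)) (w-mix y z))) ⟩
        𝔼 (λ y → 𝔼 (λ z → w y * T (mix I y z))) ≡⟨ 𝔼-swap 𝔼-linear (λ z y → w y * T (mix I y z)) ⟩
        𝔼 (λ z → 𝔼 (λ y → w y * T (mix I y z))) ≤⟨ 𝔼-≤c h ⟩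
        η ∎
        where open ≤-Reasoning

    -- The fibre of `T` at `z` is measurable for the refined partition, so `val F` may be replaced
    -- by its new projection. The difference `d` of the two projections thus correlates with a
    -- bounded function, which forces its norm up, and this norm is the gain in energy.
    energy-increment : ∀ {P F Q} {T : Ω n v → ℚ} {η} → 0ℚ ≤ η → Test Q T → ∀ z →
      η < 𝔼 (λ y → (val F y - hat P F y) * T (mix (dom F) y z)) →
      sqnorm (hat P F) + η * η ≤ sqnorm (hat (refine (dom F) z Q P) F)
    energy-increment {P} {F} {Q} {T} {η} η≥0 t z lt = ≤-trans (+-monoʳ-≤ (sqnorm (hat P F)) ηη≤) (≤-reflexive (pythagoras {P = P} {P'} P⊑P' F))
      where
      I = dom F
      P' = refine I z Q P
      P⊑P' : P ⊑ P'
      P⊑P' = ∈-++⁺ʳ (map (fibreItem I z) Q)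
      S d : Ω n v → ℚ
      S y = T (mix I y z)
      d x = hat P' F x - hat P F x
      Ed : 𝔼 (λ y → (val F y - hat P F y) * S y) ≡ 𝔼 (λ y → d y * S y)
      Ed = begin
        𝔼 (λ y → (val F y - hat P F y) * S y) ≡⟨ 𝔼-cong (λ y → distr (val F y) (hat P F y) (S y)) ⟩
        𝔼 (λ y → val F y * S y - hat P F y * S y) ≡⟨ 𝔼-- _ _ ⟩
        𝔼 (λ y → val F y * S y) - 𝔼 (λ y → hat P F y * S y)
          ≡⟨ cong (_- 𝔼 (λ y → hat P F y * S y)) (sym (cond-orth (key P' I) (val F) (fibre-meas t I z P))) ⟩
        𝔼 (λ y → hat P' F y * S y) - 𝔼 (λ y → hat P F y * S y) ≡⟨ sym (𝔼-- _ _) ⟩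
        𝔼 (λ y → hat P' F y * S y - hat P F y * S y) ≡⟨ 𝔼-cong (λ y → sym (distr (hat P' F y) (hat P F y) (S y))) ⟩
        𝔼 (λ y → d y * S y) ∎
        where
        open ≡-Reasoning
        distr : ∀ a b c → (a - b) * c ≡ a * c - b * c
        distr = solve 3 (λ a b c → (a :- b) :* c := a :* c :- b :* c) refl
      -- Cauchy-Schwarz without square roots: `d y - η * S y` has nonnegative square, and
      -- `S y * S y ≤ 1ℚ`.
      pointwise : ∀ y → (η + η) * (d y * S y) ≤ d y * d y + η * η
      pointwise y = ≤-by ((d y - η * S y) * (d y - η * S y) + (η * η) * (1ℚ - S y * S y))
        (0≤+ (0≤sq (d y - η * S y)) (0≤* (0≤sq η) (0≤-diff (sq-bd t (mix I y z)))))
        (solve 3 (λ e d s → d :* d :+ e :* e := (e :+ e) :* (d :* s) :+ ((d :- e :* s) :* (d :- e :* s) :+ (e :* e) :* (con 1ℚ :- s :* s))) refl η (d y) (S y))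
      ηη≤ : η * η ≤ sqnorm d
      ηη≤ = diff-≤ (≤-trans (0≤-diff both) (≤-reflexive (solve 2 (λ e s → (s :+ e :* e) :- (e :+ e) :* e := s :- e :* e) refl η (sqnorm d))))
        where
        open ≤-Reasoning
        both : (η + η) * η ≤ sqnorm d + η * η
        both = begin
          (η + η) * η ≤⟨ *-monoˡ (0≤+ η≥0 η≥0) (≤-trans (<⇒≤ lt) (≤-reflexive Ed)) ⟩
          (η + η) * 𝔼 (λ y → d y * S y) ≡⟨ sym (𝔼-* (η + η) _) ⟩
          𝔼 (λ y → (η + η) * (d y * S y)) ≤⟨ 𝔼-mono pointwise ⟩
          𝔼 (λ y → d y * d y + η * η) ≡⟨ trans (𝔼-+ _ _) (cong (sqnorm d +_) (𝔼-const {n} {v} (η * η))) ⟩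
          sqnorm d + η * η ∎

  -- Complexes and the two regularity lemmas

  -- In the application this is the down-closure of the edge set of a uniform hypergraph. By
  -- `extend`, small members lie in members of any prescribed size up to `rank`; this lets one layer
  -- of the complex control all layers below it.
  record Complex (v : ℕ) : Set₁ where
    field
      act : Subset v → Set
      act? : ∀ I → Dec (act I)
      down : ∀ {I J} → I ⊆ J → act J → act I
      rank : ℕ
      extend : ∀ {I i} → act I → ∣ I ∣ ℕ.≤ i → i ℕ.≤ rank → Σ (Subset v) λ J → I ⊆ J × act J × ∣ J ∣ ≡ i
  open Complex public

  Level : ∀ {n v} → ℕ → Complex v → System n v → Set
  Level l K P = ∀ {it} → it ∈ P → act K (set it) × ∣ set it ∣ ℕ.≤ l

  module _ {v : ℕ} (l C : ℕ) where

    refine-level : ∀ {n} (K : Complex v) {P Q : System n v} {I} z → act K I → Level l K P →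
      (∀ {it} → it ∈ Q → ∣ set it ∩ I ∣ ℕ.≤ l) → Level l K (refine I z Q P)
    refine-level K {P} {Q} {I} z aI lev small m with ∈-++⁻ (map (fibreItem I z) Q) m
    ... | inj₂ m' = lev m'
    ... | inj₁ m' with ∈-map⁻ (fibreItem I z) m'
    ... | it , m'' , refl = down K (p∩q⊆q (set it) I) aI , small m''

    -- s bounds the number of energy increments that are still possible.
    weak-regularity : (s ℓ : ℕ) → Σ ℕ λ b → (ℓ ℕ.≤ b) × (∀ {n} (K : Complex v) (fs : List (Fun n v)) →
      (∀ {F} → F ∈ fs → act K (dom F)) → ∀ P → Level l K P → length P ℕ.≤ ℓ → ∀ {η} → 0ℚ < η →
      nat (length fs) < energy P fs + nat s * (η * η) →
      ¬ (∀ P' → P ⊑ P' → Level l K P' → length P' ℕ.≤ b → ¬ (∀ {F} → F ∈ fs → Pseudorandom l C P' F η)))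
    weak-regularity zero ℓ = ℓ , ℕₚ.≤-refl , λ K fs _ P _ _ {η} _ lt _ →
      <-irrefl refl (<-≤-trans lt (≤-trans (≤-reflexive (trans (cong (energy P fs +_) (*-zeroˡ (η * η))) (+-identityʳ _))) (energy-≤ P fs)))
    -- A refinement adds one fibre for each member of a test system, at most `ℓ + C` sets, to the at
    -- most `ℓ` old ones.
    weak-regularity (suc s) ℓ with weak-regularity s ((ℓ ℕ.+ C) ℕ.+ ℓ)
    ... | b , le , ih = b , ℓ≤b , λ K fs acts P lev len {η} η>0 lt k →
      k P (λ m → m) lev (ℕₚ.≤-trans len ℓ≤b) λ {F} F∈ Q lenQ small T t → go K fs acts P lev len η>0 lt k F∈ Q lenQ small T t
      where
      ℓ≤b = ℕₚ.≤-trans (ℕₚ.m≤n+m ℓ (ℓ ℕ.+ C)) le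
      go : ∀ {n} (K : Complex v) (fs : List (Fun n v)) → (∀ {F} → F ∈ fs → act K (dom F)) → ∀ P → Level l K P → length P ℕ.≤ ℓ → ∀ {η} → 0ℚ < η →
        nat (length fs) < energy P fs + nat (suc s) * (η * η) →
        (∀ P' → P ⊑ P' → Level l K P' → length P' ℕ.≤ b → ¬ (∀ {F} → F ∈ fs → Pseudorandom l C P' F η)) →
        ∀ {F} → F ∈ fs → Pseudorandom l C P F η
      go K fs acts P lev len {η} η>0 lt k {F} F∈ Q lenQ small T t with 𝔼 (λ x → (val F x - hat P F x) * T x) ≤? η
      ... | yes p = p
      ... | no p = ⊥-elim (bad-fibre {P = P} {F} {T} (≰⇒> p) λ z → fibre z)
        where
        fibre : ∀ z → 𝔼 (λ y → (val F y - hat P F y) * T (mix (dom F) y z)) ≤ η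
        fibre z with 𝔼 (λ y → (val F y - hat P F y) * T (mix (dom F) y z)) ≤? η
        ... | yes q = q
        ... | no q = ⊥-elim (ih K fs acts P' (refine-level K z (acts F∈) lev small) len' η>0 lt' λ P'' sub → k P'' (λ m → sub (P⊑P' m)))
          where
          P' = refine (dom F) z Q P
          P⊑P' : P ⊑ P'
          P⊑P' = ∈-++⁺ʳ (map (fibreItem (dom F) z) Q)
          len' : length P' ℕ.≤ (ℓ ℕ.+ C) ℕ.+ ℓ
          len' = ℕₚ.≤-trans (ℕₚ.≤-reflexive (trans (length-++ (map (fibreItem (dom F) z) Q)) (cong (ℕ._+ length P) (length-map _ Q))))
            (ℕₚ.+-mono-≤ (ℕₚ.≤-trans lenQ (ℕₚ.+-monoˡ-≤ C len)) len)
          lt' : nat (length fs) < energy P' fs + nat s * (η * η)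
          lt' = <-≤-trans lt (≤-trans
            (≤-reflexive (solve 3 (λ e s h → e :+ (con 1ℚ :+ s) :* h := (e :+ h) :+ s :* h) refl (energy P fs) (nat s) (η * η)))
            (+-monoˡ-≤ (nat s * (η * η)) (sumL-gain (sqnorm-mono {P = P} {P'} P⊑P') F∈ (energy-increment {P = P} {F} {Q} {T} (<⇒≤ η>0) t z (≰⇒> q)))))

    -- Weak regularity turns the coarse `P` into `P'`. If the energy grows by at most `κ`, the gain
    -- bounds the distance of the two projections for each function; otherwise `P'` becomes the new
    -- coarse partition. The energy is at most `m`, so `s` rounds are enough. The tolerance may
    -- depend on `length P`, since `P` is fixed before `P'`.
    strong-regularity : (m : ℕ) {κ : ℚ} → 0ℚ < κ → (η : ℕ → ℚ) → (∀ i → 0ℚ < η i) → (s ℓ : ℕ) →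
      Σ ℕ λ b → ∀ {n} (K : Complex v) (fs : List (Fun n v)) → length fs ℕ.≤ m →
      (∀ {F} → F ∈ fs → act K (dom F)) → ∀ P → Level l K P → length P ℕ.≤ ℓ →
      nat m < energy P fs + nat s * κ →
      ¬ (∀ P P' → P ⊑ P' → Level l K P → Level l K P' → length P ℕ.≤ b →
         (∀ {F} → F ∈ fs → sqnorm (λ x → hat P' F x - hat P F x) ≤ κ) →
         ¬ (∀ {F} → F ∈ fs → Pseudorandom l C P' F (η (length P))))
    strong-regularity m {κ} κ>0 η pos zero ℓ = ℓ , λ K fs lm _ P _ _ lt _ →
      <-irrefl refl (<-≤-trans lt (≤-trans (≤-reflexive (trans (cong (energy P fs +_) (*-zeroˡ κ)) (+-identityʳ _))) (≤-trans (energy-≤ P fs) (nat-mono lm))))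
    strong-regularity m {κ} κ>0 η pos (suc s) ℓ = b , λ K fs lm acts P lev len lt k →
      weak K fs acts P lev len η₀>0 (inner-lt {fs = fs} lm P) λ P' sub lev' len' unif → step K fs lm acts P lev len lt k P' sub lev' len' unif
      where
      -- The bound must be uniform in `P`, of which only `length P ≤ ℓ` is known, so the smallest of
      -- the tolerances in question is used.
      open Σ (minUpTo η pos ℓ) renaming (proj₁ to η₀; proj₂ to η₀-props)
      η₀>0 = proj₁ η₀-props
      η₀≤ = proj₂ η₀-props
      arch = archimedean (0<* η₀>0 η₀>0) (nat m)
      inner = weak-regularity (proj₁ arch) ℓ
      weak = proj₂ (proj₂ inner)
      outer = strong-regularity m κ>0 η pos s (proj₁ inner)
      b = ℓ ℕ.⊔ proj₁ outer
      inner-lt : ∀ {n} {fs : List (Fun n v)} → length fs ℕ.≤ m → ∀ P → nat (length fs) < energy P fs + nat (proj₁ arch) * (η₀ * η₀)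
      inner-lt {fs = fs} lm P = ≤-<-trans (nat-mono lm) (<-≤-trans (proj₂ arch) (≤-by (energy P fs) (0≤energy P fs) (+-comm (energy P fs) _)))
      step : ∀ {n} (K : Complex v) (fs : List (Fun n v)) → length fs ℕ.≤ m →
        (∀ {F} → F ∈ fs → act K (dom F)) → ∀ P → Level l K P → length P ℕ.≤ ℓ →
        nat m < energy P fs + nat (suc s) * κ →
        (∀ P P' → P ⊑ P' → Level l K P → Level l K P' → length P ℕ.≤ b →
         (∀ {F} → F ∈ fs → sqnorm (λ x → hat P' F x - hat P F x) ≤ κ) →
         ¬ (∀ {F} → F ∈ fs → Pseudorandom l C P' F (η (length P)))) →
        ∀ P' → P ⊑ P' → Level l K P' → length P' ℕ.≤ proj₁ inner → ¬ (∀ {F} → F ∈ fs → Pseudorandom l C P' F η₀)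
      step K fs lm acts P lev len lt k P' sub lev' len' unif with energy P' fs ≤? energy P fs + κ
      ... | yes p = k P P' sub lev lev' (ℕₚ.≤-trans len (ℕₚ.m≤m⊔n ℓ _)) close
        λ F∈ Q lq sm T t → ≤-trans (unif F∈ Q lq sm T t) (η₀≤ (length P) len)
        where
        close : ∀ {F} → F ∈ fs → sqnorm (λ x → hat P' F x - hat P F x) ≤ κ
        close {F} F∈ = +-cancelˡ {energy P fs} (≤-trans (sumL-gain (sqnorm-mono {P = P} {P'} sub) F∈ (≤-reflexive (pythagoras {P = P} {P'} sub F))) p)
          where
          +-cancelˡ : ∀ {a b c} → a + b ≤ a + c → b ≤ c
          +-cancelˡ {a} {b} {c} h = diff-≤ (≤-trans (0≤-diff h) (≤-reflexive (solve 3 (λ a b c → (a :+ c) :- (a :+ b) := c :- b) refl a b c)))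
      ... | no p = proj₂ outer K fs lm acts P' lev' len'
        (<-≤-trans lt (≤-trans (≤-reflexive (solve 3 (λ e s h → e :+ (con 1ℚ :+ s) :* h := (e :+ h) :+ s :* h) refl (energy P fs) (nat s) κ))
          (+-monoˡ-≤ (nat s * κ) (<⇒≤ (≰⇒> p)))))
        λ Q Q' s₁ l₁ l₂ len₁ → k Q Q' s₁ l₁ l₂ (ℕₚ.≤-trans len₁ (ℕₚ.m≤n⊔m ℓ _))

  -- Sets and measures

  allSubsets : ∀ v → List (Subset v)
  allSubsets zero = [] ∷ []
  allSubsets (suc v) = map (true ∷_) (allSubsets v) ++ map (false ∷_) (allSubsets v)

  ∈-allSubsets : ∀ {v} (I : Subset v) → I ∈ allSubsets v
  ∈-allSubsets [] = here refl
  ∈-allSubsets (true ∷ I) = ∈-++⁺ˡ (∈-map⁺ (true ∷_) (∈-allSubsets I))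
  ∈-allSubsets {suc v} (false ∷ I) = ∈-++⁺ʳ (map (true ∷_) (allSubsets v)) (∈-map⁺ (false ∷_) (∈-allSubsets I))

  allSubsets-unique : ∀ v → Unique (allSubsets v)
  allSubsets-unique zero = All.[] ∷ []
  allSubsets-unique (suc v) = Uniqueₚ.++⁺ (Uniqueₚ.map⁺ (λ { refl → refl }) (allSubsets-unique v))
    (Uniqueₚ.map⁺ (λ { refl → refl }) (allSubsets-unique v)) disjoint
    where
    disjoint : ∀ {I} → ¬ (I ∈ map (true ∷_) (allSubsets v) × I ∈ map (false ∷_) (allSubsets v))
    disjoint (a , b) with ∈-map⁻ (true ∷_) a | ∈-map⁻ (false ∷_) b
    ... | _ , _ , refl | _ , _ , ()

  boolLists : ℕ → List (List Bool)
  boolLists zero = [] ∷ []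
  boolLists (suc k) = map (true ∷_) (boolLists k) ++ map (false ∷_) (boolLists k)

  ∈-boolLists : ∀ t → t ∈ boolLists (length t)
  ∈-boolLists [] = here refl
  ∈-boolLists (true ∷ t) = ∈-++⁺ˡ (∈-map⁺ (true ∷_) (∈-boolLists t))
  ∈-boolLists (false ∷ t) = ∈-++⁺ʳ (map (true ∷_) (boolLists (length t))) (∈-map⁺ (false ∷_) (∈-boolLists t))

  subsets# : ℕ → ℕ
  subsets# v = length (allSubsets v)

  layer : ∀ {v} → Complex v → ℕ → List (Subset v)
  layer {v} K j = filter (λ I → act? K I ×-dec (∣ I ∣ ℕₚ.≟ j)) (allSubsets v)

  above : ∀ {v} → Complex v → ℕ → List (Subset v)
  above {v} K j = filter (λ I → act? K I ×-dec (j ℕₚ.≤? ∣ I ∣)) (allSubsets v)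

  ∈-layer : ∀ {v} (K : Complex v) {j I} → act K I → ∣ I ∣ ≡ j → I ∈ layer K j
  ∈-layer K {j} a e = ∈-filter⁺ (λ I → act? K I ×-dec (∣ I ∣ ℕₚ.≟ j)) (∈-allSubsets _) (a , e)

  layer-∈ : ∀ {v} (K : Complex v) {j I} → I ∈ layer K j → act K I × ∣ I ∣ ≡ j
  layer-∈ K {j} m = proj₂ (∈-filter⁻ (λ I → act? K I ×-dec (∣ I ∣ ℕₚ.≟ j)) {xs = allSubsets _} m)

  ∈-above : ∀ {v} (K : Complex v) {j I} → act K I → j ℕ.≤ ∣ I ∣ → I ∈ above K j
  ∈-above K {j} a e = ∈-filter⁺ (λ I → act? K I ×-dec (j ℕₚ.≤? ∣ I ∣)) (∈-allSubsets _) (a , e)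

  above-∈ : ∀ {v} (K : Complex v) {j I} → I ∈ above K j → act K I × j ℕ.≤ ∣ I ∣
  above-∈ K {j} m = proj₂ (∈-filter⁻ (λ I → act? K I ×-dec (j ℕₚ.≤? ∣ I ∣)) {xs = allSubsets _} m)

  layer-unique : ∀ {v} (K : Complex v) j → Unique (layer K j)
  layer-unique K j = Uniqueₚ.filter⁺ (λ I → act? K I ×-dec (∣ I ∣ ℕₚ.≟ j)) (allSubsets-unique _)

  layer-length : ∀ {v} (K : Complex v) j → length (layer K j) ℕ.≤ subsets# v
  layer-length {v} K j = length-filter (λ I → act? K I ×-dec (∣ I ∣ ℕₚ.≟ j)) (allSubsets v)

  above-length : ∀ {v} (K : Complex v) j → length (above K j) ℕ.≤ subsets# v
  above-length {v} K j = length-filter (λ I → act? K I ×-dec (j ℕₚ.≤? ∣ I ∣)) (allSubsets v)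

  ∉-card0 : ∀ {v} {I : Subset v} {i} → i ∈ₛ I → ¬ (∣ I ∣ ℕ.≤ 0)
  ∉-card0 here ()
  ∉-card0 {I = b ∷ I} (there m) h = ∉-card0 m (ℕₚ.≤-trans (∣p∣≤∣x∷p∣ b I) h)

  ⊆-card≡ : ∀ {v} {I J : Subset v} → I ⊆ J → ∣ J ∣ ℕ.≤ ∣ I ∣ → J ⊆ I
  ⊆-card≡ {I = I} {J} s h {i} m with i ∈? I
  ... | yes p = p
  ... | no np = contradiction h (ℕₚ.<⇒≱ (p⊂q⇒∣p∣<∣q∣ {p = I} {q = J} (s , i , m , np)))

  ∩-card : ∀ {v l} {I J : Subset v} → ∣ J ∣ ≡ suc l → ¬ (J ⊆ I) → ∣ I ∩ J ∣ ℕ.≤ l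
  ∩-card {l = l} {I} {J} e ns with ∣ I ∩ J ∣ ℕₚ.≤? l
  ... | yes p = p
  ... | no np = contradiction (λ {i} m → p∩q⊆p I J (⊆-card≡ (p∩q⊆q I J) (subst (ℕ._≤ ∣ I ∩ J ∣) (sym e) (ℕₚ.≰⇒> np)) {i} m)) ns

  allB anyB : ∀ {A : Set} → (A → Bool) → List A → Bool
  allB f [] = true
  allB f (a ∷ as) = f a ∧ allB f as
  anyB f [] = false
  anyB f (a ∷ as) = f a ∨ anyB f as

  module _ {A : Set} {f : A → Bool} where

    allB-∈ : ∀ {as} → allB f as ≡ true → ∀ {a} → a ∈ as → f a ≡ true
    allB-∈ {b ∷ as} h m with f b in eq
    allB-∈ {b ∷ as} h (here refl) | true = eq
    allB-∈ {b ∷ as} h (there m) | true = allB-∈ h m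

    ∈-allB : ∀ as → (∀ {a} → a ∈ as → f a ≡ true) → allB f as ≡ true
    ∈-allB [] h = refl
    ∈-allB (a ∷ as) h rewrite h (here refl) = ∈-allB as (λ m → h (there m))

    anyB-∉ : ∀ {as} → anyB f as ≡ false → ∀ {a} → a ∈ as → f a ≡ false
    anyB-∉ {b ∷ as} h m with f b in eq
    anyB-∉ {b ∷ as} h (here refl) | false = eq
    anyB-∉ {b ∷ as} h (there m) | false = anyB-∉ h m

    anyB-cong : ∀ {g : A → Bool} as → (∀ a → f a ≡ g a) → anyB f as ≡ anyB g as
    anyB-cong [] h = refl
    anyB-cong (a ∷ as) h = cong₂ _∨_ (h a) (anyB-cong as h)

    allB-cong : ∀ {g : A → Bool} as → (∀ a → f a ≡ g a) → allB f as ≡ allB g as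
    allB-cong [] h = refl
    allB-cong (a ∷ as) h = cong₂ _∧_ (h a) (allB-cong as h)

    ind-anyB : ∀ as → ind (anyB f as) ≤ sumL as (λ a → ind (f a))
    ind-anyB [] = ≤-refl
    ind-anyB (a ∷ as) with f a
    ... | true = ≤-by (sumL as (λ b → ind (f b))) (sumL-nonneg as (λ b → 0≤ind (f b))) refl
    ... | false = ≤-trans (ind-anyB as) (≤-reflexive (sym (+-identityˡ _)))

    find-true : ∀ as → (∀ {a} → a ∈ as → f a ≡ false) ⊎ Σ A λ a → a ∈ as × f a ≡ true
    find-true [] = inj₁ λ ()
    find-true (a ∷ as) with f a in eq | find-true as
    ... | true | _ = inj₂ (a , here refl , eq)
    ... | false | inj₂ (b , m , e) = inj₂ (b , there m , e)
    ... | false | inj₁ h = inj₁ λ { (here refl) → eq ; (there m) → h m }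

  bool-ext : ∀ {a b} → (a ≡ true → b ≡ true) → (b ≡ true → a ≡ true) → a ≡ b
  bool-ext {true} {b} f g = sym (f refl)
  bool-ext {false} {true} f g = g refl
  bool-ext {false} {false} f g = refl

  ⌊⌋-true : ∀ {P : Set} {d : Dec P} → ⌊ d ⌋ ≡ true → P
  ⌊⌋-true {d = yes p} _ = p

  true-⌊⌋ : ∀ {P : Set} (d : Dec P) → P → ⌊ d ⌋ ≡ true
  true-⌊⌋ (yes _) p = refl
  true-⌊⌋ (no np) p = contradiction p np

  ⌊⌋-false : ∀ {P : Set} {d : Dec P} → ⌊ d ⌋ ≡ false → ¬ P
  ⌊⌋-false {d = no np} _ = np

  ∧-true : ∀ {a b} → a ∧ b ≡ true → a ≡ true × b ≡ true
  ∧-true {true} {true} _ = refl , refl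

  ∨-false : ∀ {a b} → a ∨ b ≡ false → a ≡ false × b ≡ false
  ∨-false {false} {false} _ = refl , refl

  ∧-intro : ∀ {a b} → a ≡ true → b ≡ true → a ∧ b ≡ true
  ∧-intro refl refl = refl

  -- The cleaning statement and its base case

  Family : ℕ → ℕ → Set
  Family n v = Subset v → Ω n v → Bool

  MeasurableFamily : ∀ {n v} → Family n v → Set
  MeasurableFamily {n} {v} B = ∀ I {x y : Ω n v} → x ≈[ I ] y → B I x ≡ B I y

  -- The cell of x under c, minus the sets Bad I with |I| > j, has measure at least δ.
  -- A Boolean superset G stands in for that set, so that no decidability is needed here.
  Rich : ∀ {n v} → Complex v → ℕ → System n v → Family n v → ℚ → Ω n v → Set
  Rich {n} {v} K j c Bad δ x = (G : Ω n v → Bool) →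
    (∀ y → key c ⊤ x ≡ key c ⊤ y → (∀ I → act K I → j ℕ.< ∣ I ∣ → Bad I y ≡ false) → G y ≡ true) → δ ≤ 𝔼 (ind ∘ G)

  Avoids : ∀ {n v} → Complex v → ℕ → Family n v → Ω n v → Set
  Avoids K j D x = ∀ I → act K I → j ℕ.≤ ∣ I ∣ → D I x ≡ false

  module _ (v : ℕ) where

    -- The tolerance `β` for the given bad sets does not depend on the length of the system, whereas
    -- `δ` does. The inductive step relies on this: its jump sets must be small by a standard that
    -- is known before the coarse partition, and hence its length, is chosen.
    Cleanable : ℕ → ℚ → ℚ → (ℕ → ℚ) → Set₁
    Cleanable j ε β δ = ∀ {n} (K : Complex v) → j ℕ.≤ rank K → (c : System n v) → Level j K c →
      (Bad : Family n v) → MeasurableFamily Bad → (∀ I → 𝔼 (ind ∘ Bad I) ≤ β) →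
      ¬ ((D : Family n v) → MeasurableFamily D → (∀ I → 𝔼 (ind ∘ D I) ≤ ε) →
         ¬ (∀ x → Avoids K j D x → Rich K j c Bad (δ (length c)) x))

    Cleaning : ℕ → Set₁
    Cleaning j = ∀ {ε} → 0ℚ < ε → Σ ℚ λ β → (0ℚ < β) × Σ (ℕ → ℚ) λ δ → (∀ i → 0ℚ < δ i) × Cleanable j ε β δ

  0<½ : 0ℚ < ½
  0<½ = *<* (ℤ.+<+ (ℕ.s≤s ℕ.z≤n))

  -- Sets of level 0 depend on no coordinate, so all points share one cell. By the choice of `β`,
  -- all the bad sets together cover at most half of the space.
  cleaning-zero : ∀ v → Cleaning v 0
  cleaning-zero v {ε} ε>0 = β , 0<* 0<½ (0<recip M) , (λ _ → ½) , (λ _ → 0<½) , clean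
    where
    M = subsets# v
    β = ½ * recip M
    clean : Cleanable v 0 ε β (λ _ → ½)
    clean {n} K _ c lev Bad _ small k = k (λ _ _ → false) (λ _ _ → refl)
      (λ _ → ≤-trans (≤-reflexive (𝔼-const {n} {v} 0ℚ)) (<⇒≤ ε>0)) λ x _ G hG → rich x G hG
      where
      S : Ω n v → ℚ
      S y = sumL (allSubsets v) (λ I → ind (Bad I y))
      0≤S : ∀ y → 0ℚ ≤ S y
      0≤S y = sumL-nonneg (allSubsets v) (λ I → 0≤ind (Bad I y))
      ES : 𝔼 S ≤ ½
      ES = ≤-trans (𝔼-union (allSubsets v) {F = λ I y → ind (Bad I y)} β (λ _ → ≤-refl) (λ I _ → small I))
        (≤-trans (*-monoʳ (<⇒≤ (0<* 0<½ (0<recip M))) (nat-mono (ℕₚ.n≤1+n M)))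
          (≤-reflexive (trans (solve 3 (λ m h r → m :* (h :* r) := h :* (r :* m)) refl (nat (suc M)) ½ (recip M))
            (trans (cong (½ *_) (recip-inv M)) (*-identityʳ ½)))))
      rich : ∀ x → Rich K 0 c Bad ½ x
      rich x G hG = begin
        ½ ≤⟨ ≤-by (½ - 𝔼 S) (0≤-diff ES) (solve 1 (λ s → con 1ℚ :- s := con ½ :+ (con ½ :- s)) refl (𝔼 S)) ⟩
        1ℚ - 𝔼 S ≡⟨ sym (trans (𝔼-- _ _) (cong (_- 𝔼 S) (𝔼-const {n} {v} 1ℚ))) ⟩
        𝔼 (λ y → 1ℚ - S y) ≤⟨ 𝔼-mono pointwise ⟩
        𝔼 (ind ∘ G) ∎
        where
        open ≤-Reasoning
        same-key : ∀ y → key c ⊤ x ≡ key c ⊤ y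
        same-key y = key-ext c (λ {it} m _ → meas it (λ i i∈ → contradiction (proj₂ (lev m)) (∉-card0 i∈)))
        1-≤ : ∀ a b → 0ℚ ≤ b → 1ℚ ≤ a → 1ℚ - b ≤ a
        1-≤ a b hb ha = ≤-by (b + (a - 1ℚ)) (0≤+ hb (0≤-diff ha)) (solve 2 (λ a b → a := con 1ℚ :- b :+ (b :+ (a :- con 1ℚ))) refl a b)
        pointwise : ∀ y → 1ℚ - S y ≤ ind (G y)
        pointwise y with find-true {f = λ I → Bad I y} (allSubsets v)
        ... | inj₁ h = 1-≤ _ _ (0≤S y) (≤-reflexive (sym (cong ind (hG y (same-key y) (λ I _ _ → h (∈-allSubsets I))))))
        ... | inj₂ (I , m , e) = ≤-trans (≤-by (S y - 1ℚ) (0≤-diff (≤-trans (≤-reflexive (sym (cong ind e))) (term≤sumL (λ J → 0≤ind (Bad J y)) m)))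
          (solve 1 (λ s → con 0ℚ := con 1ℚ :- s :+ (s :- con 1ℚ)) refl (S y))) (0≤ind (G y))

  -- Counting

  prodL : ∀ {A : Set} → List A → (A → ℚ) → ℚ
  prodL [] f = 1ℚ
  prodL (a ∷ as) f = f a * prodL as f

  _^ℚ_ : ℚ → ℕ → ℚ
  q ^ℚ zero = 1ℚ
  q ^ℚ suc k = q * (q ^ℚ k)

  0<^ : ∀ {q} → 0ℚ < q → ∀ k → 0ℚ < q ^ℚ k
  0<^ h zero = 0<1
  0<^ h (suc k) = 0<* h (0<^ h k)

  ^-anti : ∀ {q} → 0ℚ < q → q ≤ 1ℚ → ∀ {k l} → k ℕ.≤ l → q ^ℚ l ≤ q ^ℚ k
  ^-anti h le {l = zero} ℕ.z≤n = ≤-refl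
  ^-anti {q} h le {l = suc l} ℕ.z≤n = ≤-trans (*-mono (<⇒≤ (0<^ h l)) 0≤1 le (^-anti h le {l = l} ℕ.z≤n)) (≤-reflexive (*-identityˡ 1ℚ))
  ^-anti h le (ℕ.s≤s kl) = *-monoˡ (<⇒≤ h) (^-anti h le kl)

  module _ {A : Set} where

    prodL-≥ : ∀ (as : List A) {f q} → 0ℚ < q → (∀ {a} → a ∈ as → q ≤ f a) → q ^ℚ length as ≤ prodL as f
    prodL-≥ [] h le = ≤-refl
    prodL-≥ (a ∷ as) h le = *-mono (<⇒≤ (0<^ h (length as))) (≤-trans (<⇒≤ h) (le (here refl))) (le (here refl)) (prodL-≥ as h (λ m → le (there m)))

    prodL-nonneg : ∀ (as : List A) {f} → (∀ a → 0ℚ ≤ f a) → 0ℚ ≤ prodL as f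
    prodL-nonneg [] h = 0≤1
    prodL-nonneg (a ∷ as) h = 0≤* (h a) (prodL-nonneg as h)

    prodL-ind : ∀ (as : List A) (f : A → Bool) → prodL as (ind ∘ f) ≡ ind (allB f as)
    prodL-ind [] f = refl
    prodL-ind (a ∷ as) f = trans (cong (ind (f a) *_) (prodL-ind as f)) (sym (ind-∧ (f a) (allB f as)))

  0≤1-sq : ∀ {a} → 0ℚ ≤ a → a ≤ 1ℚ → a * a ≤ 1ℚ
  0≤1-sq h0 h1 = ≤-trans (*-mono h0 0≤1 h1 h1) (≤-reflexive (*-identityˡ 1ℚ))

  module _ {n v : ℕ} {Q : System n v} where

    Test-* : ∀ {S T : Ω n v → ℚ} → Test Q S → Test Q T → Test Q (λ x → S x * T x)
    Test-* {S} {T} s t = record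
      { dep = λ x y h → cong₂ _*_ (dep s x y h) (dep t x y h)
      ; sq-bd = λ x → ≤-trans (≤-reflexive (solve 2 (λ a b → (a :* b) :* (a :* b) := (a :* a) :* (b :* b)) refl (S x) (T x)))
          (≤-trans (*-mono (0≤sq (T x)) 0≤1 (sq-bd s x) (sq-bd t x)) (≤-reflexive (*-identityˡ 1ℚ)))
      }

    Test-neg : ∀ {T : Ω n v → ℚ} → Test Q T → Test Q (λ x → - T x)
    Test-neg {T} t = record
      { dep = λ x y h → cong -_ (dep t x y h)
      ; sq-bd = λ x → ≤-trans (≤-reflexive (solve 1 (λ a → (:- a) :* (:- a) := a :* a) refl (T x))) (sq-bd t x)
      }

    Test-ind : ∀ {b : Ω n v → Bool} → (∀ x y → (∀ {it} → it ∈ Q → fn it x ≡ fn it y) → b x ≡ b y) → Test Q (ind ∘ b)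
    Test-ind {b} h = record { dep = λ x y e → cong ind (h x y e) ; sq-bd = λ x → 0≤1-sq (0≤ind (b x)) (ind≤1 (b x)) }

    Test-prod : ∀ {A : Set} (as : List A) {F : A → Ω n v → ℚ} → (∀ {a} → a ∈ as → Test Q (F a)) → Test Q (λ x → prodL as (λ a → F a x))
    Test-prod [] h = record { dep = λ _ _ _ → refl ; sq-bd = λ _ → ≤-reflexive (*-identityˡ 1ℚ) }
    Test-prod (a ∷ as) h = Test-* (h (here refl)) (Test-prod as (λ m → h (there m)))

  Test-⊑ : ∀ {n v} {Q Q' : System n v} {T} → Q ⊑ Q' → Test Q T → Test Q' T
  Test-⊑ s t = record { dep = λ x y h → dep t x y (λ m → h (s m)) ; sq-bd = sq-bd t }

  hat-Test : ∀ {n v} (P : System n v) F → Test P (hat P F)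
  hat-Test P F = record { dep = λ x y h → cond-measurable (key P (dom F)) (val F) (key-ext P (λ m _ → h m)) ; sq-bd = hat²≤1 P F }

  -ind-bounds : ∀ b τ → 0ℚ ≤ τ → τ + τ ≤ 1ℚ → (- 1ℚ ≤ ind b - (τ + τ)) × (ind b - (τ + τ) ≤ 1ℚ)
  -ind-bounds true τ h u = ≤-by (1ℚ + (1ℚ - (τ + τ))) (0≤+ 0≤1 (0≤-diff u)) (solve 1 (λ t → con 1ℚ :- (t :+ t) := :- con 1ℚ :+ (con 1ℚ :+ (con 1ℚ :- (t :+ t)))) refl τ)
    , ≤-by (τ + τ) (0≤+ h h) (solve 1 (λ t → con 1ℚ := con 1ℚ :- (t :+ t) :+ (t :+ t)) refl τ)
  -ind-bounds false τ h u = ≤-by (1ℚ - (τ + τ)) (0≤-diff u) (solve 1 (λ t → con 0ℚ :- (t :+ t) := :- con 1ℚ :+ (con 1ℚ :- (t :+ t))) refl τ)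
    , ≤-by (1ℚ + (τ + τ)) (0≤+ 0≤1 (0≤+ h h)) (solve 1 (λ t → con 1ℚ := con 0ℚ :- (t :+ t) :+ (con 1ℚ :+ (t :+ t))) refl τ)

  ind-lower : ∀ b → - 1ℚ ≤ ind b
  ind-lower b = ≤-by (1ℚ + ind b) (0≤+ 0≤1 (0≤ind b)) (solve 1 (λ a → a := :- con 1ℚ :+ (con 1ℚ :+ a)) refl (ind b))

  scaled-bounds : ∀ {a} b → - 1ℚ ≤ a → a ≤ 1ℚ → (- 1ℚ ≤ a * ind b) × (a * ind b ≤ 1ℚ)
  scaled-bounds {a} true l u = subst (λ c → (- 1ℚ ≤ c) × (c ≤ 1ℚ)) (sym (*-identityʳ a)) (l , u)
  scaled-bounds {a} false l u = subst (λ c → (- 1ℚ ≤ c) × (c ≤ 1ℚ)) (sym (*-zeroʳ a)) (ind-lower false , 0≤1)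

  module _ {n v : ℕ} (c : System n v) where

    inCell : Subset v → List Bool → Ω n v → Bool
    inCell I t y = ⌊ t ≟L key c I y ⌋

    inCell-≈ : ∀ I t {x y} → x ≈[ I ] y → inCell I t x ≡ inCell I t y
    inCell-≈ I t e = cong (λ k → ⌊ t ≟L k ⌋) (key-≈ c e)

    cellItem : Subset v → List Bool → Item n v
    cellItem I t = record { set = I ; fn = inCell I t ; meas = inCell-≈ I t }

    cellFun : Subset v → List Bool → Fun n v
    cellFun I t = record
      { dom = I ; val = ind ∘ inCell I t ; val-meas = λ e → cong ind (inCell-≈ I t e)
      ; lower = λ x → ind-lower (inCell I t x) ; upper = λ x → ind≤1 (inCell I t x) }

    module _ (Bad : Family n v) (Bad-meas : MeasurableFamily Bad) (τ : ℚ) (τ≥0 : 0ℚ ≤ τ) (τ≤½ : τ + τ ≤ 1ℚ) where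

      badItem : Subset v → Item n v
      badItem I = record { set = I ; fn = Bad I ; meas = Bad-meas I }

      -- Its conditional expectation is nonpositive where Bad I has density at most 2 τ in the cell.
      excess : Subset v → List Bool → Fun n v
      excess I t = record
        { dom = I
        ; val = λ y → (ind (Bad I y) - (τ + τ)) * ind (inCell I t y)
        ; val-meas = λ e → cong₂ (λ a b → (ind a - (τ + τ)) * ind b) (Bad-meas I e) (inCell-≈ I t e)
        ; lower = λ y → proj₁ (scaled-bounds (inCell I t y) (proj₁ (bds y)) (proj₂ (bds y)))
        ; upper = λ y → proj₂ (scaled-bounds (inCell I t y) (proj₁ (bds y)) (proj₂ (bds y)))
        }
        where
        bds : ∀ y → (- 1ℚ ≤ ind (Bad I y) - (τ + τ)) × (ind (Bad I y) - (τ + τ) ≤ 1ℚ)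
        bds y = -ind-bounds (Bad I y) τ τ≥0 τ≤½

  -- Here `P` is the fine partition. The set `Y` consists of cells of `P`; on it the densities of
  -- the cells over the layer of size `suc l` will be at least `θ`, and the projected excesses
  -- nonpositive. The points of `Y` that lie in the cell of `x` and outside the higher bad sets are
  -- counted.
  module Counting
    {n v : ℕ} (l : ℕ) (K : Complex v) (l<rank : suc l ℕ.≤ rank K)
    (c : System n v) (lev : Level (suc l) K c)
    (Bad : Family n v) (Bad-meas : MeasurableFamily Bad) {τ : ℚ} (τ≥0 : 0ℚ ≤ τ) (τ≤½ : τ + τ ≤ 1ℚ)
    (x : Ω n v) (P : System n v) (levP : Level l K P) (η : ℚ) (η≥0 : 0ℚ ≤ η)
    (Y : Ω n v → Bool) (Y-dep : ∀ y z → (∀ {it} → it ∈ P → fn it y ≡ fn it z) → Y y ≡ Y z)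
    {θ : ℚ} (θ>0 : 0ℚ < θ)
    where

    C LJ# : ℕ
    -- Besides `P`, a test uses at most one cell for each set of the layer and, in `bad-mass`, two
    -- more sets: a bad set and the cell over its index.
    C = 2 ℕ.+ subsets# v

    LJ : List (Subset v)
    LJ = layer K (suc l)
    LJ# = length LJ

    t : Subset v → List Bool
    t I = key c I x

    cell : Subset v → Ω n v → Bool
    cell I = inCell c I (t I)

    F : Subset v → Fun n v
    F I = cellFun c I (t I)

    u : Subset v → Fun n v
    u I = excess c Bad Bad-meas τ τ≥0 τ≤½ I (t I)

    A g : Subset v → Ω n v → ℚ
    A I = val (F I)
    g I = hat P (F I)

    module _
      (F-uniform : ∀ {J} → J ∈ LJ → Pseudorandom l C P (F J) η)
      (u-uniform : ∀ {I} → I ∈ above K (suc (suc l)) → Pseudorandom l C P (u I) η)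
      (θ≤g : ∀ {J} → J ∈ LJ → ∀ y → Y y ≡ true → θ ≤ g J y)
      (û≤0 : ∀ {I} → I ∈ above K (suc (suc l)) → ∀ y → Y y ≡ true → hat P (u I) y ≤ 0ℚ)
      where

      ΠA Πg : List (Subset v) → Ω n v → ℚ
      ΠA 𝒥 y = prodL 𝒥 (λ J → A J y)
      Πg 𝒥 y = prodL 𝒥 (λ J → g J y)

      0≤g : ∀ J y → 0ℚ ≤ g J y
      0≤g J = cond-lower (key P J) (λ y → 0≤ind (cell J y))

      P-small : ∀ {J it} → it ∈ P → ∣ set it ∩ J ∣ ℕ.≤ l
      P-small {J} {it} m = ℕₚ.≤-trans (∣p∩q∣≤∣p∣ (set it) J) (proj₂ (levP m))

      -- The cells are replaced by their projected densities one at a time, each at cost `η`. When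
      -- `J` is treated, the cells not yet replaced belong to the test: their sets differ from `J`
      -- and have its size, so they meet it in at most `l` points. The densities already inserted
      -- are functions on `P` and join the weight `W`.
      telescope : ∀ 𝒥 → Unique 𝒥 → (∀ {J} → J ∈ 𝒥 → J ∈ LJ) → ∀ {Q W} → P ⊑ Q → Test Q W →
        (∀ {it J} → it ∈ Q → J ∈ 𝒥 → ∣ set it ∩ J ∣ ℕ.≤ l) → length Q ℕ.+ length 𝒥 ℕ.≤ length P ℕ.+ C →
        𝔼 (λ y → W y * ΠA 𝒥 y) ≤ 𝔼 (λ y → W y * Πg 𝒥 y) + nat (length 𝒥) * η
      telescope [] _ _ {W = W} _ _ _ _ = ≤-reflexive (sym (trans (cong (𝔼 (λ y → W y * 1ℚ) +_) (*-zeroˡ η)) (+-identityʳ _)))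
      telescope (J ∷ 𝒥) (J∉ ∷ uniq) in-LJ {Q} {W} P⊑Q tW small len = begin
        𝔼 (λ y → W y * (A J y * ΠA 𝒥 y))
          ≡⟨ 𝔼-cong (λ y → solve 4 (λ w a g p → w :* (a :* p) := (a :- g) :* (w :* p) :+ (w :* g) :* p) refl (W y) (A J y) (g J y) (ΠA 𝒥 y)) ⟩
        𝔼 (λ y → (A J y - g J y) * (W y * ΠA 𝒥 y) + (W y * g J y) * ΠA 𝒥 y) ≡⟨ 𝔼-+ _ _ ⟩
        𝔼 (λ y → (A J y - g J y) * (W y * ΠA 𝒥 y)) + 𝔼 (λ y → (W y * g J y) * ΠA 𝒥 y)
          ≤⟨ +-mono-≤ (F-uniform (in-LJ (here refl)) Q' len' small' _ tWA)
               (telescope 𝒥 uniq (λ m → in-LJ (there m)) P⊑Q (Test-* tW (Test-⊑ P⊑Q (hat-Test P (F J)))) (λ a b → small a (there b))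
                 (ℕₚ.≤-trans (ℕₚ.+-monoʳ-≤ (length Q) (ℕₚ.n≤1+n _)) len)) ⟩
        η + (𝔼 (λ y → (W y * g J y) * Πg 𝒥 y) + nat (length 𝒥) * η)
          ≡⟨ solve 3 (λ e s k → e :+ (s :+ k :* e) := s :+ (con 1ℚ :+ k) :* e) refl η (𝔼 (λ y → (W y * g J y) * Πg 𝒥 y)) (nat (length 𝒥)) ⟩
        𝔼 (λ y → (W y * g J y) * Πg 𝒥 y) + nat (length (J ∷ 𝒥)) * η
          ≡⟨ cong (_+ nat (length (J ∷ 𝒥)) * η) (𝔼-cong (λ y → *-assoc (W y) (g J y) (Πg 𝒥 y))) ⟩
        𝔼 (λ y → W y * (g J y * Πg 𝒥 y)) + nat (length (J ∷ 𝒥)) * η ∎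
        where
        open ≤-Reasoning
        items : System n v
        items = map (λ I → cellItem c I (t I)) 𝒥
        Q' : System n v
        Q' = Q ++ items
        len' : length Q' ℕ.≤ length P ℕ.+ C
        len' = ℕₚ.≤-trans (ℕₚ.≤-reflexive (trans (length-++ Q) (cong (length Q ℕ.+_) (length-map _ 𝒥))))
          (ℕₚ.≤-trans (ℕₚ.+-monoʳ-≤ (length Q) (ℕₚ.n≤1+n _)) len)
        small' : ∀ {it} → it ∈ Q' → ∣ set it ∩ J ∣ ℕ.≤ l
        small' m with ∈-++⁻ Q m
        ... | inj₁ m' = small m' (here refl)
        ... | inj₂ m' with ∈-map⁻ (λ I → cellItem c I (t I)) m'
        ... | J' , J'∈ , refl = ∩-card cardJ λ J⊆J' →
          All.lookup J∉ J'∈ (⊆-antisym (λ {i} → J⊆J' {i}) (λ {i} → ⊆-card≡ J⊆J' (ℕₚ.≤-reflexive (trans cardJ' (sym cardJ))) {i}))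
          where
          cardJ = proj₂ (layer-∈ K (in-LJ (here refl)))
          cardJ' = proj₂ (layer-∈ K (in-LJ (there J'∈)))
        tWA : Test Q' (λ y → W y * ΠA 𝒥 y)
        tWA = Test-* (Test-⊑ ∈-++⁺ˡ tW) (Test-prod 𝒥 (λ m → Test-ind (λ y z h → h (∈-++⁺ʳ Q (∈-map⁺ (λ I → cellItem c I (t I)) m)))))

      1Y : Ω n v → ℚ
      1Y y = ind (Y y)

      tY : Test P 1Y
      tY = Test-ind Y-dep

      X : ℚ
      X = 𝔼 (λ y → 1Y y * ΠA LJ y)

      |LJ|≤ : length LJ ℕ.≤ subsets# v
      |LJ|≤ = layer-length K (suc l)

      X-lower : 𝔼 1Y * (θ ^ℚ LJ#) ≤ X + nat LJ# * η
      X-lower = begin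
        𝔼 1Y * (θ ^ℚ LJ#) ≡⟨ sym (𝔼-*ʳ 1Y (θ ^ℚ LJ#)) ⟩
        𝔼 (λ y → 1Y y * (θ ^ℚ LJ#)) ≤⟨ 𝔼-mono pointwise ⟩
        𝔼 (λ y → 1Y y * Πg LJ y) ≡⟨ solve 2 (λ a b → a := b :+ (a :- b)) refl Z X ⟩
        X + (Z - X) ≤⟨ +-monoʳ-≤ X Z-X ⟩
        X + nat LJ# * η ∎
        where
        open ≤-Reasoning
        Z = 𝔼 (λ y → 1Y y * Πg LJ y)
        pointwise : ∀ y → 1Y y * (θ ^ℚ LJ#) ≤ 1Y y * Πg LJ y
        pointwise y with Y y in eq
        ... | true = *-monoˡ 0≤1 (prodL-≥ LJ θ>0 (λ m → θ≤g m y eq))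
        ... | false = ≤-reflexive (trans (*-zeroˡ (θ ^ℚ LJ#)) (sym (*-zeroˡ (Πg LJ y))))
        neg : ∀ (f : Ω n v → ℚ) → 𝔼 (λ y → (- 1Y y) * f y) ≡ - 𝔼 (λ y → 1Y y * f y)
        neg f = trans (𝔼-cong (λ y → sym (neg-distribˡ-* (1Y y) (f y)))) (𝔼-neg _)
        -- As `telescope` bounds from above only, it is applied to the weight `- 1Y`.
        -X≤ : - X ≤ - Z + nat LJ# * η
        -X≤ = ≤-trans (≤-reflexive (sym (neg (ΠA LJ)))) (≤-trans
          (telescope LJ (layer-unique K (suc l)) (λ m → m) {P} (λ m → m) (Test-neg tY) (λ m _ → P-small m)
            (ℕₚ.+-monoʳ-≤ (length P) (ℕₚ.≤-trans |LJ|≤ (ℕₚ.m≤n+m _ 2))))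
          (≤-reflexive (cong (_+ nat LJ# * η) (neg (Πg LJ)))))
        Z-X : Z - X ≤ nat LJ# * η
        Z-X = diff-≤ (≤-trans (0≤-diff -X≤) (≤-reflexive (solve 3 (λ x z e → (:- z :+ e) :- (:- x) := e :- (z :- x)) refl X Z (nat LJ# * η))))

      -- Each set of the system has size at most `suc l` and so extends to a member of the layer,
      -- whose cell already decides it.
      cell-⊤ : ∀ y → allB (λ J → cell J y) LJ ≡ true → key c ⊤ x ≡ key c ⊤ y
      cell-⊤ y h = key-ext c λ {it} m _ → go it m
        where
        go : ∀ it → it ∈ c → fn it x ≡ fn it y
        go it m with extend K (proj₁ (lev m)) (proj₂ (lev m)) l<rank
        ... | J , sub , aJ , eJ = key-∈ {P = c} (⌊⌋-true (allB-∈ h (∈-layer K aJ eJ))) m sub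

      outside : Subset v → List (Subset v)
      outside I = filter (λ J → ¬? (J ⊆? I)) LJ

      -- All factors over subsets of `I` merge into the single cell over `I`, which can then be
      -- joined with `Bad I`. The remaining sets of the layer meet `I` in at most `l` points, as a
      -- test requires.
      split-cell : ∀ I y → cell I y ∧ allB (λ J → cell J y) (outside I) ≡ allB (λ J → cell J y) LJ
      split-cell I y = bool-ext to from
        where
        from : allB (λ J → cell J y) LJ ≡ true → cell I y ∧ allB (λ J → cell J y) (outside I) ≡ true
        from h = ∧-intro (true-⌊⌋ (t I ≟L key c I y) (key-mono {P = c} {I} {⊤} ⊆⊤ (cell-⊤ y h)))
          (∈-allB (outside I) (λ m → allB-∈ h (proj₁ (∈-filter⁻ (λ J → ¬? (J ⊆? I)) {xs = LJ} m))))
        to : cell I y ∧ allB (λ J → cell J y) (outside I) ≡ true → allB (λ J → cell J y) LJ ≡ true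
        to h = ∈-allB LJ inside
          where
          inside : ∀ {J} → J ∈ LJ → cell J y ≡ true
          inside {J} m with J ⊆? I
          ... | yes s = true-⌊⌋ (t J ≟L key c J y) (key-mono {P = c} {J} {I} s (⌊⌋-true (proj₁ (∧-true {cell I y} h))))
          ... | no ns = allB-∈ (proj₂ (∧-true {cell I y} h)) (∈-filter⁺ (λ J → ¬? (J ⊆? I)) m (λ s → ns s))

      ΠA-ind : ∀ 𝒥 y → ΠA 𝒥 y ≡ ind (allB (λ J → cell J y) 𝒥)
      ΠA-ind 𝒥 y = prodL-ind 𝒥 (λ J → cell J y)

      -- The indicator of `Bad I` is split as `τ + τ` plus the rest. The first part gives a fraction
      -- of `X`; the second, times the cell over `I`, is the excess. Its projection is nonpositive
      -- on `Y`, so it contributes errors only: one for each factor outside `I`, and one for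
      -- replacing the excess by its projection.
      bad-mass : ∀ {I} → I ∈ above K (suc (suc l)) →
        𝔼 (λ y → 1Y y * ind (Bad I y) * ΠA LJ y) ≤ (τ + τ) * X + nat (suc (subsets# v)) * η
      bad-mass {I} I∈ = begin
        𝔼 (λ y → 1Y y * ind (Bad I y) * ΠA LJ y) ≡⟨ 𝔼-cong pointwise ⟩
        𝔼 (λ y → (τ + τ) * (1Y y * ΠA LJ y) + W y * ΠA O y) ≡⟨ trans (𝔼-+ _ _) (cong (_+ 𝔼 (λ y → W y * ΠA O y)) (𝔼-* (τ + τ) _)) ⟩
        (τ + τ) * X + 𝔼 (λ y → W y * ΠA O y) ≤⟨ +-monoʳ-≤ ((τ + τ) * X) tele ⟩
        (τ + τ) * X + (𝔼 (λ y → W y * Πg O y) + nat (length O) * η) ≤⟨ +-monoʳ-≤ ((τ + τ) * X) (+-mono-≤ last (*-monoʳ η≥0 (nat-mono O≤))) ⟩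
        (τ + τ) * X + (η + nat (subsets# v) * η)
          ≡⟨ cong ((τ + τ) * X +_) (solve 2 (λ e k → e :+ k :* e := (con 1ℚ :+ k) :* e) refl η (nat (subsets# v))) ⟩
        (τ + τ) * X + nat (suc (subsets# v)) * η ∎
        where
        open ≤-Reasoning
        O = outside I
        W : Ω n v → ℚ
        W y = 1Y y * val (u I) y
        O≤ : length O ℕ.≤ subsets# v
        O≤ = ℕₚ.≤-trans (length-filter _ LJ) |LJ|≤
        pointwise : ∀ y → 1Y y * ind (Bad I y) * ΠA LJ y ≡ (τ + τ) * (1Y y * ΠA LJ y) + W y * ΠA O y
        pointwise y = begin-equality
          1Y y * ind (Bad I y) * ΠA LJ y ≡⟨ cong (1Y y * ind (Bad I y) *_) eq ⟩
          1Y y * ind (Bad I y) * (A I y * ΠA O y)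
            ≡⟨ solve 5 (λ w b a o t → w :* b :* (a :* o) := (t :+ t) :* (w :* (a :* o)) :+ (w :* ((b :- (t :+ t)) :* a)) :* o) refl (1Y y) (ind (Bad I y)) (A I y) (ΠA O y) τ ⟩
          (τ + τ) * (1Y y * (A I y * ΠA O y)) + W y * ΠA O y ≡⟨ cong (λ a → (τ + τ) * (1Y y * a) + W y * ΠA O y) (sym eq) ⟩
          (τ + τ) * (1Y y * ΠA LJ y) + W y * ΠA O y ∎
          where
          eq : ΠA LJ y ≡ A I y * ΠA O y
          eq = trans (ΠA-ind LJ y) (trans (cong ind (sym (split-cell I y)))
            (trans (ind-∧ (cell I y) _) (cong (A I y *_) (sym (ΠA-ind O y)))))
        Q : System n v
        Q = badItem c Bad Bad-meas τ τ≥0 τ≤½ I ∷ cellItem c I (t I) ∷ P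
        tW : Test Q W
        tW = Test-* (Test-⊑ (λ m → there (there m)) tY) (record
          { dep = λ y z h → cong₂ (λ a b → (ind a - (τ + τ)) * ind b) (h (here refl)) (h (there (here refl)))
          ; sq-bd = λ y → sq≤1 (lower (u I) y) (upper (u I) y) })
        small : ∀ {it J} → it ∈ Q → J ∈ O → ∣ set it ∩ J ∣ ℕ.≤ l
        small {it} {J} m J∈ = go m
          where
          J∈′ = ∈-filter⁻ (λ J → ¬? (J ⊆? I)) {xs = LJ} J∈
          I∩J : ∣ I ∩ J ∣ ℕ.≤ l
          I∩J = ∩-card (proj₂ (layer-∈ K (proj₁ J∈′))) (proj₂ J∈′)
          go : it ∈ Q → ∣ set it ∩ J ∣ ℕ.≤ l
          go (here refl) = I∩J
          go (there (here refl)) = I∩J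
          go (there (there m)) = P-small m
        tele : 𝔼 (λ y → W y * ΠA O y) ≤ 𝔼 (λ y → W y * Πg O y) + nat (length O) * η
        tele = telescope O (Uniqueₚ.filter⁺ (λ J → ¬? (J ⊆? I)) (layer-unique K (suc l)))
          (λ m → proj₁ (∈-filter⁻ (λ J → ¬? (J ⊆? I)) {xs = LJ} m)) {Q} (λ m → there (there m)) tW small
          (ℕₚ.≤-trans (ℕₚ.≤-reflexive (trans (cong (2 ℕ.+_) refl) (ℕₚ.+-comm (2 ℕ.+ length P) (length O))))
            (ℕₚ.≤-trans (ℕₚ.+-monoˡ-≤ (2 ℕ.+ length P) O≤)
              (ℕₚ.≤-reflexive (trans (ℕₚ.+-comm (subsets# v) (2 ℕ.+ length P))
                (trans (cong (ℕ._+ subsets# v) (ℕₚ.+-comm 2 (length P))) (ℕₚ.+-assoc (length P) 2 (subsets# v)))))))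
        T : Ω n v → ℚ
        T y = 1Y y * Πg O y
        tT : Test P T
        tT = Test-* tY (Test-prod O (λ {J} _ → hat-Test P (F J)))
        last : 𝔼 (λ y → W y * Πg O y) ≤ η
        last = begin
          𝔼 (λ y → W y * Πg O y)
            ≡⟨ 𝔼-cong (λ y → solve 4 (λ w a h p → w :* a :* p := (a :- h) :* (w :* p) :+ h :* (w :* p)) refl (1Y y) (val (u I) y) (hat P (u I) y) (Πg O y)) ⟩
          𝔼 (λ y → (val (u I) y - hat P (u I) y) * T y + hat P (u I) y * T y) ≡⟨ 𝔼-+ _ _ ⟩
          𝔼 (λ y → (val (u I) y - hat P (u I) y) * T y) + 𝔼 (λ y → hat P (u I) y * T y)
            ≤⟨ +-mono-≤ (u-uniform I∈ P (ℕₚ.m≤m+n _ _) P-small T tT) (𝔼-≤c neg) ⟩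
          η + 0ℚ ≡⟨ +-identityʳ η ⟩
          η ∎
          where
          neg : ∀ y → hat P (u I) y * T y ≤ 0ℚ
          neg y with Y y in eq
          ... | true = ≤-trans (*-monoʳ (0≤* 0≤1 (prodL-nonneg O (λ J → 0≤g J y))) (û≤0 I∈ y eq)) (≤-reflexive (*-zeroˡ (1ℚ * Πg O y)))
          ... | false = ≤-reflexive (trans (cong (hat P (u I) y *_) (*-zeroˡ (Πg O y))) (*-zeroʳ (hat P (u I) y)))

      main-count : ∀ {G : Ω n v → Bool} →
        (∀ y → key c ⊤ x ≡ key c ⊤ y → (∀ I → act K I → suc l ℕ.< ∣ I ∣ → Bad I y ≡ false) → G y ≡ true) →
        X - nat (subsets# v) * ((τ + τ) * X + nat (suc (subsets# v)) * η) ≤ 𝔼 (ind ∘ G)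
      main-count {G} hG = begin
        X - nat (subsets# v) * B ≤⟨ +-monoʳ-≤ X (neg-antimono-≤ (*-monoʳ B≥0 (nat-mono (above-length K (suc (suc l)))))) ⟩
        X - nat (length U) * B ≤⟨ +-monoʳ-≤ X (neg-antimono-≤ (𝔼-union U {F = bad} B (λ _ → ≤-refl) (λ I m → bad-mass m))) ⟩
        X - 𝔼 (λ y → sumL U (λ I → bad I y)) ≡⟨ sym (𝔼-- _ _) ⟩
        𝔼 (λ y → 1Y y * ΠA LJ y - sumL U (λ I → bad I y)) ≤⟨ 𝔼-mono pointwise ⟩
        𝔼 (ind ∘ G) ∎
        where
        open ≤-Reasoning
        U = above K (suc (suc l))
        B = (τ + τ) * X + nat (suc (subsets# v)) * η
        0≤ΠA : ∀ y → 0ℚ ≤ ΠA LJ y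
        0≤ΠA y = prodL-nonneg LJ (λ J → 0≤ind (cell J y))
        B≥0 : 0ℚ ≤ B
        B≥0 = 0≤+ (0≤* (0≤+ τ≥0 τ≥0) (𝔼-nonneg (λ y → 0≤* (0≤ind (Y y)) (0≤ΠA y)))) (0≤* (0≤nat (suc (subsets# v))) η≥0)
        bad : Subset v → Ω n v → ℚ
        bad I y = 1Y y * ind (Bad I y) * ΠA LJ y
        0≤bad : ∀ y I → 0ℚ ≤ bad I y
        0≤bad y I = 0≤* (0≤* (0≤ind (Y y)) (0≤ind (Bad I y))) (0≤ΠA y)
        drop : ∀ {a b} → 0ℚ ≤ b → a - b ≤ a
        drop {a} {b} h = ≤-by b h (solve 2 (λ a b → a := a :- b :+ b) refl a b)
        -- The left side is nonpositive outside the cell of `x`, and also inside some bad set, where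
        -- one summand cancels the main term; elsewhere it is at most 1.
        pointwise : ∀ y → 1Y y * ΠA LJ y - sumL U (λ I → bad I y) ≤ ind (G y)
        pointwise y with allB (λ J → cell J y) LJ in eq | find-true {f = λ I → Bad I y} U
        ... | false | _ = ≤-trans (drop (sumL-nonneg U (0≤bad y)))
          (≤-trans (≤-reflexive (trans (cong (1Y y *_) (trans (ΠA-ind LJ y) (cong ind eq))) (*-zeroʳ (1Y y)))) (0≤ind (G y)))
        ... | true | inj₁ none = ≤-trans (drop (sumL-nonneg U (0≤bad y)))
          (≤-trans (≤-trans (*-mono (0≤ΠA y) 0≤1 (ind≤1 (Y y)) (≤-trans (≤-reflexive (ΠA-ind LJ y)) (ind≤1 (allB (λ J → cell J y) LJ)))) (≤-reflexive (*-identityˡ 1ℚ)))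
            (≤-reflexive (sym (cong ind (hG y (cell-⊤ y eq) (λ I a h → none (∈-above K a h)))))))
        ... | true | inj₂ (I , m , e) = ≤-trans (diff≤0 (≤-trans (≤-reflexive (sym bad≡)) (term≤sumL (0≤bad y) m))) (0≤ind (G y))
          where
          bad≡ : bad I y ≡ 1Y y * ΠA LJ y
          bad≡ = cong (_* ΠA LJ y) (trans (cong (λ b → 1Y y * ind b) e) (*-identityʳ (1Y y)))
          diff≤0 : ∀ {a b} → a ≤ b → a - b ≤ 0ℚ
          diff≤0 {a} {b} h = ≤-by (b - a) (0≤-diff h) (solve 2 (λ a b → con 0ℚ := a :- b :+ (b :- a)) refl a b)

  -- Induction on the level

  nat-recip≤1 : ∀ k → nat k * recip k ≤ 1ℚ
  nat-recip≤1 k = ≤-trans (*-monoʳ (<⇒≤ (0<recip k)) (nat-mono (ℕₚ.n≤1+n k))) (≤-reflexive (trans (*-comm (nat (suc k)) (recip k)) (recip-inv k)))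

  recip≤1 : ∀ k → recip k ≤ 1ℚ
  recip≤1 k = ≤-trans (≤-trans (≤-reflexive (sym (*-identityˡ (recip k)))) (*-monoʳ {1ℚ} {nat (suc k)} (<⇒≤ (0<recip k)) (≤-by (nat k) (0≤nat k) refl)))
    (≤-reflexive (trans (*-comm (nat (suc k)) (recip k)) (recip-inv k)))

  thirds : ∀ ε → ε * recip 2 + (ε * recip 2 + ε * recip 2) ≡ ε
  thirds ε = trans (solve 2 (λ e r → e :* r :+ (e :* r :+ e :* r) := e :* (r :* (con 1ℚ :+ (con 1ℚ :+ (con 1ℚ :+ con 0ℚ))))) refl ε (recip 2))
    (trans (cong (ε *_) (recip-inv 2)) (*-identityʳ ε))

  length-cartesianProduct : ∀ {A B : Set} (as : List A) (bs : List B) → length (cartesianProduct as bs) ≡ length as ℕ.* length bs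
  length-cartesianProduct [] bs = refl
  length-cartesianProduct (a ∷ as) bs = trans (length-++ (map (a ,_) bs)) (cong₂ ℕ._+_ (length-map (a ,_) bs) (length-cartesianProduct as bs))

  markov : ∀ {n v} {f : Ω n v → ℚ} {τ c} → 0ℚ < τ → (∀ x → 0ℚ ≤ f x) → 𝔼 f ≤ τ * c → 𝔼 (λ x → ind ⌊ τ <? f x ⌋) ≤ c
  markov {n} {v} {f} {τ} {c} τ>0 f≥0 h = *-cancelˡ-≤-pos τ {{positive τ>0}} (≤-trans (≤-trans (≤-reflexive (sym (𝔼-* τ _))) (𝔼-mono pointwise)) h)
    where
    pointwise : ∀ x → τ * ind ⌊ τ <? f x ⌋ ≤ f x
    pointwise x with τ <? f x
    ... | yes p = ≤-trans (≤-reflexive (*-identityʳ τ)) (<⇒≤ p)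
    ... | no _ = ≤-trans (≤-reflexive (*-zeroʳ τ)) (f≥0 x)

  ind-∨ : ∀ a b → ind (a ∨ b) ≤ ind a + ind b
  ind-∨ true b = ≤-by (ind b) (0≤ind b) refl
  ind-∨ false b = ≤-reflexive (sym (+-identityˡ (ind b)))

  𝔼-cond : ∀ {n v} (κ : Ω n v → List Bool) f → 𝔼 (cond κ f) ≡ 𝔼 f
  𝔼-cond κ f = trans (𝔼-cong (λ x → sym (*-identityʳ (cond κ f x)))) (trans (cond-orth κ f {λ _ → 1ℚ} (λ _ → refl)) (𝔼-cong (λ x → *-identityʳ (f x))))

  module _ {n v : ℕ} (c P : System n v) (I : Subset v) where

    cellDensity : Ω n v → ℚ
    cellDensity x = hat P (cellFun c I (key c I x)) x

    cellDensity-≈ : ∀ {x y} → x ≈[ I ] y → cellDensity x ≡ cellDensity y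
    cellDensity-≈ {x} {y} e = trans (cong (λ t → hat P (cellFun c I t) x) (key-≈ c e)) (hat-≈ P (cellFun c I (key c I y)) e)

    -- For a fixed key, the set where its density given `P` is below `ε` is measurable for `P`, so
    -- the part of the cell in that set has measure at most `ε`. A union bound over all keys
    -- follows.
    rare-cells : ∀ {ε} → 0ℚ ≤ ε → 𝔼 (λ x → ind ⌊ cellDensity x <? ε ⌋) ≤ nat (length (boolLists (length c))) * ε
    rare-cells {ε} ε≥0 = 𝔼-union ts {F = λ t x → ind (inCell c I t x) * ind ⌊ hat P (cellFun c I t) x <? ε ⌋} ε pointwise λ t _ → each t
      where
      ts = boolLists (length c)
      pointwise : ∀ x → ind ⌊ cellDensity x <? ε ⌋ ≤ sumL ts (λ t → ind (inCell c I t x) * ind ⌊ hat P (cellFun c I t) x <? ε ⌋)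
      pointwise x = ≤-trans (≤-reflexive (sym (trans (cong (_* ind ⌊ cellDensity x <? ε ⌋) (ind-yes (key c I x ≟L key c I x) refl)) (*-identityˡ _))))
        (term≤sumL {f = λ t → ind (inCell c I t x) * ind ⌊ hat P (cellFun c I t) x <? ε ⌋} (λ t → 0≤* (0≤ind (inCell c I t x)) (0≤ind ⌊ hat P (cellFun c I t) x <? ε ⌋))
          (subst (λ k → key c I x ∈ boolLists k) (key-length c I x) (∈-boolLists (key c I x))))
      each : ∀ t → 𝔼 (λ x → ind (inCell c I t x) * ind ⌊ hat P (cellFun c I t) x <? ε ⌋) ≤ ε
      each t = ≤-trans (≤-reflexive (sym (cond-orth (key P I) (val (cellFun c I t)) {λ x → ind ⌊ hat P (cellFun c I t) x <? ε ⌋}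
        (λ e → cong (λ q → ind ⌊ q <? ε ⌋) (cond-measurable (key P I) (val (cellFun c I t)) e))))) (𝔼-≤c small)
        where
        small : ∀ x → hat P (cellFun c I t) x * ind ⌊ hat P (cellFun c I t) x <? ε ⌋ ≤ ε
        small x with hat P (cellFun c I t) x <? ε
        ... | yes p = ≤-trans (≤-reflexive (*-identityʳ _)) (<⇒≤ p)
        ... | no _ = ≤-trans (≤-reflexive (*-zeroʳ (hat P (cellFun c I t) x))) ε≥0

    same-++ : ∀ x y → same (key (c ++ P) I) (key (c ++ P) I x) y ≡ same (key P I) (key P I x) y * ind (inCell c I (key c I x) y)
    same-++ x y = trans (cong ind (bool-ext to from)) (ind-∧ ⌊ key P I x ≟L key P I y ⌋ (inCell c I (key c I x) y))
      where
      to : ⌊ key (c ++ P) I x ≟L key (c ++ P) I y ⌋ ≡ true → ⌊ key P I x ≟L key P I y ⌋ ∧ inCell c I (key c I x) y ≡ true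
      to h = ∧-intro (true-⌊⌋ (key P I x ≟L key P I y) (key-⊆ {P = P} {c ++ P} (∈-++⁺ʳ c) (⌊⌋-true h)))
        (true-⌊⌋ (key c I x ≟L key c I y) (key-⊆ {P = c} {c ++ P} ∈-++⁺ˡ (⌊⌋-true h)))
      from : ⌊ key P I x ≟L key P I y ⌋ ∧ inCell c I (key c I x) y ≡ true → ⌊ key (c ++ P) I x ≟L key (c ++ P) I y ⌋ ≡ true
      from h = true-⌊⌋ (key (c ++ P) I x ≟L key (c ++ P) I y) (key-ext (c ++ P) λ m s →
        [ (λ m′ → key-∈ {P = c} (⌊⌋-true (proj₂ h′)) m′ s) , (λ m′ → key-∈ {P = P} (⌊⌋-true (proj₁ h′)) m′ s) ]′ (∈-++⁻ c m))
        where h′ = ∧-true {⌊ key P I x ≟L key P I y ⌋} h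

    -- The density of Bad in the cell of x under c ++ P is the quotient of its density, given P,
    -- in the cell of x under c by cellDensity x.
    excess-small : (Bad : Family n v) (Bm : MeasurableFamily Bad) {τ : ℚ} (τ≥0 : 0ℚ ≤ τ) (τ≤½ : τ + τ ≤ 1ℚ) →
      ∀ x → cond (key (c ++ P) I) (ind ∘ Bad I) x ≤ τ →
      hat P (excess c Bad Bm τ τ≥0 τ≤½ I (key c I x)) x ≤ - (τ * cellDensity x)
    excess-small Bad Bm {τ} τ≥0 τ≤½ x b≤τ = cond-≤ (key P I) x (begin
      𝔼 (λ y → s y * ((ind (Bad I y) - (τ + τ)) * a y))
        ≡⟨ 𝔼-cong (λ y → trans (solve 4 (λ s b a t → s :* ((b :- (t :+ t)) :* a) := (s :* a) :* b :- (t :+ t) :* (s :* a)) refl (s y) (ind (Bad I y)) (a y) τ)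
             (cong (λ w → w * ind (Bad I y) - (τ + τ) * (s y * a y)) (sym (same-++ x y)))) ⟩
      𝔼 (λ y → s′ y * ind (Bad I y) - (τ + τ) * (s y * a y)) ≡⟨ trans (𝔼-- _ _) (cong (_-_ (𝔼 (λ y → s′ y * ind (Bad I y)))) (𝔼-* (τ + τ) _)) ⟩
      𝔼 (λ y → s′ y * ind (Bad I y)) - (τ + τ) * 𝔼 (λ y → s y * a y)
        ≡⟨ cong (_- (τ + τ) * 𝔼 (λ y → s y * a y)) (sym (cond-cls (key (c ++ P) I) (ind ∘ Bad I) x)) ⟩
      cond (key (c ++ P) I) (ind ∘ Bad I) x * N′ - (τ + τ) * 𝔼 (λ y → s y * a y)
        ≤⟨ +-monoˡ-≤ _ (*-monoʳ (<⇒≤ (0<cls (key (c ++ P) I) x)) b≤τ) ⟩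
      τ * N′ - (τ + τ) * 𝔼 (λ y → s y * a y) ≡⟨ cong (λ w → τ * w - (τ + τ) * 𝔼 (λ y → s y * a y)) (𝔼-cong (same-++ x)) ⟩
      τ * 𝔼 (λ y → s y * a y) - (τ + τ) * 𝔼 (λ y → s y * a y)
        ≡⟨ solve 2 (λ t e → t :* e :- (t :+ t) :* e := :- (t :* e)) refl τ (𝔼 (λ y → s y * a y)) ⟩
      - (τ * 𝔼 (λ y → s y * a y)) ≡⟨ cong (λ w → - (τ * w)) (sym (cond-cls (key P I) a x)) ⟩
      - (τ * (cellDensity x * N)) ≡⟨ solve 3 (λ t d k → :- (t :* (d :* k)) := (:- (t :* d)) :* k) refl τ (cellDensity x) N ⟩
      - (τ * cellDensity x) * N ∎)
      where
      open ≤-Reasoning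
      s s′ a : Ω n v → ℚ
      s = same (key P I) (key P I x)
      s′ = same (key (c ++ P) I) (key (c ++ P) I x)
      a y = ind (inCell c I (key c I x) y)
      N N′ : ℚ
      N = cls (key P I) (key P I x)
      N′ = cls (key (c ++ P) I) (key (c ++ P) I x)

  ∧-congʳ : ∀ {A : Set} (d : Dec A) {b b′} → (A → b ≡ b′) → ⌊ d ⌋ ∧ b ≡ ⌊ d ⌋ ∧ b′
  ∧-congʳ (yes p) h = h p
  ∧-congʳ (no _) h = refl

  ind-∧-≤ : ∀ a b → ind (a ∧ b) ≤ ind b
  ind-∧-≤ true b = ≤-refl
  ind-∧-≤ false b = 0≤ind b

  ind-≤? : ∀ {r s a} → 0ℚ ≤ r → 0ℚ ≤ a → r * s ≡ 1ℚ → ind ⌊ s ≤? a ⌋ ≤ r * a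
  ind-≤? {r} {s} {a} r≥0 a≥0 rs with s ≤? a
  ... | yes p = ≤-trans (≤-reflexive (sym rs)) (*-monoˡ r≥0 p)
  ... | no _ = 0≤* r≥0 a≥0

  map-++-elim : ∀ {A B : Set} {R : B → Set} {f g : A → B} as → (∀ {a} → a ∈ as → R (f a)) → (∀ {a} → a ∈ as → R (g a)) →
    ∀ {b} → b ∈ map f as ++ map g as → R b
  map-++-elim {f = f} {g} as hf hg m with ∈-++⁻ (map f as) m
  ... | inj₁ m′ with ∈-map⁻ f m′
  ... | a , a∈ , refl = hf a∈
  map-++-elim {f = f} {g} as hf hg m | inj₂ m′ with ∈-map⁻ g m′
  ... | a , a∈ , refl = hg a∈

  module CleaningStep (v l : ℕ) (ih : Cleaning v l) {ε : ℚ} (ε>0 : 0ℚ < ε) where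

    M : ℕ
    M = subsets# v

    opaque
      -- With `τ`, all bad sets together, each of density at most `τ + τ`, take at most half of the
      -- main term. The budget `ε` is shared by three kinds of exceptional sets: `β` is what
      -- Markov's inequality at threshold `τ` needs for the first, and `εᵢ` allows a union over all
      -- subsets in the third.
      τ ε₃ β εᵢ : ℚ
      τ = (½ * ½) * recip M
      ε₃ = ε * recip 2
      β = τ * ε₃
      εᵢ = ε₃ * recip M

      τ>0 : 0ℚ < τ
      τ>0 = 0<* (0<* 0<½ 0<½) (0<recip M)
      ε₃>0 : 0ℚ < ε₃
      ε₃>0 = 0<* ε>0 (0<recip 2)
      β>0 : 0ℚ < β
      β>0 = 0<* τ>0 ε₃>0
      εᵢ>0 : 0ℚ < εᵢ
      εᵢ>0 = 0<* ε₃>0 (0<recip M)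

      quarter≤ : ∀ {a} → 0ℚ ≤ a → a ≤ 1ℚ → (½ * ½) * a ≤ ½ * ½
      quarter≤ h u = ≤-trans (*-monoˡ (<⇒≤ (0<* 0<½ 0<½)) u) (≤-reflexive (*-identityʳ (½ * ½)))

      τ≤¼ : τ ≤ ½ * ½
      τ≤¼ = quarter≤ (<⇒≤ (0<recip M)) (recip≤1 M)

      2τ≤½ : τ + τ ≤ ½
      2τ≤½ = +-mono-≤ τ≤¼ τ≤¼

      ½≤1 : ½ ≤ 1ℚ
      ½≤1 = ≤-by ½ (<⇒≤ 0<½) refl

      2τ≤1 : τ + τ ≤ 1ℚ
      2τ≤1 = ≤-trans 2τ≤½ ½≤1

      M2τ≤½ : nat M * (τ + τ) ≤ ½
      M2τ≤½ = ≤-trans (≤-reflexive (solve 2 (λ m r → m :* (con (½ * ½) :* r :+ con (½ * ½) :* r) := con ½ :* (m :* r)) refl (nat M) (recip M)))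
        (≤-trans (*-monoˡ (<⇒≤ 0<½) (nat-recip≤1 M)) (≤-reflexive (*-identityʳ ½)))

      β≤ : β ≤ τ * ε₃
      β≤ = ≤-refl

      ε₃-sum : ε₃ + (ε₃ + ε₃) ≤ ε
      ε₃-sum = ≤-reflexive (thirds ε)

      M-εᵢ≤ε₃ : nat M * εᵢ ≤ ε₃
      M-εᵢ≤ε₃ = ≤-trans (≤-reflexive (solve 3 (λ m e r → m :* (e :* r) := e :* (m :* r)) refl (nat M) ε₃ (recip M)))
        (≤-trans (*-monoˡ (<⇒≤ ε₃>0) (nat-recip≤1 M)) (≤-reflexive (*-identityʳ ε₃)))

    open Σ (ih εᵢ>0) renaming (proj₁ to βᵢ; proj₂ to ihᵢ)
    βᵢ>0 = proj₁ ihᵢ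
    δᵢ = proj₁ (proj₂ ihᵢ)
    δᵢ>0 = proj₁ (proj₂ (proj₂ ihᵢ))
    cleanᵢ = proj₂ (proj₂ (proj₂ ihᵢ))

    -- L is the number of sets in the system.
    module Constants (L : ℕ) where

      bl : ℕ
      bl = length (boolLists L)

      -- `k` counts the errors `η`: `M` in the lower bound for the main term and `suc M` for each of
      -- `M` bad sets. `mF` bounds the number of functions, a density and an excess for every set
      -- and key.
      k mF : ℕ
      k = M ℕ.+ M ℕ.* suc M
      mF = M ℕ.* bl ℕ.+ M ℕ.* bl

      opaque
        unfolding τ

        minε₁ : Σ ℚ λ e → (0ℚ < e) × (e ≤ ε₃ * recip bl) × (e ≤ 1ℚ)
        minε₁ = min (0<* ε₃>0 (0<recip bl)) 0<1

        -- Cells of density below `ε₁` are exceptional, and jumps below `σ` are tolerated. The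
        -- surplus `τ * cellDensity` in `excess-small` is at least `τ * ε₁`, so exactly a jump of
        -- `σ = τ * ε₁` can be absorbed; densities then stay above `ε₁ - σ`, hence above `θ`.
        ε₁ σ θ : ℚ
        ε₁ = proj₁ minε₁
        σ = τ * ε₁
        θ = ½ * ε₁

        ε₁>0 : 0ℚ < ε₁
        ε₁>0 = proj₁ (proj₂ minε₁)

        σ>0 : 0ℚ < σ
        σ>0 = 0<* τ>0 ε₁>0

        θ>0 : 0ℚ < θ
        θ>0 = 0<* 0<½ ε₁>0

        θ≤1 : θ ≤ 1ℚ
        θ≤1 = ≤-trans (*-mono (<⇒≤ ε₁>0) 0≤1 ½≤1 (proj₂ (proj₂ (proj₂ minε₁)))) (≤-reflexive (*-identityˡ 1ℚ))

        θ≤ε₁-σ : θ ≤ ε₁ - σ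
        θ≤ε₁-σ = ≤-by ((½ - τ) * ε₁) (0≤* (0≤-diff τ≤½) (<⇒≤ ε₁>0))
          (solve 2 (λ e t → e :- t :* e := con ½ :* e :+ (con ½ :- t) :* e) refl ε₁ τ)
          where
          τ≤½ : τ ≤ ½
          τ≤½ = ≤-trans (≤-by τ (<⇒≤ τ>0) refl) 2τ≤½

        bl-ε₁≤ε₃ : nat bl * ε₁ ≤ ε₃
        bl-ε₁≤ε₃ = ≤-trans (*-monoˡ (0≤nat bl) (proj₁ (proj₂ (proj₂ minε₁))))
          (≤-trans (≤-reflexive (solve 3 (λ b e r → b :* (e :* r) := e :* (b :* r)) refl (nat bl) ε₃ (recip bl)))
            (≤-trans (*-monoˡ (<⇒≤ ε₃>0) (nat-recip≤1 bl)) (≤-reflexive (*-identityʳ ε₃))))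

        inv-σσ : Σ ℚ λ r → (0ℚ < r) × (r * (σ * σ) ≡ 1ℚ)
        inv-σσ = inv (0<* σ>0 σ>0)

        -- By Chebyshev a function jumps by at least `σ` on measure at most `rσ * κ`; the choice of
        -- `κ` makes the sum over all functions at most `βᵢ`.
        rσ κ : ℚ
        rσ = proj₁ inv-σσ
        κ = βᵢ * (σ * σ) * recip mF

        rσ>0 : 0ℚ < rσ
        rσ>0 = proj₁ (proj₂ inv-σσ)

        rσ-inv : rσ * (σ * σ) ≡ 1ℚ
        rσ-inv = proj₂ (proj₂ inv-σσ)

        σ≡ : σ ≡ τ * ε₁
        σ≡ = refl

        κ>0 : 0ℚ < κ
        κ>0 = 0<* (0<* βᵢ>0 (0<* σ>0 σ>0)) (0<recip mF)

        mF-bound : nat mF * (rσ * κ) ≤ βᵢ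
        mF-bound = begin
          nat mF * (rσ * (βᵢ * (σ * σ) * recip mF))
            ≡⟨ solve 5 (λ m r b s c → m :* (r :* (b :* s :* c)) := (r :* s) :* (b :* (m :* c))) refl (nat mF) rσ βᵢ (σ * σ) (recip mF) ⟩
          (rσ * (σ * σ)) * (βᵢ * (nat mF * recip mF)) ≡⟨ trans (cong (_* (βᵢ * (nat mF * recip mF))) (proj₂ (proj₂ inv-σσ))) (*-identityˡ _) ⟩
          βᵢ * (nat mF * recip mF) ≤⟨ *-monoˡ (<⇒≤ βᵢ>0) (nat-recip≤1 mF) ⟩
          βᵢ * 1ℚ ≡⟨ *-identityʳ βᵢ ⟩
          βᵢ ∎
          where open ≤-Reasoning

        -- The argument is the length of the coarse partition. `ρ` is a quarter of the main term,
        -- the mass `δᵢ` of the jump-free points times the lower bound for the product of densities;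
        -- `η` keeps `k` errors below `ρ`.
        ρ η : ℕ → ℚ
        ρ i = (½ * ½) * (δᵢ i * (θ ^ℚ M))
        η i = ρ i * recip k

        ρ>0 : ∀ i → 0ℚ < ρ i
        ρ>0 i = 0<* (0<* 0<½ 0<½) (0<* (δᵢ>0 i) (0<^ θ>0 M))

        η>0 : ∀ i → 0ℚ < η i
        η>0 i = 0<* (ρ>0 i) (0<recip k)

        k-η≤ρ : ∀ i → nat k * η i ≤ ρ i
        k-η≤ρ i = ≤-trans (≤-reflexive (solve 3 (λ k r c → k :* (r :* c) := r :* (k :* c)) refl (nat k) (ρ i) (recip k)))
          (≤-trans (*-monoˡ (<⇒≤ (ρ>0 i)) (nat-recip≤1 k)) (≤-reflexive (*-identityʳ (ρ i))))

        ρ-def : ∀ i → ρ i ≡ (½ * ½) * (δᵢ i * (θ ^ℚ M))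
        ρ-def i = refl

      opaque
        steps : Σ ℕ λ s → nat mF < nat s * κ
        steps = archimedean κ>0 (nat mF)

      regularity = strong-regularity {v} l (2 ℕ.+ M) mF κ>0 η η>0 (proj₁ steps) 0

      opaque
        minρ : Σ ℚ λ c → (0ℚ < c) × (∀ i → i ℕ.≤ proj₁ regularity → c ≤ ρ i)
        minρ = minUpTo ρ ρ>0 (proj₁ regularity)

      -- Half of `X` survives the bad sets, and `X` is at least `Θ` up to `nat M * η i`. So at least
      -- half of `Θ` minus the `k` errors remains, which is a quarter of `Θ`.
      numeric : ∀ i {X e g j} → 0ℚ ≤ X → j ℕ.≤ M → δᵢ i ≤ e →
        e * (θ ^ℚ j) ≤ X + nat j * η i →
        X - nat M * ((τ + τ) * X + nat (suc M) * η i) ≤ g → ρ i ≤ g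
      numeric i {X} {e} {g} {j} X≥0 j≤M δ≤e low main = ≤-trans (diff-≤ diff) main
        where
        Θ = δᵢ i * (θ ^ℚ M)
        low′ : Θ ≤ X + nat M * η i
        low′ = ≤-trans (*-mono (<⇒≤ (0<^ θ>0 M)) (≤-trans (<⇒≤ (δᵢ>0 i)) δ≤e) δ≤e (^-anti θ>0 θ≤1 j≤M))
          (≤-trans low (+-monoʳ-≤ X (*-monoʳ (<⇒≤ (η>0 i)) (nat-mono j≤M))))
        kη : (nat M + nat M * nat (suc M)) * η i ≤ ρ i
        kη = ≤-trans (≤-reflexive (cong (_* η i) (sym (trans (nat-+ M (M ℕ.* suc M)) (cong (nat M +_) (nat-* M (suc M))))))) (k-η≤ρ i)
        0≤Mη : 0ℚ ≤ nat M * η i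
        0≤Mη = 0≤* (0≤nat M) (<⇒≤ (η>0 i))
        diff : 0ℚ ≤ (X - nat M * ((τ + τ) * X + nat (suc M) * η i)) - ρ i
        diff = ≤-trans (0≤+ (0≤+ (0≤* (<⇒≤ 0<½) (0≤-diff low′)) (0≤* (0≤-diff M2τ≤½) X≥0)) (0≤+ (0≤-diff kη) (0≤* (<⇒≤ 0<½) 0≤Mη)))
          (≤-reflexive (trans (cong (λ r → (½ * ((X + nat M * η i) - Θ) + (½ - nat M * (τ + τ)) * X) + ((r - (nat M + nat M * nat (suc M)) * η i) + ½ * (nat M * η i))) (ρ-def i))
            (trans (solve 6 (λ Θ X m η t s →
              (con ½ :* ((X :+ m :* η) :- Θ) :+ (con ½ :- m :* (t :+ t)) :* X) :+ ((con (½ * ½) :* Θ :- (m :+ m :* s) :* η) :+ con ½ :* (m :* η))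
              := (X :- m :* ((t :+ t) :* X :+ s :* η)) :- con (½ * ½) :* Θ) refl Θ X (nat M) (η i) τ (nat (suc M)))
            (cong (λ r → (X - nat M * ((τ + τ) * X + nat (suc M) * η i)) - r) (sym (ρ-def i))))))

    -- The coarse partition has a length known only up to the bound from regularity, so the least of
    -- the possible values of `ρ` is taken.
    δ : ℕ → ℚ
    δ L = proj₁ (Constants.minρ L)

    module Main {n : ℕ} (K : Complex v) (l<rank : suc l ℕ.≤ rank K) (c : System n v) (lev : Level (suc l) K c)
      (Bad : Family n v) (Bad-meas : MeasurableFamily Bad) (Bad-small : ∀ I → 𝔼 (ind ∘ Bad I) ≤ β) where

      open Constants (length c)

      ts : List (List Bool)
      ts = boolLists (length c)

      U : List (Subset v)
      U = above K (suc l)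

      pairs : List (Subset v × List Bool)
      pairs = cartesianProduct U ts

      densityFun excessFun : Subset v × List Bool → Fun n v
      densityFun (I , t) = cellFun c I t
      excessFun (I , t) = excess c Bad Bad-meas τ (<⇒≤ τ>0) 2τ≤1 I t

      fs : List (Fun n v)
      fs = map densityFun pairs ++ map excessFun pairs

      fs-length : length fs ℕ.≤ mF
      fs-length = ℕₚ.≤-trans (ℕₚ.≤-reflexive (trans (length-++ (map densityFun pairs)) (cong₂ ℕ._+_ (length-map densityFun pairs) (length-map excessFun pairs))))
        (ℕₚ.+-mono-≤ pairs-length pairs-length)
        where
        pairs-length : length pairs ℕ.≤ M ℕ.* bl
        pairs-length = ℕₚ.≤-trans (ℕₚ.≤-reflexive (length-cartesianProduct U ts)) (ℕₚ.*-monoˡ-≤ bl (above-length K (suc l)))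

      fs-act : ∀ {F} → F ∈ fs → act K (dom F)
      fs-act = map-++-elim {R = λ F → act K (dom F)} pairs pair-act pair-act
        where
        pair-act : ∀ {p} → p ∈ pairs → act K (proj₁ p)
        pair-act p∈ = proj₁ (above-∈ K (proj₁ (∈-cartesianProduct⁻ U ts p∈)))

      pair-∈ : ∀ {I} x → I ∈ U → (I , key c I x) ∈ pairs
      pair-∈ {I} x I∈ = ∈-cartesianProduct⁺ I∈ (subst (λ k → key c I x ∈ boolLists k) (key-length c I x) (∈-boolLists (key c I x)))

      density-∈ : ∀ {I} x → I ∈ U → cellFun c I (key c I x) ∈ fs
      density-∈ x I∈ = ∈-++⁺ˡ (∈-map⁺ densityFun (pair-∈ x I∈))

      excess-∈ : ∀ {I} x → I ∈ U → excessFun (I , key c I x) ∈ fs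
      excess-∈ x I∈ = ∈-++⁺ʳ (map densityFun pairs) (∈-map⁺ excessFun (pair-∈ x I∈))

      module Regular (P P' : System n v) (P⊑P' : P ⊑ P') (levP : Level l K P) (levP' : Level l K P')
        (len : length P ℕ.≤ proj₁ regularity)
        (close : ∀ {F} → F ∈ fs → sqnorm (λ x → hat P' F x - hat P F x) ≤ κ)
        (uniform : ∀ {F} → F ∈ fs → Pseudorandom l (2 ℕ.+ M) P' F (η (length P))) where

        gap : Fun n v → Ω n v → ℚ
        gap F y = hat P' F y - hat P F y

        -- These are the bad sets handed to level `l`. Only functions with domain inside `I` are
        -- collected, so that `Jump I` depends on the coordinates in `I`; comparing squares avoids
        -- absolute values.
        Jump : Family n v
        Jump I y = anyB (λ F → ⌊ dom F ⊆? I ⌋ ∧ ⌊ σ * σ ≤? gap F y * gap F y ⌋) fs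

        Jump-cong : ∀ I {x y} → (∀ F → dom F ⊆ I → gap F x ≡ gap F y) → Jump I x ≡ Jump I y
        Jump-cong I {x} {y} h = anyB-cong fs step
          where
          step : ∀ F → ⌊ dom F ⊆? I ⌋ ∧ ⌊ σ * σ ≤? gap F x * gap F x ⌋ ≡ ⌊ dom F ⊆? I ⌋ ∧ ⌊ σ * σ ≤? gap F y * gap F y ⌋
          step F = ∧-congʳ (dom F ⊆? I) (λ s → cong (λ q → ⌊ σ * σ ≤? q * q ⌋) (h F s))

        Jump-meas : MeasurableFamily Jump
        Jump-meas I e = Jump-cong I λ F s → cong₂ _-_ (hat-≈ P' F (λ i m → e i (s m))) (hat-≈ P F (λ i m → e i (s m)))

        Jump-small : ∀ I → 𝔼 (ind ∘ Jump I) ≤ βᵢ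
        Jump-small I = ≤-trans (𝔼-union fs {F = λ F y → rσ * (gap F y * gap F y)} (rσ * κ) pointwise
            (λ F m → ≤-trans (≤-reflexive (𝔼-* rσ _)) (*-monoˡ (<⇒≤ rσ>0) (close m))))
          (≤-trans (*-monoʳ (<⇒≤ (0<* rσ>0 κ>0)) (nat-mono fs-length)) mF-bound)
          where
          each : ∀ F y → ind (⌊ dom F ⊆? I ⌋ ∧ ⌊ σ * σ ≤? gap F y * gap F y ⌋) ≤ rσ * (gap F y * gap F y)
          each F y = ≤-trans (ind-∧-≤ ⌊ dom F ⊆? I ⌋ _) (ind-≤? (<⇒≤ rσ>0) (0≤sq (gap F y)) rσ-inv)
          pointwise : ∀ y → ind (Jump I y) ≤ sumL fs (λ F → rσ * (gap F y * gap F y))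
          pointwise y = ≤-trans (ind-anyB fs) (sumL-≤ fs (λ F _ → each F y))

        module Exceptional (Dᵢ : Family n v) (Dᵢ-meas : MeasurableFamily Dᵢ) (Dᵢ-small : ∀ I → 𝔼 (ind ∘ Dᵢ I) ≤ εᵢ)
          (richᵢ : ∀ x → Avoids K l Dᵢ x → Rich K l P Jump (δᵢ (length P)) x) where

          dense : Subset v → Ω n v → ℚ
          dense I = cond (key (c ++ P) I) (ind ∘ Bad I)

          -- The three reasons to give up a point: `Bad I` is too dense in its cell, its cell is too
          -- rare, or it is exceptional on the previous level for some subset of `I`.
          D₁ D₂ D₃ D : Family n v
          D₁ I x = ⌊ τ <? dense I x ⌋
          D₂ I x = ⌊ cellDensity c P I x <? ε₁ ⌋
          D₃ I x = anyB (λ J → ⌊ J ⊆? I ⌋ ∧ Dᵢ J x) (allSubsets v)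
          D I x = D₁ I x ∨ (D₂ I x ∨ D₃ I x)

          D-meas : MeasurableFamily D
          D-meas I {x} {y} e = cong₂ _∨_ (cong (λ q → ⌊ τ <? q ⌋) (cond-measurable (key (c ++ P) I) (ind ∘ Bad I) (key-≈ (c ++ P) e)))
            (cong₂ _∨_ (cong (λ q → ⌊ q <? ε₁ ⌋) (cellDensity-≈ c P I e)) (anyB-cong (allSubsets v) step))
            where
            step : ∀ J → ⌊ J ⊆? I ⌋ ∧ Dᵢ J x ≡ ⌊ J ⊆? I ⌋ ∧ Dᵢ J y
            step J = ∧-congʳ (J ⊆? I) (λ s → Dᵢ-meas J (λ i m → e i (s m)))

          D-small : ∀ I → 𝔼 (ind ∘ D I) ≤ ε
          D-small I = ≤-trans (𝔼-mono (λ x → ≤-trans (ind-∨ (D₁ I x) _) (+-monoʳ-≤ (ind (D₁ I x)) (ind-∨ (D₂ I x) (D₃ I x)))))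
            (≤-trans (≤-reflexive (trans (𝔼-+ _ _) (cong (_+_ (𝔼 (ind ∘ D₁ I))) (𝔼-+ _ _))))
              (≤-trans (+-mono-≤ small₁ (+-mono-≤ small₂ small₃)) ε₃-sum))
            where
            small₁ : 𝔼 (ind ∘ D₁ I) ≤ ε₃
            small₁ = markov τ>0 (cond-lower (key (c ++ P) I) (λ y → 0≤ind (Bad I y)))
              (≤-trans (≤-reflexive (𝔼-cond (key (c ++ P) I) (ind ∘ Bad I))) (≤-trans (Bad-small I) β≤))
            small₂ : 𝔼 (ind ∘ D₂ I) ≤ ε₃
            small₂ = ≤-trans (rare-cells c P I (<⇒≤ ε₁>0)) bl-ε₁≤ε₃
            small₃ : 𝔼 (ind ∘ D₃ I) ≤ ε₃
            small₃ = ≤-trans (𝔼-union (allSubsets v) {F = λ J x → ind (Dᵢ J x)} εᵢ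
                (λ x → ≤-trans (ind-anyB (allSubsets v)) (sumL-≤ (allSubsets v) (λ J _ → ind-∧-≤ ⌊ J ⊆? I ⌋ (Dᵢ J x)))) (λ J _ → Dᵢ-small J))
              M-εᵢ≤ε₃

          module Point (x : Ω n v) (avoids : Avoids K (suc l) D x) where

            not-dense : ∀ {I} → I ∈ U → dense I x ≤ τ
            not-dense {I} I∈ = ≮⇒≥ (⌊⌋-false {d = τ <? dense I x} (proj₁ (∨-false (avoids I (proj₁ (above-∈ K I∈)) (proj₂ (above-∈ K I∈))))))

            not-rare : ∀ {I} → I ∈ U → ε₁ ≤ cellDensity c P I x
            not-rare {I} I∈ = ≮⇒≥ (⌊⌋-false {d = cellDensity c P I x <? ε₁}
              (proj₁ (∨-false {D₂ I x} (proj₂ (∨-false {D₁ I x} (avoids I (proj₁ (above-∈ K I∈)) (proj₂ (above-∈ K I∈))))))))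

            avoidsᵢ : Avoids K l Dᵢ x
            avoidsᵢ J aJ l≤ with l ℕₚ.<? ∣ J ∣
            ... | yes l< = inside J J aJ l< (λ m → m)
              where
              inside : ∀ I J → act K I → suc l ℕ.≤ ∣ I ∣ → J ⊆ I → Dᵢ J x ≡ false
              inside I J aI h s = trans (sym (cong (_∧ Dᵢ J x) (true-⌊⌋ (J ⊆? I) s)))
                (anyB-∉ {as = allSubsets v} (proj₂ (∨-false {D₂ I x} (proj₂ (∨-false {D₁ I x} (avoids I aI h))))) (∈-allSubsets J))
            -- Level `l` also asks about sets of exactly `l` points, which `D` is not known to avoid
            -- directly. Such a set lies in a member of size `suc l`, whose `D₃` includes it.
            ... | no l≮ with extend K {J} {suc l} aJ (ℕₚ.≤-trans (ℕₚ.≮⇒≥ l≮) (ℕₚ.n≤1+n l)) l<rank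
            ... | I , s , aI , eI = trans (sym (cong (_∧ Dᵢ J x) (true-⌊⌋ (J ⊆? I) s)))
                (anyB-∉ {as = allSubsets v} (proj₂ (∨-false {D₂ I x} (proj₂ (∨-false {D₁ I x} (avoids I aI (ℕₚ.≤-reflexive (sym eI))))))) (∈-allSubsets J))

            -- The points in the coarse cell of `x` at which nothing jumps. Coarse projections agree
            -- there with those at `x`, and fine ones differ by less than `σ`. The richness of `x`
            -- on level `l`, with `Jump` as the bad sets, is precisely a lower bound for the measure
            -- of `Y`.
            Y : Ω n v → Bool
            Y y = ⌊ key P ⊤ x ≟L key P ⊤ y ⌋ ∧ allB (λ I → not (Jump I y)) U

            Y-dep : ∀ y z → (∀ {it} → it ∈ P' → fn it y ≡ fn it z) → Y y ≡ Y z
            Y-dep y z h = cong₂ _∧_ (cong (λ k → ⌊ key P ⊤ x ≟L k ⌋) (key-ext P {⊤} (λ m _ → h (P⊑P' m))))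
              (allB-cong U (λ I → cong not (Jump-cong I (λ F _ → cong₂ _-_
                (cond-measurable (key P' (dom F)) (val F) (key-ext P' (λ m _ → h m)))
                (cond-measurable (key P (dom F)) (val F) (key-ext P (λ m _ → h (P⊑P' m))))))))

            δ≤Y : δᵢ (length P) ≤ 𝔼 (ind ∘ Y)
            δ≤Y = richᵢ x avoidsᵢ Y λ y e none → ∧-intro (true-⌊⌋ (key P ⊤ x ≟L key P ⊤ y) e)
              (∈-allB U (λ {I} m → cong not (none I (proj₁ (above-∈ K m)) (proj₂ (above-∈ K m)))))

            module _ {y : Ω n v} (Yy : Y y ≡ true) where

              same-hat : ∀ F → hat P F x ≡ hat P F y
              same-hat F = cond-measurable (key P (dom F)) (val F)
                (key-mono {P = P} {dom F} {⊤} ⊆⊤ (⌊⌋-true {d = key P ⊤ x ≟L key P ⊤ y} (proj₁ (∧-true Yy))))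

              gap-small : ∀ {F} → F ∈ fs → dom F ∈ U → gap F y * gap F y < σ * σ
              gap-small {F} m I∈ = ≰⇒> (⌊⌋-false {d = σ * σ ≤? gap F y * gap F y} (trans (sym (cong (_∧ ⌊ σ * σ ≤? gap F y * gap F y ⌋) (true-⌊⌋ (dom F ⊆? dom F) (λ i → i))))
                (anyB-∉ {as = fs} (not-true (allB-∈ (proj₂ (∧-true {⌊ key P ⊤ x ≟L key P ⊤ y ⌋} Yy)) I∈)) m)))
                where
                not-true : ∀ {b} → not b ≡ true → b ≡ false
                not-true {false} _ = refl

              density≥θ : ∀ {I} → I ∈ U → θ ≤ hat P' (cellFun c I (key c I x)) y
              density≥θ {I} I∈ = ≤-trans θ≤ε₁-σ (≤-trans (+-monoˡ-≤ (- σ) (≤-trans (not-rare I∈) (≤-reflexive (same-hat F)))) (diff-≤ (≤-trans (<⇒≤ (0<diff lt))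
                (≤-reflexive (solve 3 (λ s a b → s :- (:- (a :- b)) := a :- (b :- s)) refl σ (hat P' F y) (hat P F y))))))
                where
                F = cellFun c I (key c I x)
                lt : - gap F y < σ
                lt = sq-cancel-< σ>0 (subst (_< σ * σ) (solve 1 (λ a → a :* a := (:- a) :* (:- a)) refl (gap F y)) (gap-small (density-∈ x I∈) I∈))
                0<diff : ∀ {a b} → a < b → 0ℚ < b - a
                0<diff {a} {b} h = subst (_< b - a) (+-inverseʳ a) (+-monoˡ-< (- a) h)

              excess≤0 : ∀ {I} → I ∈ U → hat P' (excessFun (I , key c I x)) y ≤ 0ℚ
              excess≤0 {I} I∈ = begin
                hat P' F y ≡⟨ solve 2 (λ a b → a := b :+ (a :- b)) refl (hat P' F y) (hat P F y) ⟩
                hat P F y + gap F y ≤⟨ +-mono-≤ (≤-trans (≤-reflexive (sym (same-hat F))) (excess-small c P I Bad Bad-meas (<⇒≤ τ>0) 2τ≤1 x (not-dense I∈)))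
                    (<⇒≤ (sq-cancel-< σ>0 (gap-small (excess-∈ x I∈) I∈))) ⟩
                - (τ * cellDensity c P I x) + σ ≤⟨ +-monoˡ-≤ σ (neg-antimono-≤ (*-monoˡ (<⇒≤ τ>0) (not-rare I∈))) ⟩
                - (τ * ε₁) + σ ≡⟨ trans (cong (_+_ (- (τ * ε₁))) σ≡) (+-inverseˡ (τ * ε₁)) ⟩
                0ℚ ∎
                where
                open ≤-Reasoning
                F = excessFun (I , key c I x)

            layer⊆U : ∀ {J} → J ∈ layer K (suc l) → J ∈ U
            layer⊆U m = ∈-above K (proj₁ (layer-∈ K m)) (ℕₚ.≤-reflexive (sym (proj₂ (layer-∈ K m))))

            above⊆U : ∀ {I} → I ∈ above K (suc (suc l)) → I ∈ U
            above⊆U m = ∈-above K (proj₁ (above-∈ K m)) (ℕₚ.≤-trans (ℕₚ.n≤1+n (suc l)) (proj₂ (above-∈ K m)))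

            open Counting l K l<rank c lev Bad Bad-meas (<⇒≤ τ>0) 2τ≤1 x P' levP' (η (length P)) (<⇒≤ (η>0 (length P))) Y Y-dep θ>0

            cells-pseudorandom : ∀ {J} → J ∈ layer K (suc l) → Pseudorandom l (2 ℕ.+ M) P' (F J) (η (length P))
            cells-pseudorandom m = uniform (density-∈ x (layer⊆U m))
            excess-pseudorandom : ∀ {I} → I ∈ above K (suc (suc l)) → Pseudorandom l (2 ℕ.+ M) P' (u I) (η (length P))
            excess-pseudorandom m = uniform (excess-∈ x (above⊆U m))
            cells-dense : ∀ {J} → J ∈ layer K (suc l) → ∀ y → Y y ≡ true → θ ≤ g J y
            cells-dense m y Yy = density≥θ Yy (layer⊆U m)
            excess-nonpositive : ∀ {I} → I ∈ above K (suc (suc l)) → ∀ y → Y y ≡ true → hat P' (u I) y ≤ 0ℚ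
            excess-nonpositive m y Yy = excess≤0 Yy (above⊆U m)

            rich : Rich K (suc l) c Bad (δ (length c)) x
            rich G hG = ≤-trans (proj₂ (proj₂ minρ) (length P) len)
              (numeric (length P) {X cells-pseudorandom excess-pseudorandom cells-dense excess-nonpositive} {j = LJ#} (𝔼-nonneg (λ y → 0≤* (0≤ind (Y y)) (prodL-nonneg LJ (λ J → 0≤ind (cell J y))))) (layer-length K (suc l)) δ≤Y
                (X-lower cells-pseudorandom excess-pseudorandom cells-dense excess-nonpositive)
                (main-count cells-pseudorandom excess-pseudorandom cells-dense excess-nonpositive {G} hG))

    clean : Cleanable v (suc l) ε β δ
    clean {n} K l<rank c lev Bad Bad-meas Bad-small conclude =
      proj₂ regularity K fs fs-length fs-act [] (λ ()) ℕ.z≤n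
        (<-≤-trans (proj₂ steps) (≤-by (energy [] fs) (0≤energy [] fs) (+-comm (energy [] fs) _)))
        λ P P' sub levP levP' len close uniform →
          let open Regular P P' sub levP levP' len close uniform in
          cleanᵢ K (ℕₚ.≤-trans (ℕₚ.n≤1+n l) l<rank) P levP Jump Jump-meas Jump-small λ Dᵢ measᵢ smallᵢ richᵢ →
            let open Exceptional Dᵢ measᵢ smallᵢ richᵢ in
            conclude D D-meas D-small λ x avoids → Point.rich x avoids
      where
      open Main K l<rank c lev Bad Bad-meas Bad-small
      open Constants (length c)

  cleaning-suc : ∀ v l → Cleaning v l → Cleaning v (suc l)
  cleaning-suc v l ih {ε} ε>0 = S.β , S.β>0 , S.δ , (λ L → proj₁ (proj₂ (S.Constants.minρ L))) , S.clean
    where module S = CleaningStep v l ih {ε} ε>0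

  cleaning : ∀ v j → Cleaning v j
  cleaning v zero = cleaning-zero v
  cleaning v (suc j) = cleaning-suc v j (cleaning v j)

  -- The removal lemma

  true⇒∈ : ∀ {n} {S : Subset n} {i} → lookup S i ≡ true → i ∈ₛ S
  true⇒∈ {S = S} {i} = lookup⇒[]= i S

  module _ {m n : ℕ} {φ : Fin m → Fin n} {S : Subset m} where

    private
      in? : ∀ y → Dec (∃ λ x → x ∈ₛ S × φ x ≡ y)
      in? y = any? (λ x → (x ∈? S) ×-dec (φ x ≟ y))

    ∈-image : ∀ {x} → x ∈ₛ S → φ x ∈ₛ image φ S
    ∈-image {x} m = true⇒∈ (trans (lookup∘tabulate (λ y → ⌊ in? y ⌋) (φ x)) (true-⌊⌋ (in? (φ x)) (x , m , refl)))

    image-∈ : ∀ {y} → y ∈ₛ image φ S → Σ (Fin m) λ x → x ∈ₛ S × φ x ≡ y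
    image-∈ {y} m = ⌊⌋-true {d = in? y} (trans (sym (lookup∘tabulate (λ y → ⌊ in? y ⌋) y)) ([]=⇒lookup m))

  image-⊆ : ∀ {m n} {φ : Fin m → Fin n} {S T} → (∀ {x} → x ∈ₛ S → φ x ∈ₛ T) → image φ S ⊆ T
  image-⊆ h m with image-∈ m
  ... | x , x∈ , refl = h x∈

  image-cong : ∀ {m n} {φ ψ : Fin m → Fin n} {S} → (∀ x → x ∈ₛ S → φ x ≡ ψ x) → image φ S ≡ image ψ S
  image-cong {φ = φ} {ψ} {S} h = ⊆-antisym
    (image-⊆ {φ = φ} (λ {x} m → subst (_∈ₛ image ψ S) (sym (h x m)) (∈-image m)))
    (image-⊆ {φ = ψ} (λ {x} m → subst (_∈ₛ image φ S) (h x m) (∈-image m)))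

  image-∘ : ∀ {l m n} {φ : Fin m → Fin n} {χ : Fin l → Fin m} {S} → image φ (image χ S) ≡ image (φ ∘ χ) S
  image-∘ {φ = φ} {χ} {S} = ⊆-antisym
    (image-⊆ {φ = φ} λ m → inner (image-∈ m))
    (image-⊆ {φ = φ ∘ χ} (λ m → ∈-image (∈-image m)))
    where
    inner : ∀ {y} → (Σ _ λ x → x ∈ₛ S × χ x ≡ y) → φ y ∈ₛ image (φ ∘ χ) S
    inner (x , m , refl) = ∈-image m

  image-injective : ∀ {m n} {φ : Fin m → Fin n} → Injective _≡_ _≡_ φ → ∀ {S T} → image φ S ≡ image φ T → S ≡ T
  image-injective {φ = φ} inj {S} {T} e = ⊆-antisym (half e) (half (sym e))
    where
    half : ∀ {S T} → image φ S ≡ image φ T → S ⊆ T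
    half {S} {T} e {x} m with image-∈ (subst (φ x ∈ₛ_) e (∈-image m))
    ... | y , y∈ , eq = subst (_∈ₛ T) (inj eq) y∈

  card-≤ : ∀ {m n} (φ : Fin m → Fin n) {S T} → (∀ {x y} → x ∈ₛ S → y ∈ₛ S → φ x ≡ φ y → x ≡ y) → (∀ {x} → x ∈ₛ S → φ x ∈ₛ T) → ∣ S ∣ ℕ.≤ ∣ T ∣
  card-≤ φ {[]} inj h = ℕ.z≤n
  card-≤ φ {false ∷ S} inj h = card-≤ (φ ∘ suc) (λ a b e → suc-injective (inj (there a) (there b) e)) (h ∘ there)
  card-≤ φ {true ∷ S} {T} inj h = ℕₚ.≤-trans (ℕ.s≤s (card-≤ (φ ∘ suc) (λ a b e → suc-injective (inj (there a) (there b) e))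
      (λ {x} m → x∈p∧x≢y⇒x∈p-y (h (there m)) (λ e → 0≢1+n (inj here (there m) (sym e))))))
    (x∈p⇒∣p-x∣<∣p∣ (h here))

  between : ∀ {v} {I e : Subset v} {i} → I ⊆ e → ∣ I ∣ ℕ.≤ i → i ℕ.≤ ∣ e ∣ → Σ (Subset v) λ J → I ⊆ J × J ⊆ e × ∣ J ∣ ≡ i
  between {I = []} {[]} s h ℕ.z≤n = [] , (λ m → m) , (λ m → m) , refl
  between {I = true ∷ I} {false ∷ e} s h u with s here
  ... | ()
  between {I = true ∷ I} {true ∷ e} {suc i} s (ℕ.s≤s h) (ℕ.s≤s u) with between (drop-∷-⊆ s) h u
  ... | J , a , b , c = true ∷ J , s⊆s a , s⊆s b , cong suc c
  between {I = false ∷ I} {false ∷ e} s h u with between (drop-∷-⊆ s) h u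
  ... | J , a , b , c = false ∷ J , s⊆s a , s⊆s b , c
  between {I = false ∷ I} {true ∷ e} {i} s h u with i ℕₚ.≤? ∣ e ∣
  ... | no i≰ = true ∷ e , (λ m → s m) , (λ m → m) , ℕₚ.≤-antisym (ℕₚ.≰⇒> i≰) u
  ... | yes i≤ with between (drop-∷-⊆ s) h i≤
  ... | J , a , b , c = false ∷ J , s⊆s a , (λ { (there m) → there (b m) }) , c

  -- Degenerate maps are included; on the side of packings they are counted among the collisions.
  Hom : ∀ {n v} → (Subset v → Set) → (Subset (suc n) → Set) → Ω n v → Set
  Hom Edge R x = ∀ e → Edge e → R (image (lookup x) e)

  module _ {v : ℕ} (k : ℕ) (Edge : Subset v → Set) (Edge? : ∀ e → Dec (Edge e)) (uniform : ∀ e → Edge e → ∣ e ∣ ≡ k) where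

    closure : Complex v
    closure = record
      { act = λ I → Σ (Subset v) λ e → Edge e × I ⊆ e
      ; act? = λ I → anySubset? (λ e → Edge? e ×-dec (I ⊆? e))
      ; down = λ s (e , Ee , t) → e , Ee , ⊆-trans s t
      ; rank = k
      ; extend = λ (e , Ee , t) h u → ext e Ee t (between {e = e} t h (subst (_ ℕ.≤_) (sym (uniform e Ee)) u))
      }
      where
      ext : ∀ e {I i} → Edge e → I ⊆ e → (Σ (Subset v) λ J → I ⊆ J × J ⊆ e × ∣ J ∣ ≡ i) →
        Σ (Subset v) λ J → I ⊆ J × (Σ (Subset v) λ e → Edge e × J ⊆ e) × ∣ J ∣ ≡ i
      ext e Ee t (J , a , b , c) = J , a , (e , Ee , b) , c

    module _ {n : ℕ} (R : Subset (suc n) → Set) (R? : ∀ T → Dec (R T)) where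

      edgeItem : Subset v → Item n v
      edgeItem e = record
        { set = e
        ; fn = λ y → ⌊ R? (image (lookup y) e) ⌋
        ; meas = λ h → cong (λ T → ⌊ R? T ⌋) (image-cong h)
        }

      edges : List (Subset v)
      edges = filter Edge? (allSubsets v)

      edgeSystem : System n v
      edgeSystem = map edgeItem edges

      edge-∈ : ∀ {e} → Edge e → e ∈ edges
      edge-∈ Ee = ∈-filter⁺ Edge? (∈-allSubsets _) Ee

      edgeSystem-level : Level k closure edgeSystem
      edgeSystem-level m with ∈-map⁻ edgeItem m
      ... | e , e∈ , refl = (e , Ee , λ i → i) , ℕₚ.≤-reflexive (uniform e Ee)
        where Ee = proj₂ (∈-filter⁻ Edge? {xs = allSubsets v} e∈)

      edgeSystem-length : length edgeSystem ℕ.≤ subsets# v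
      edgeSystem-length = ℕₚ.≤-trans (ℕₚ.≤-reflexive (length-map edgeItem edges)) (length-filter Edge? (allSubsets v))

      same-cell⇒Hom : ∀ {x y} → Hom Edge R x → key edgeSystem ⊤ x ≡ key edgeSystem ⊤ y → Hom Edge R y
      same-cell⇒Hom {x} {y} hx eq e Ee = ⌊⌋-true {d = R? (image (lookup y) e)}
        (trans (sym (key-∈ {P = edgeSystem} eq (∈-map⁺ edgeItem (edge-∈ Ee)) ⊆⊤)) (true-⌊⌋ (R? (image (lookup x) e)) (hx e Ee)))

      -- A member of the closure with at least `k` points fills the edge that contains it, so on the
      -- top level only edges are tested.
      avoid-edges : ∀ {D : Family n v} {x} → (∀ e → Edge e → D e x ≡ false) → Avoids closure k D x
      avoid-edges {D} {x} h I (e , Ee , s) k≤ = subst (λ J → D J x ≡ false)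
        (⊆-antisym (⊆-card≡ {I = I} {J = e} s (subst (ℕ._≤ ∣ I ∣) (sym (uniform e Ee)) k≤)) s) (h e Ee)

  -- The cell of a homomorphism in the system of edge indicators consists of homomorphisms, so
  -- cleaning on level `k`, with empty bad sets, shows that one surviving homomorphism entails many.
  -- The minimum over all lengths makes `δ` independent of the hypergraph.
  removal : ∀ v k {ε} → 0ℚ < ε → Σ ℚ λ δ → (0ℚ < δ) × (∀ {Edge} (Edge? : ∀ e → Dec (Edge e)) (uniform : ∀ e → Edge e → ∣ e ∣ ≡ k)
    {n} {R : Subset (suc n) → Set} (R? : ∀ T → Dec (R T)) →
    ¬ ((D : Family n v) → MeasurableFamily D → (∀ I → 𝔼 (ind ∘ D I) ≤ ε) →
       ¬ (∀ x → Hom Edge R x → (∀ e → Edge e → D e x ≡ false) →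
          ∀ (G : Ω n v → Bool) → (∀ y → Hom Edge R y → G y ≡ true) → δ ≤ 𝔼 (ind ∘ G))))
  removal v k {ε} ε>0 with cleaning v k ε>0
  ... | β , β>0 , δ , δ>0 , clean with minUpTo δ δ>0 (subsets# v)
  ... | δ₀ , δ₀>0 , δ₀≤ = δ₀ , δ₀>0 , λ {Edge} Edge? uniform {n} {R} R? conclude →
    clean (closure k Edge Edge? uniform) ℕₚ.≤-refl (edgeSystem k Edge Edge? uniform R R?) (edgeSystem-level k Edge Edge? uniform R R?)
      (λ _ _ → false) (λ _ _ → refl) (λ _ → ≤-trans (≤-reflexive (𝔼-const {n} {v} 0ℚ)) (<⇒≤ β>0))
      λ D D-meas D-small rich → conclude D D-meas D-small λ x hx avoid G hG →
        ≤-trans (δ₀≤ _ (edgeSystem-length k Edge Edge? uniform R R?))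
          (rich x (avoid-edges k Edge Edge? uniform R R? {D} {x} avoid) G λ y e _ → hG y (same-cell⇒Hom k Edge Edge? uniform R R? hx e))

  -- Packings

  sumF-point : ∀ {n} (b : Fin n) → sumF (λ a → ind ⌊ a ≟ b ⌋) ≡ 1ℚ
  sumF-point {suc n} zero = trans (cong (1ℚ +_) (trans (sumF-const {n} 0ℚ) (*-zeroʳ (nat n)))) (+-identityʳ 1ℚ)
  sumF-point {suc n} (suc b) = trans (+-identityˡ _) (trans (sumF-cong (λ a → cong ind (bool-ext (to a) (from a)))) (sumF-point b))
    where
    to : ∀ a → ⌊ Fin.suc a ≟ suc b ⌋ ≡ true → ⌊ a ≟ b ⌋ ≡ true
    to a h with ⌊⌋-true {d = Fin.suc a ≟ suc b} h
    ... | refl = true-⌊⌋ (b ≟ b) refl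
    from : ∀ a → ⌊ a ≟ b ⌋ ≡ true → ⌊ Fin.suc a ≟ suc b ⌋ ≡ true
    from a h = true-⌊⌋ (Fin.suc a ≟ suc b) (cong suc (⌊⌋-true {d = a ≟ b} h))

  opaque
    unfolding 𝔼 avg

    -- Once the other coordinates are fixed, `g` is constant and equals just one of the `suc n`
    -- values of coordinate `u`.
    𝔼-coordinate : ∀ {n v} (u : Fin v) (g : Ω n v → Fin (suc n)) → (∀ {x y} → (∀ i → i ≢ u → lookup x i ≡ lookup y i) → g x ≡ g y) →
      𝔼 (λ y → ind ⌊ lookup y u ≟ g y ⌋) ≤ recip n
    𝔼-coordinate {n} {suc v} zero g indep = ≤-reflexive (begin
      avg (λ a → 𝔼 (λ y → ind ⌊ a ≟ g (a ∷ y) ⌋))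
        ≡⟨ Φ-cong avg-linear (λ a → 𝔼-cong (λ y → cong (λ b → ind ⌊ a ≟ b ⌋) (indep {a ∷ y} {zero ∷ y} (others a y)))) ⟩
      avg (λ a → 𝔼 (λ y → ind ⌊ a ≟ g (zero ∷ y) ⌋)) ≡⟨ sym (avg-swap 𝔼-linear (λ a y → ind ⌊ a ≟ g (zero ∷ y) ⌋)) ⟩
      𝔼 (λ y → recip n * sumF (λ a → ind ⌊ a ≟ g (zero ∷ y) ⌋))
        ≡⟨ 𝔼-cong (λ y → trans (cong (recip n *_) (sumF-point (g (zero ∷ y)))) (*-identityʳ (recip n))) ⟩
      𝔼 {n} {v} (λ _ → recip n) ≡⟨ 𝔼-const {n} {v} (recip n) ⟩
      recip n ∎)
      where
      open ≡-Reasoning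
      others : ∀ a (y : Ω n v) i → i ≢ zero → lookup (a ∷ y) i ≡ lookup (zero ∷ y) i
      others a y zero h = contradiction refl h
      others a y (suc i) h = refl
    𝔼-coordinate {n} {suc v} (suc u) g indep = ≤-trans (avg-mono (λ a → 𝔼-coordinate u (λ y → g (a ∷ y)) (λ {x} {y} h → indep {a ∷ x} {a ∷ y} (extended a h))))
      (≤-reflexive (avg-const (recip n)))
      where
      extended : ∀ a {x y : Ω n v} → (∀ i → i ≢ u → lookup x i ≡ lookup y i) → ∀ i → i ≢ suc u → lookup (a ∷ x) i ≡ lookup (a ∷ y) i
      extended a h zero _ = refl
      extended a h (suc i) ne = h i (λ e → ne (cong suc e))

    𝔼-cylinder : ∀ {n v} (J : Subset v) (y : Ω n v) {f : Ω n v → ℚ} → (∀ z → 0ℚ ≤ f z) → (∀ z → z ≈[ J ] y → 1ℚ ≤ f z) →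
      recip n ^ℚ ∣ J ∣ ≤ 𝔼 f
    𝔼-cylinder [] [] f≥0 h = h [] (λ ())
    𝔼-cylinder {n} (true ∷ J) (a ∷ y) {f} f≥0 h = *-monoˡ (<⇒≤ (0<recip n))
      (≤-trans (𝔼-cylinder J y (λ z → f≥0 (a ∷ z)) (λ z e → h (a ∷ z) (λ { zero _ → refl ; (suc i) (there m) → e i m })))
        (term≤sumF (λ b → 𝔼-nonneg (λ z → f≥0 (b ∷ z))) a))
    𝔼-cylinder {n} (false ∷ J) (a ∷ y) {f} f≥0 h = ≤-trans (≤-reflexive (sym (avg-const _)))
      (avg-mono (λ b → 𝔼-cylinder J y (λ z → f≥0 (b ∷ z)) (λ z e → h (b ∷ z) (λ { (suc i) (there m) → e i m }))))

  ¬¬-Dec : ∀ {A : Set} → ¬ ¬ Dec A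
  ¬¬-Dec k = k (no (λ a → k (yes a)))

  ¬¬-Dec-Subset : ∀ {v} (A : Subset v → Set) → ¬ ¬ (∀ S → Dec (A S))
  ¬¬-Dec-Subset {zero} A k = ¬¬-Dec {A []} λ d → k λ { [] → d }
  ¬¬-Dec-Subset {suc v} A k = ¬¬-Dec-Subset (λ S → A (true ∷ S)) λ d → ¬¬-Dec-Subset (λ S → A (false ∷ S)) λ d′ →
    k λ { (true ∷ S) → d S ; (false ∷ S) → d′ S }

  ¬¬-Dec-Fin : ∀ {n} (A : Fin n → Set) → ¬ ¬ (∀ i → Dec (A i))
  ¬¬-Dec-Fin {zero} A k = k λ ()
  ¬¬-Dec-Fin {suc n} A k = ¬¬-Dec {A zero} λ d → ¬¬-Dec-Fin (A ∘ suc) λ d′ → k λ { zero → d ; (suc i) → d′ i }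

  sumL-linear : ∀ {A : Set} (as : List A) → Linear (sumL as)
  sumL-linear [] = record { Φ-cong = λ _ → refl ; Φ-+ = λ _ _ → refl ; Φ-* = λ c _ → sym (*-zeroʳ c) }
  sumL-linear (a ∷ as) = record
    { Φ-cong = λ h → cong₂ _+_ (h a) (Φ-cong (sumL-linear as) h)
    ; Φ-+ = λ f g → trans (cong (f a + g a +_) (Φ-+ (sumL-linear as) f g))
        (solve 4 (λ a b c d → a :+ b :+ (c :+ d) := a :+ c :+ (b :+ d)) refl (f a) (g a) (sumL as f) (sumL as g))
    ; Φ-* = λ c f → trans (cong (c * f a +_) (Φ-* (sumL-linear as) c f)) (sym (*-distribˡ-+ c (f a) (sumL as f)))
    }

  sumL-at-most-one : ∀ {A : Set} {as : List A} {f : A → Bool} → Unique as → (∀ {a b} → f a ≡ true → f b ≡ true → a ≡ b) → sumL as (ind ∘ f) ≤ 1ℚ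
  sumL-at-most-one {as = []} _ _ = 0≤1
  sumL-at-most-one {as = a ∷ as} {f} (a∉ ∷ u) h with f a in eq
  ... | false = ≤-trans (≤-reflexive (+-identityˡ _)) (sumL-at-most-one u h)
  ... | true = ≤-trans (+-monoʳ-≤ 1ℚ (≤-trans (sumL-≤ as rest) (≤-reflexive (trans (sumL-const as 0ℚ) (*-zeroʳ (nat (length as))))))) (≤-reflexive (+-identityʳ 1ℚ))
    where
    rest : ∀ b → b ∈ as → ind (f b) ≤ 0ℚ
    rest b m with f b in eq′
    ... | false = ≤-refl
    ... | true = contradiction (h eq eq′) (All.lookup a∉ m)

  lookup-unique : ∀ {A : Set} {as : List A} → Unique as → ∀ {i j} → List.lookup as i ≡ List.lookup as j → i ≡ j
  lookup-unique (_ ∷ _) {zero} {zero} _ = refl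
  lookup-unique (a∉ ∷ _) {zero} {suc j} e = contradiction e (All.lookup a∉ (∈-lookup j))
  lookup-unique (a∉ ∷ _) {suc i} {zero} e = contradiction (sym e) (All.lookup a∉ (∈-lookup i))
  lookup-unique (_ ∷ u) {suc i} {suc j} e = cong suc (lookup-unique u e)

  filter-split : ∀ {A : Set} {P : A → Set} (P? : ∀ a → Dec (P a)) as → length as ≡ length (filter (λ a → ¬? (P? a)) as) ℕ.+ length (filter P? as)
  filter-split P? [] = refl
  filter-split P? (a ∷ as) with P? a
  ... | yes _ = trans (cong suc (filter-split P? as)) (sym (ℕₚ.+-suc _ _))
  ... | no _ = cong suc (filter-split P? as)

  nat-^ : ∀ n k → recip n ^ℚ k * nat (suc n ℕ.^ k) ≡ 1ℚ
  nat-^ n zero = trans (*-identityˡ (1ℚ + 0ℚ)) (+-identityʳ 1ℚ)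
  nat-^ n (suc k) = begin
    recip n * (recip n ^ℚ k) * nat (suc n ℕ.* (suc n ℕ.^ k)) ≡⟨ cong (recip n * (recip n ^ℚ k) *_) (nat-* (suc n) (suc n ℕ.^ k)) ⟩
    recip n * (recip n ^ℚ k) * (nat (suc n) * nat (suc n ℕ.^ k))
      ≡⟨ solve 4 (λ r p m q → r :* p :* (m :* q) := (r :* m) :* (p :* q)) refl (recip n) (recip n ^ℚ k) (nat (suc n)) (nat (suc n ℕ.^ k)) ⟩
    (recip n * nat (suc n)) * (recip n ^ℚ k * nat (suc n ℕ.^ k)) ≡⟨ cong₂ _*_ (recip-inv n) (nat-^ n k) ⟩
    1ℚ * 1ℚ ≡⟨ *-identityˡ 1ℚ ⟩
    1ℚ ∎
    where open ≡-Reasoning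

  _≟S_ : ∀ {n} (S T : Subset n) → Dec (S ≡ T)
  _≟S_ = Vec-≡-dec Bool._≟_

  module Coloured {F : Hypergraph} (F? : ∀ f → Dec (E F f)) {n a : ℕ} (P : Packing F (suc n) a) where

    InCopy : Fin a → Subset (suc n) → Set
    InCopy i T = Σ (Subset (V F)) λ f → E F f × T ≡ image (emb P i) f

    InCopy? : ∀ i T → Dec (InCopy i T)
    InCopy? i T = anySubset? (λ f → F? f ×-dec (T ≟S image (emb P i) f))

    InCopy-unique : ∀ {i j T} → InCopy i T → InCopy j T → i ≡ j
    InCopy-unique {i} {j} (f , Ef , e) (f′ , Ef′ , e′) with i ≟ j
    ... | yes p = p
    ... | no i≢j = contradiction (trans (sym e) e′) (disj P i j i≢j f f′ Ef Ef′)

    R : Subset (suc n) → Set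
    R T = Σ (Fin a) λ i → InCopy i T

    R? : ∀ T → Dec (R T)
    R? T = any? (λ i → InCopy? i T)

    module Collisions (H : Hypergraph) {k : ℕ} (H-uniform : Uniform k H) where

      v = V H

      -- The value `zero` for a set in no copy can only create spurious collisions, and these are
      -- covered by the same probability bound.
      vertex : ∀ {T} → Fin (V F) → Dec (R T) → Fin (suc n)
      vertex w (yes (i , _)) = emb P i w
      vertex w (no _) = zero

      vertices-meet : Fin v × Fin v → Ω n v → Bool
      vertices-meet (i , j) y = not ⌊ i ≟ j ⌋ ∧ ⌊ lookup y i ≟ lookup y j ⌋

      -- If two distinct edges of `H` get one colour, some `u` in the second and outside the first,
      -- `J`, is sent to a vertex of the copy through the image of `J`. That copy is determined by
      -- the coordinates in `J`, so each of its vertices is hit by coordinate `u` with probability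
      -- `recip n`.
      copy-hit : Subset v × Fin v × Fin (V F) → Ω n v → Bool
      copy-hit (J , u , w) y = not ⌊ u ∈? J ⌋ ∧ ⌊ lookup y u ≟ vertex w (R? (image (lookup y) J)) ⌋

      pairs : List (Fin v × Fin v)
      pairs = cartesianProduct (allFin v) (allFin v)

      triples : List (Subset v × Fin v × Fin (V F))
      triples = cartesianProduct (allSubsets v) (cartesianProduct (allFin v) (allFin (V F)))

      collision : Ω n v → Bool
      collision y = anyB (λ p → vertices-meet p y) pairs ∨ anyB (λ t → copy-hit t y) triples

      collisions# : ℕ
      collisions# = v ℕ.* v ℕ.+ subsets# v ℕ.* (v ℕ.* V F)

      pairs-length : length pairs ≡ v ℕ.* v
      pairs-length = trans (length-cartesianProduct (allFin v) (allFin v)) (cong₂ ℕ._*_ (length-tabulate {n = v} (λ i → i)) (length-tabulate {n = v} (λ i → i)))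

      triples-length : length triples ≡ subsets# v ℕ.* (v ℕ.* V F)
      triples-length = trans (length-cartesianProduct (allSubsets v) (cartesianProduct (allFin v) (allFin (V F))))
        (cong (subsets# v ℕ.*_) (trans (length-cartesianProduct (allFin v) (allFin (V F))) (cong₂ ℕ._*_ (length-tabulate {n = v} (λ i → i)) (length-tabulate {n = V F} (λ i → i)))))

      𝔼-guarded : ∀ {A : Set} (d : Dec A) {b : Ω n v → Bool} {c} → 0ℚ ≤ c → (¬ A → 𝔼 (ind ∘ b) ≤ c) → 𝔼 (λ y → ind (not ⌊ d ⌋ ∧ b y)) ≤ c
      𝔼-guarded (yes _) c≥0 h = ≤-trans (≤-reflexive (𝔼-const {n} {v} 0ℚ)) c≥0
      𝔼-guarded (no na) c≥0 h = h na

      vertices-meet-small : ∀ p → 𝔼 (ind ∘ vertices-meet p) ≤ recip n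
      vertices-meet-small (i , j) = 𝔼-guarded (i ≟ j) (<⇒≤ (0<recip n)) λ i≢j →
        𝔼-coordinate i (λ y → lookup y j) (λ h → h j (λ e → i≢j (sym e)))

      copy-hit-small : ∀ t → 𝔼 (ind ∘ copy-hit t) ≤ recip n
      copy-hit-small (J , u , w) = 𝔼-guarded (u ∈? J) (<⇒≤ (0<recip n)) λ u∉ →
        𝔼-coordinate u (λ y → vertex w (R? (image (lookup y) J)))
          (λ h → cong (λ T → vertex w (R? T)) (image-cong {S = J} (λ i m → h i (λ e → u∉ (subst (_∈ₛ J) e m)))))

      collision-small : 𝔼 (ind ∘ collision) ≤ nat collisions# * recip n
      collision-small = begin
        𝔼 (ind ∘ collision) ≤⟨ 𝔼-mono (λ y → ind-∨ (anyB (λ p → vertices-meet p y) pairs) (anyB (λ t → copy-hit t y) triples)) ⟩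
        𝔼 (λ y → ind (anyB (λ p → vertices-meet p y) pairs) + ind (anyB (λ t → copy-hit t y) triples)) ≡⟨ 𝔼-+ _ _ ⟩
        𝔼 (λ y → ind (anyB (λ p → vertices-meet p y) pairs)) + 𝔼 (λ y → ind (anyB (λ t → copy-hit t y) triples))
          ≤⟨ +-mono-≤ (𝔼-union pairs {F = λ p → ind ∘ vertices-meet p} (recip n) (λ y → ind-anyB pairs) (λ p _ → vertices-meet-small p))
                       (𝔼-union triples {F = λ t → ind ∘ copy-hit t} (recip n) (λ y → ind-anyB triples) (λ t _ → copy-hit-small t)) ⟩
        nat (length pairs) * recip n + nat (length triples) * recip n
          ≡⟨ cong₂ (λ p t → nat p * recip n + nat t * recip n) pairs-length triples-length ⟩
        nat (v ℕ.* v) * recip n + nat (subsets# v ℕ.* (v ℕ.* V F)) * recip n ≡⟨ sym (*-distribʳ-+ (recip n) (nat (v ℕ.* v)) (nat (subsets# v ℕ.* (v ℕ.* V F)))) ⟩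
        (nat (v ℕ.* v) + nat (subsets# v ℕ.* (v ℕ.* V F))) * recip n ≡⟨ cong (_* recip n) (sym (nat-+ (v ℕ.* v) _)) ⟩
        nat collisions# * recip n ∎
        where open ≤-Reasoning

      no-collision⇒rainbow : ∀ {y} → Hom (E H) R y → collision y ≡ false → Rainbow H P
      no-collision⇒rainbow {y} hom none = record
        { ψ = lookup y
        ; ψ-inj = injective
        ; col = λ e p → proj₁ (hom e p)
        ; fedge = λ e p → proj₁ (proj₂ (hom e p))
        ; fedgeE = λ e p → proj₁ (proj₂ (proj₂ (hom e p)))
        ; match = λ e p → proj₂ (proj₂ (proj₂ (hom e p)))
        ; col-inj = colours-distinct
        }
        where
        none₁ = proj₁ (∨-false {anyB (λ p → vertices-meet p y) pairs} none)
        none₂ = proj₂ (∨-false {anyB (λ p → vertices-meet p y) pairs} none)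
        refute : ∀ {A B : Set} (d : Dec A) (d′ : Dec B) → ¬ A → not ⌊ d ⌋ ∧ ⌊ d′ ⌋ ≡ false → ¬ B
        refute (yes a) _ na _ _ = na a
        refute (no _) (no nb) _ _ b = nb b
        injective : Injective _≡_ _≡_ (lookup y)
        injective {i} {j} e with i ≟ j in eq
        ... | yes p = p
        ... | no i≢j = contradiction e (refute (i ≟ j) (lookup y i ≟ lookup y j) i≢j
          (anyB-∉ {as = pairs} none₁ (∈-cartesianProduct⁺ (∈-allFin i) (∈-allFin j))))
        colours-distinct : ∀ e p e′ p′ → proj₁ (hom e p) ≡ proj₁ (hom e′ p′) → e ≡ e′
        colours-distinct e p e′ p′ same = ⊆-antisym (⊆-card≡ e′⊆e (ℕₚ.≤-reflexive (trans (H-uniform e p) (sym (H-uniform e′ p′))))) e′⊆e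
          where
          e′⊆e : e′ ⊆ e
          e′⊆e {u} u∈ with u ∈? e
          ... | yes m = m
          ... | no u∉ = contradiction hit (refute (u ∈? e) (lookup y u ≟ vertex w (R? (image (lookup y) e))) u∉
              (anyB-∉ {as = triples} none₂ (∈-cartesianProduct⁺ (∈-allSubsets e) (∈-cartesianProduct⁺ (∈-allFin u) (∈-allFin w)))))
            where
            T′ = proj₂ (hom e′ p′)
            preimage = image-∈ {φ = emb P (proj₁ (hom e′ p′))} {S = proj₁ T′}
              (subst (lookup y u ∈ₛ_) (proj₂ (proj₂ T′)) (∈-image {φ = lookup y} u∈))
            w = proj₁ preimage
            at : ∀ (d : Dec (R (image (lookup y) e))) → lookup y u ≡ vertex w d
            -- The decision procedure may find another witness than the given homomorphism;
            -- edge-disjointness makes their colours equal.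
            at (yes (i , c)) = trans (sym (proj₂ (proj₂ preimage)))
              (cong (λ i → emb P i w) (trans (sym same) (InCopy-unique (proj₂ (hom e p)) c)))
            at (no nr) = contradiction (hom e p) nr
            hit : lookup y u ≡ vertex w (R? (image (lookup y) e))
            hit = at (R? (image (lookup y) e))

    module Deletion {v : ℕ} {k : ℕ} (Edge : Subset v → Set) (uniform : ∀ e → Edge e → ∣ e ∣ ≡ k)
      (D : Family n v) (D-meas : MeasurableFamily D) {ε : ℚ} (D-small : ∀ I → 𝔼 (ind ∘ D I) ≤ ε) where

      -- A colour is given up entirely as soon as one of its edges is the image of an edge `e` under
      -- a map in `D e`.
      Hit : Fin a → Set
      Hit i = Σ (Subset v) λ e → Edge e × Σ (Ω n v) λ y → D e y ≡ true × InCopy i (image (lookup y) e)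

      -- Each hit colour occurs in D on a set of measure at least (n + 1) ^ (- k), and the colours are disjoint.
      hits-few : ∀ {is} → Unique is → (∀ {i} → i ∈ is → Hit i) → nat (length is) * (recip n ^ℚ k) ≤ nat (subsets# v) * ε
      hits-few {is} uniq hit = begin
        nat (length is) * (recip n ^ℚ k) ≡⟨ sym (sumL-const is (recip n ^ℚ k)) ⟩
        sumL is (λ _ → recip n ^ℚ k) ≤⟨ sumL-≤ is (λ i m → W-large i (hit m)) ⟩
        sumL is (λ i → 𝔼 (W i)) ≡⟨ sym (sumL-swap 𝔼-linear is W) ⟩
        𝔼 (λ z → sumL is (λ i → W i z)) ≤⟨ 𝔼-union Ss {F = λ J z → ind (D J z)} ε pointwise (λ J _ → D-small J) ⟩
        nat (subsets# v) * ε ∎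
        where
        open ≤-Reasoning
        Ss = allSubsets v
        term : Fin a → Ω n v → Subset v → ℚ
        term i z J = ind (D J z) * ind ⌊ InCopy? i (image (lookup z) J) ⌋
        0≤term : ∀ i z J → 0ℚ ≤ term i z J
        0≤term i z J = 0≤* (0≤ind (D J z)) (0≤ind ⌊ InCopy? i (image (lookup z) J) ⌋)
        W : Fin a → Ω n v → ℚ
        W i z = sumL Ss (term i z)
        W-large : ∀ i → Hit i → recip n ^ℚ k ≤ 𝔼 (W i)
        W-large i (e , Ee , y , Dy , copy) = subst (λ m → recip n ^ℚ m ≤ 𝔼 (W i)) (uniform e Ee)
          (𝔼-cylinder e y (λ z → sumL-nonneg Ss (0≤term i z)) λ z z≈y →
            ≤-trans (≤-reflexive (sym (trans (cong₂ _*_ (cong ind (trans (D-meas e z≈y) Dy))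
                (ind-yes (InCopy? i (image (lookup z) e)) (subst (InCopy i) (sym (image-cong z≈y)) copy))) (*-identityˡ 1ℚ))))
              (term≤sumL (0≤term i z) (∈-allSubsets e)))
        pointwise : ∀ z → sumL is (λ i → W i z) ≤ sumL Ss (λ J → ind (D J z))
        pointwise z = begin
          sumL is (λ i → sumL Ss (term i z)) ≡⟨ sumL-swap (sumL-linear is) Ss (λ J i → term i z J) ⟩
          sumL Ss (λ J → sumL is (λ i → term i z J)) ≤⟨ sumL-≤ Ss (λ J _ → one J) ⟩
          sumL Ss (λ J → ind (D J z)) ∎
          where
          one : ∀ J → sumL is (λ i → term i z J) ≤ ind (D J z)
          one J = ≤-trans (≤-reflexive (Φ-* (sumL-linear is) (ind (D J z)) _)) (≤-trans (*-monoˡ (0≤ind (D J z))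
            (sumL-at-most-one {f = λ i → ⌊ InCopy? i (image (lookup z) J) ⌋} uniq (λ p q → InCopy-unique (⌊⌋-true p) (⌊⌋-true q)))) (≤-reflexive (*-identityʳ (ind (D J z)))))

  restrict : ∀ {F n a} (P : Packing F n a) {is : List (Fin a)} → Unique is → Packing F n (length is)
  restrict P {is} uniq = record
    { emb = λ j → emb P (List.lookup is j)
    ; inj = λ j → inj P (List.lookup is j)
    ; disj = λ i j i≢j → disj P (List.lookup is i) (List.lookup is j) (λ e → i≢j (lookup-unique uniq e))
    }

  -- Blowups

  module Blowup (G : Hypergraph) (s : ℕ) where

    proj : Fin (V G ℕ.* suc s) → Fin (V G)
    proj = proj₁ ∘ remQuot {V G} (suc s)

    proj-combine : ∀ x a → proj (combine x a) ≡ x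
    proj-combine x a = cong proj₁ (remQuot-combine x a)

    blowup-uniform : ∀ {k} → Uniform k G → Uniform k (blowup G (suc s))
    blowup-uniform G-uniform _ (e , Ee , c , refl) = trans (ℕₚ.≤-antisym
      (card-≤ proj proj-inj proj-∈)
      (card-≤ φ (λ {x} {y} _ _ eq → combine-injectiveˡ x (c x) y (c y) eq) (λ m → ∈-image m))) (G-uniform e Ee)
      where
      φ : Fin (V G) → Fin (V G ℕ.* suc s)
      φ x = combine x (c x)
      proj-∈ : ∀ {y} → y ∈ₛ image φ e → proj y ∈ₛ e
      proj-∈ m with image-∈ m
      ... | x , x∈ , refl = subst (_∈ₛ e) (sym (proj-combine x (c x))) x∈
      proj-inj : ∀ {y z} → y ∈ₛ image φ e → z ∈ₛ image φ e → proj y ≡ proj z → y ≡ z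
      proj-inj my mz eq with image-∈ my | image-∈ mz
      ... | x , _ , refl | x′ , _ , refl = cong φ (trans (sym (proj-combine x (c x))) (trans eq (proj-combine x′ (c x′))))

    lift-edge : ∀ {e} → E G e → E (blowup G (suc s)) (image (λ x → combine x zero) e)
    lift-edge {e} Ee = e , Ee , (λ _ → zero) , refl

    -- The vertices with copy number `zero` span a copy of `G` inside the blowup.
    rainbow-blowup⇒rainbow : ∀ {F n c} {P : Packing F n c} → Rainbow (blowup G (suc s)) P → Rainbow G P
    rainbow-blowup⇒rainbow r = record
      { ψ = ψ ∘ base
      ; ψ-inj = λ {x} {y} eq → combine-injectiveˡ x zero y zero (ψ-inj eq)
      ; col = λ e p → col _ (lift-edge p)
      ; fedge = λ e p → fedge _ (lift-edge p)
      ; fedgeE = λ e p → fedgeE _ (lift-edge p)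
      ; match = λ e p → trans (sym (image-∘ {φ = ψ} {base} {e})) (match _ (lift-edge p))
      ; col-inj = λ e p e′ p′ eq → image-injective {φ = base} (λ {x} {y} q → combine-injectiveˡ x zero y zero q) (col-inj _ (lift-edge p) _ (lift-edge p′) eq)
      }
      where
      open Rainbow r
      base : Fin (V G) → Fin (V G ℕ.* suc s)
      base x = combine x zero

  -- Comparison of the two extremal numbers

  module Main (k : ℕ) (G F : Hypergraph) (G-uniform : Uniform k G) (s m : ℕ) where

    open Blowup G s

    H : Hypergraph
    H = blowup G (suc s)

    H-uniform : Uniform k H
    H-uniform = blowup-uniform G-uniform

    M : ℕ
    M = subsets# (V H)

    opaque
      -- By `hits-few` the number of lost colours is at most `nat M * ε` times the `k`-th power of
      -- the number of vertices; `m` times this must not exceed that power.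
      ε : ℚ
      ε = recip (m ℕ.* M)

      ε>0 : 0ℚ < ε
      ε>0 = 0<recip (m ℕ.* M)

      mMε≤1 : nat m * (nat M * ε) ≤ 1ℚ
      mMε≤1 = ≤-trans (≤-reflexive (trans (sym (*-assoc (nat m) (nat M) ε)) (cong (_* ε) (sym (nat-* m M))))) (nat-recip≤1 (m ℕ.* M))

      removed : Σ ℚ λ δ → (0ℚ < δ) × (∀ {Edge} (Edge? : ∀ e → Dec (Edge e)) (uniform : ∀ e → Edge e → ∣ e ∣ ≡ k)
        {n} {R : Subset (suc n) → Set} (R? : ∀ T → Dec (R T)) →
        ¬ ((D : Family n (V H)) → MeasurableFamily D → (∀ I → 𝔼 (ind ∘ D I) ≤ ε) →
           ¬ (∀ x → Hom Edge R x → (∀ e → Edge e → D e x ≡ false) →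
              ∀ (B : Ω n (V H) → Bool) → (∀ y → Hom Edge R y → B y ≡ true) → δ ≤ 𝔼 (ind ∘ B))))
      removed = removal (V H) k ε>0

    δ : ℚ
    δ = proj₁ removed

    collisions : ℕ
    collisions = V H ℕ.* V H ℕ.+ M ℕ.* (V H ℕ.* V F)

    opaque
      -- From this many vertices on, the collisions have measure below the `δ` of the removal lemma.
      threshold : Σ ℕ λ N → nat collisions < nat N * δ
      threshold = archimedean (proj₁ (proj₂ removed)) (nat collisions)

    collisions-rare : ∀ {n} → proj₁ threshold ℕ.≤ suc n → nat collisions * recip n < δ
    collisions-rare {n} N≤ = subst (nat collisions * recip n <_) eq (*-monoˡ-<-pos (recip n) {{positive (0<recip n)}}
      (<-≤-trans (proj₂ threshold) (*-monoʳ (<⇒≤ (proj₁ (proj₂ removed))) (nat-mono N≤))))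
      where
      eq : nat (suc n) * δ * recip n ≡ δ
      eq = trans (solve 3 (λ n d r → n :* d :* r := d :* (r :* n)) refl (nat (suc n)) δ (recip n)) (trans (cong (δ *_) (recip-inv n)) (*-identityʳ δ))

    module _ {n : ℕ} (N≤ : proj₁ threshold ℕ.≤ suc n) {a b : ℕ} (exH : IsEx F H (suc n) a) (exG : IsEx F G (suc n) b) where

      lower-bound : b ℕ.≤ a
      lower-bound = proj₂ exH b (proj₁ (proj₁ exG)) (λ r → proj₂ (proj₁ exG) (rainbow-blowup⇒rainbow r))

      P : Packing F (suc n) a
      P = proj₁ (proj₁ exH)

      module _ (H? : ∀ e → Dec (E H e)) (F? : ∀ f → Dec (E F f)) where

        open Coloured F? P
        open Collisions H H-uniform

        module _ (D : Family n (V H)) (D-meas : MeasurableFamily D) (D-small : ∀ I → 𝔼 (ind ∘ D I) ≤ ε)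
          (rich : ∀ x → Hom (E H) R x → (∀ e → E H e → D e x ≡ false) →
            ∀ (B : Ω n (V H) → Bool) → (∀ y → Hom (E H) R y → B y ≡ true) → δ ≤ 𝔼 (ind ∘ B)) where

          open Deletion (E H) H-uniform D D-meas D-small

          hom-collides : ∀ y → Hom (E H) R y → collision y ≡ true
          hom-collides y hom with collision y in eq
          ... | true = refl
          ... | false = contradiction (no-collision⇒rainbow {y} hom eq) (proj₂ (proj₁ exH))

          module _ (Hit? : ∀ i → Dec (Hit i)) where

            kept hits : List (Fin a)
            kept = filter (λ i → ¬? (Hit? i)) (allFin a)
            hits = filter Hit? (allFin a)

            a≡ : a ≡ length kept ℕ.+ length hits
            a≡ = trans (sym (length-tabulate {n = a} (λ i → i))) (filter-split Hit? (allFin a))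

            kept-unique : Unique kept
            kept-unique = Uniqueₚ.filter⁺ (λ i → ¬? (Hit? i)) (Uniqueₚ.allFin⁺ a)

            -- Composed with `proj`, a rainbow copy of `G` in the kept colours becomes a
            -- homomorphism from `H`. It avoids `D`, since otherwise one of its colours would be
            -- hit. By `rich` the homomorphisms, all of which collide, then have measure at least
            -- `δ`, more than collisions can have.
            kept-rainbow-free : ¬ Rainbow G (restrict P kept-unique)
            kept-rainbow-free r = <-irrefl refl (<-≤-trans (collisions-rare N≤)
              (≤-trans (rich x hom avoid collision hom-collides) collision-small))
              where
              open Rainbow r
              x : Ω n (V H)
              x = tabulate (ψ ∘ proj)
              colour : ∀ {e} → E G e → Fin a
              colour {e} p = List.lookup kept (col e p)
              copy : ∀ {T} (h : E H T) → InCopy (colour (proj₁ (proj₂ h))) (image (lookup x) T)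
              copy (e , Ee , c , refl) = fedge e Ee , fedgeE e Ee , trans
                (trans (image-∘ {φ = lookup x} {λ z → combine z (c z)} {e})
                  (image-cong {S = e} (λ z _ → trans (lookup∘tabulate (ψ ∘ proj) (combine z (c z))) (cong ψ (proj-combine z (c z))))))
                (match e Ee)
              hom : Hom (E H) R x
              hom T h = colour (proj₁ (proj₂ h)) , copy h
              avoid : ∀ T → E H T → D T x ≡ false
              avoid T h with D T x in eq
              ... | false = refl
              ... | true = contradiction (T , h , x , eq , copy h)
                (proj₂ (∈-filter⁻ (λ i → ¬? (Hit? i)) {xs = allFin a} (∈-lookup (col (proj₁ h) (proj₁ (proj₂ h))))))

            m-hits≤ : m ℕ.* length hits ℕ.≤ suc n ℕ.^ k
            m-hits≤ = ≤-nat-cancel (begin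
              nat (m ℕ.* length hits) ≡⟨ nat-* m (length hits) ⟩
              nat m * nat (length hits) ≡⟨ sym (trans (cong (nat m * nat (length hits) *_) (nat-^ n k)) (*-identityʳ _)) ⟩
              nat m * nat (length hits) * (recip n ^ℚ k * nat (suc n ℕ.^ k))
                ≡⟨ solve 4 (λ m h r q → m :* h :* (r :* q) := m :* (h :* r) :* q) refl (nat m) (nat (length hits)) (recip n ^ℚ k) (nat (suc n ℕ.^ k)) ⟩
              nat m * (nat (length hits) * recip n ^ℚ k) * nat (suc n ℕ.^ k)
                ≤⟨ *-monoʳ (0≤nat (suc n ℕ.^ k)) (≤-trans (*-monoˡ (0≤nat m)
                     (hits-few (Uniqueₚ.filter⁺ Hit? (Uniqueₚ.allFin⁺ a)) (λ i∈ → proj₂ (∈-filter⁻ Hit? {xs = allFin a} i∈)))) mMε≤1) ⟩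
              1ℚ * nat (suc n ℕ.^ k) ≡⟨ *-identityˡ (nat (suc n ℕ.^ k)) ⟩
              nat (suc n ℕ.^ k) ∎)
              where open ≤-Reasoning

            upper-bound′ : m ℕ.* a ℕ.≤ m ℕ.* b ℕ.+ suc n ℕ.^ k
            upper-bound′ = begin
              m ℕ.* a ≡⟨ cong (m ℕ.*_) a≡ ⟩
              m ℕ.* (length kept ℕ.+ length hits) ≡⟨ ℕₚ.*-distribˡ-+ m (length kept) (length hits) ⟩
              m ℕ.* length kept ℕ.+ m ℕ.* length hits
                ≤⟨ ℕₚ.+-mono-≤ (ℕₚ.*-monoʳ-≤ m (proj₂ exG (length kept) (restrict P kept-unique) kept-rainbow-free)) m-hits≤ ⟩
              m ℕ.* b ℕ.+ suc n ℕ.^ k ∎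
              where open ℕₚ.≤-Reasoning

      upper-bound : m ℕ.* a ℕ.≤ m ℕ.* b ℕ.+ suc n ℕ.^ k
      upper-bound with m ℕ.* a ℕₚ.≤? m ℕ.* b ℕ.+ suc n ℕ.^ k
      ... | yes p = p
      ... | no np = ⊥-elim (¬¬-Dec-Subset (E H) λ H? → ¬¬-Dec-Subset (E F) λ F? →
        proj₂ (proj₂ removed) H? H-uniform (Coloured.R? F? P) λ D D-meas D-small rich →
          ¬¬-Dec-Fin (Coloured.Deletion.Hit F? P (E H) H-uniform D D-meas D-small) λ Hit? →
            np (upper-bound′ H? F? D D-meas D-small rich Hit?))

open import Data.Nat using (ℕ; suc; _≤_; _+_; _*_; _^_)
open import Data.Nat.Properties using (≤-trans; n≤1+n; m≤m+n; *-monoʳ-≤)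
open import Data.Product using (Σ; _×_; _,_; proj₁)

theorem1p10 : (k : ℕ) → 2 ≤ k → (G F : Hypergraph) → Uniform k G → Uniform k F →
    (s : ℕ) → 1 ≤ s →
    (m : ℕ) → 1 ≤ m →
    Σ ℕ λ N → (n : ℕ) → N ≤ n → (a b : ℕ) →
    IsEx F (blowup G s) n a → IsEx F G n b →
    (m * a ≤ m * b + n ^ k) × (m * b ≤ m * a + n ^ k)
-- The shift of the threshold by one excludes `n = 0`, so that the vertex set has the form
-- `Fin (suc n)`.
theorem1p10 k _ G F G-uniform _ (suc s) _ m _ = suc (proj₁ threshold) , λ
  { (suc n) N≤ a b exH exG → upper-bound (≤-trans (n≤1+n _) N≤) exH exG ,
      ≤-trans (*-monoʳ-≤ m (lower-bound (≤-trans (n≤1+n _) N≤) exH exG)) (m≤m+n (m * a) (suc n ^ k)) }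
  where open Removal.Main k G F G-uniform s m
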